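{- Let $k \geq 1$ be an integer, let $\ell \in \{1,2,3\}$, and let $G$ be a connected graph with exactly $m$ edges that is not a $k$-clique (i.e. not isomorphic to $K_k$). Then \[\iota(G, \mathcal{F}_{\ell,k}) \leq \frac{m+1}{\binom{k}{2}+2}.\] Moreover: (i) Equality holds if and only if $G$ is a pure $(m,k)$-special graph, or $k=2$ and $G$ is a $5$-cycle, or $k=3$, $\ell \in \{1,3\}$ and $G$ is a $4$-cycle. (ii) If $G$ is an $(m,k)$-special graph, then $\iota(G,\mathcal{F}_{\ell,k}) = \left\lfloor (m+1)/\left(\binom{k}{2}+2\right)\right\rfloor$.
   Context: All graphs are finite and simple. For a graph $G$ and $X \subseteq V(G)$, $N_G[X]$ is the closed neighbourhood $\bigcup_{v\in X}(\{v\}\cup N_G(v))$, and $G - N_G[X]$ is the graph obtained from $G$ by deleting the vertices of $N_G[X]$. For a set $\mathcal{F}$ of graphs, an $\mathcal{F}$-graph is a graph isomorphic to a member of $\mathcal{F}$; a set $D \subseteq V(G)$ is $\mathcal{F}$-isolating if $G - N_G[D]$ has no subgraph that is an $\mathcal{F}$-graph; $\iota(G,\mathcal{F})$ is the minimum size of an $\mathcal{F}$-isolating set of $G$. For an integer $k\ge 1$: $\mathcal{F}_{1,k}$ is the set of (nonempty) regular graphs whose degree is at least $k-1$; $\mathcal{F}_{2,k}$ is the set of graphs with chromatic number at least $k$; $\mathcal{F}_{3,k}=\mathcal{F}_{1,k}\cup\mathcal{F}_{2,k}$. A $k$-clique is a copy of $K_k$; an $n$-cycle is a copy of $C_n$.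 $(m,k)$-special graphs: let $m,k\in\mathbb{N}$, $t_k=\binom{k}{2}+2$, and write $m+1 = q t_k + r$ with integers $q\ge 0$, $0\le r\le t_k-1$. If $q\ge1$, let $v_1,\dots,v_q$ be distinct vertices, let $U_1,\dots,U_q$ be pairwise disjoint $k$-element sets disjoint from $\{v_1,\dots,v_q\}$, and for each $i$ let $u_i^1\in U_i$ and let $G_i$ be the graph with vertex set $U_i\cup\{v_i\}$ and edge set $\binom{U_i}{2}\cup\{u_i^1v_i\}$ (a $k$-clique plus a pendant edge to $v_i$). A graph $G$ is an $(m,k)$-special graph if either $q=0$ and $G$ is a tree with $r$ edges, or $q\ge 1$ and $G$ has vertex set $V(T')\cup\bigcup_{i=1}^q V(G_i)$ and edge set $E(T)\cup E(T')\cup\bigcup_{i=1}^q E(G_i)$, where $T$ is a tree with vertex set $\{v_1,\dots,v_q\}$ and $T'$ is a tree with $r$ edges such that $V(T')\cap\bigcup_{i=1}^q V(G_i)=\{v_q\}$. The $G_i$ are called the $k$-clique constituents of $G$. It is pure if $r=0$. -}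

module Defs where

open import Data.Nat using (ℕ; zero; suc; _+_; _*_; _∸_; _≤_; _<_; _≡ᵇ_)
open import Data.Nat.DivMod using (_/_; _%_)
open import Data.Nat.Combinatorics using (_C_)
open import Data.Fin using (Fin; toℕ; fromℕ)
import Data.Fin as Fin
open import Data.Fin.Subset using (Subset; _∈_; _∉_)
open import Data.Bool using (Bool; true; false; not; _∧_; _∨_; if_then_else_)
open import Data.Bool.Properties using (∨-comm)
open import Data.Product using (Σ; ∃; ∃-syntax; _×_; _,_)
open import Data.Sum using (_⊎_)
open import Relation.Nullary using (¬_; yes; no)
open import Relation.Binary.PropositionalEquality using (_≡_; _≢_; refl; sym; cong)
open import Function.Bundles using (_↔_; Inverse)
open import Function.Definitions using (Injective)

record Graph (n : ℕ) : Set where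
  field
    adj    : Fin n → Fin n → Bool
    adjSym : ∀ i j → adj i j ≡ adj j i
    loopless : ∀ i → adj i i ≡ false
open Graph public

Edge : ∀ {n} → Graph n → Fin n → Fin n → Set
Edge G i j = adj G i j ≡ true

mkGraph : ∀ {n} → (Fin n → Fin n → Bool) → Graph n
mkGraph {n} R = record { adj = A ; adjSym = S ; loopless = L }
  where
  A : Fin n → Fin n → Bool
  A i j with i Fin.≟ j
  ... | yes _ = false
  ... | no  _ = R i j ∨ R j i
  S : ∀ i j → A i j ≡ A j i
  S i j with i Fin.≟ j | j Fin.≟ i
  ... | yes _ | yes _ = refl
  ... | yes p | no ¬q = Data.Empty.⊥-elim (¬q (sym p))
    where import Data.Empty
  ... | no ¬p | yes q = Data.Empty.⊥-elim (¬p (sym q))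
    where import Data.Empty
  ... | no _  | no _  = ∨-comm (R i j) (R j i)
  L : ∀ i → A i i ≡ false
  L i with i Fin.≟ i
  ... | yes _ = refl
  ... | no ¬p = Data.Empty.⊥-elim (¬p refl)
    where import Data.Empty

K : (k : ℕ) → Graph k
K k = mkGraph (λ _ _ → true)

Cyc : (j : ℕ) → Graph (3 + j)
Cyc j = mkGraph (λ a b → ((suc (toℕ a)) % (3 + j)) ≡ᵇ toℕ b)

C4 : Graph 4
C4 = Cyc 1

C5 : Graph 5
C5 = Cyc 2

∑ : ∀ {n} → (Fin n → ℕ) → ℕ
∑ {zero}  f = 0
∑ {suc n} f = f Fin.zero + ∑ (λ i → f (Fin.suc i))

edgeCount : ∀ {n} → Graph n → ℕ
edgeCount G = ∑ (λ i → ∑ (λ j →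
  if (suc (toℕ i) Data.Nat.≤ᵇ toℕ j) ∧ adj G i j then 1 else 0))

degree : ∀ {n} → Graph n → Fin n → ℕ
degree G i = ∑ (λ j → if adj G i j then 1 else 0)

Iso : ∀ {n n'} → Graph n → Graph n' → Set
Iso {n} {n'} G H = Σ (Fin n ↔ Fin n') λ f →
  ∀ a b → adj G a b ≡ adj H (Inverse.to f a) (Inverse.to f b)

-- an injective edge-preserving map H → G, i.e. G has a subgraph isomorphic to H
Embedding : ∀ {h n} → Graph h → Graph n → Set
Embedding {h} {n} H G = Σ (Fin h → Fin n) λ f →
  Injective _≡_ _≡_ f × (∀ a b → Edge H a b → Edge G (f a) (f b))

data Reach {n} (G : Graph n) : Fin n → Fin n → Set where
  here : ∀ {u} → Reach G u u
  step : ∀ {u v w} → Edge G u v → Reach G v w → Reach G u w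

Connected : ∀ {n} → Graph n → Set
Connected {n} G = 1 ≤ n × (∀ u v → Reach G u v)

Acyclic : ∀ {n} → Graph n → Set
Acyclic G = ∀ j → ¬ Embedding (Cyc j) G

IsTree : ∀ {n} → Graph n → Set
IsTree G = Connected G × Acyclic G

GraphClass : Set₁
GraphClass = ∀ {h} → Graph h → Set

Regular : ∀ {h} → Graph h → ℕ → Set
Regular H d = ∀ a → degree H a ≡ d

Colourable : ℕ → ∀ {h} → Graph h → Set
Colourable c {h} H = Σ (Fin h → Fin c) λ f → ∀ a b → Edge H a b → f a ≢ f b

ChromaticAtLeast : ℕ → ∀ {h} → Graph h → Set
ChromaticAtLeast k H = ∀ c → c Data.Nat.< k → ¬ Colourable c H

𝓕₁ : ℕ → GraphClass
𝓕₁ k {h} H = 1 ≤ h × Σ ℕ λ d → (k ∸ 1 ≤ d) × Regular H d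

𝓕₂ : ℕ → GraphClass
𝓕₂ k H = ChromaticAtLeast k H

𝓕₃ : ℕ → GraphClass
𝓕₃ k H = 𝓕₁ k H ⊎ 𝓕₂ k H

-- F_{ℓ,k} for ℓ ∈ {1,2,3} (other ℓ never used)
𝓕 : ℕ → ℕ → GraphClass
𝓕 1 k = 𝓕₁ k
𝓕 2 k = 𝓕₂ k
𝓕 _ k = 𝓕₃ k

InClosedNbhd : ∀ {n} → Graph n → Subset n → Fin n → Set
InClosedNbhd G D x = ∃[ d ] (d ∈ D × (x ≡ d ⊎ Edge G d x))

-- G - N[D] has no subgraph that is an F-graph
Isolating : ∀ {n} → Graph n → GraphClass → Subset n → Set
Isolating G F D = ∀ {h} (H : Graph h) (e : Embedding H G) →
  (∀ a → ¬ InClosedNbhd G D (Data.Product.proj₁ e a)) → ¬ F H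

IsIota : ∀ {n} → Graph n → GraphClass → ℕ → Set
IsIota G F i =
  (∃[ D ] (Isolating G F D × Data.Fin.Subset.∣ D ∣ ≡ i)) ×
  (∀ D → Isolating G F D → i ≤ Data.Fin.Subset.∣ D ∣)

t : ℕ → ℕ
t k = 2 + k C 2

-- the edge relation E(T) ∪ E(T') ∪ ⋃ E(G_i) expressed on the vertices of G
SpecEdge : ∀ {k q p n} → (v : Fin q → Fin n) → (U : Fin q → Fin k → Fin n) →
  (u1 : Fin q → Fin k) → Graph q → (w : Fin p → Fin n) → Graph p →
  Fin n → Fin n → Set
SpecEdge v U u1 T w T' x y =
    (∃[ a ] ∃[ b ] (x ≡ v a × y ≡ v b × Edge T a b))
  ⊎ (∃[ a ] ∃[ b ] (x ≡ w a × y ≡ w b × Edge T' a b))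
  ⊎ (∃[ i ] ∃[ a ] ∃[ b ] (x ≡ U i a × y ≡ U i b × a ≢ b))
  ⊎ (∃[ i ] ((x ≡ U i (u1 i) × y ≡ v i) ⊎ (x ≡ v i × y ≡ U i (u1 i))))

-- Structure for q = suc q' ≥ 1 (clique constituents G_i), r = |E(T')|
record SpecialStruct (k q' r : ℕ) {n} (G : Graph n) : Set where
  field
    v   : Fin (suc q') → Fin n
    U   : Fin (suc q') → Fin k → Fin n          -- U_i = image of U i (k elements)
    u1  : Fin (suc q') → Fin k                  -- u_i^1 = U i (u1 i)
    v-inj  : Injective _≡_ _≡_ v
    U-inj  : ∀ i a j b → U i a ≡ U j b → (i ≡ j × a ≡ b)
    vU-disj : ∀ i j a → v i ≢ U j a
    T      : Graph (suc q')                      -- tree T on {v_1..v_q} (via v)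
    T-tree : IsTree T
    p      : ℕ
    T'     : Graph p                             -- tree T' with r edges (vertices via w)
    w      : Fin p → Fin n
    w-inj  : Injective _≡_ _≡_ w
    T'-tree : IsTree T'
    T'-edges : edgeCount T' ≡ r
    -- V(T') ∩ ⋃ V(G_i) = {v_q}
    w-vq   : ∃[ a ] (w a ≡ v (fromℕ q'))
    w-v    : ∀ a i → w a ≡ v i → i ≡ fromℕ q'
    w-U    : ∀ a i b → w a ≢ U i b
    cover  : ∀ x → (∃[ a ] (x ≡ w a)) ⊎ (∃[ i ] (x ≡ v i)) ⊎ (∃[ i ] ∃[ a ] (x ≡ U i a))
    edges-sound    : ∀ x y → Edge G x y → SpecEdge v U u1 T w T' x y
    edges-complete : ∀ x y → SpecEdge v U u1 T w T' x y → Edge G x y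

Special : ℕ → ℕ → ∀ {n} → Graph n → Set
Special m k G with (m + 1) / t k
... | zero   = IsTree G × edgeCount G ≡ (m + 1) % t k
... | suc q' = SpecialStruct k q' ((m + 1) % t k) G

PureSpecial : ℕ → ℕ → ∀ {n} → Graph n → Set
PureSpecial m k G = Special m k G × (m + 1) % t k ≡ 0

{-# OPTIONS --safe #-}

-- Every graph in 𝓕 ℓ k contains a core: a nonempty vertex set inducing minimum degree at least
-- k - 1 (a regular graph is one; a graph without a core is coloured greedily with k - 1 colours).
-- So it suffices to destroy all cores. By induction on a connected vertex set S: S is a k-clique,
-- or some D with t |D| ≤ m(S) destroys its cores, or some D with t |D| = m(S) + 1 does and S is
-- pure special, a 5-cycle (k = 2) or a 4-cycle (k = 3). One deletes N[v] and counts, for each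
-- component H left over, its m(H) edges and the e(H) edges joining it to N[v]; the induction
-- hypothesis loses only if e(H) = 1 and H is a k-clique, or H is extremal.
--  * If deleting one vertex x leaves a k-clique component, x also meets all other such components,
--    and equality forces every other component to be pure special and joined to x at a centre.
--  * Otherwise, if v lies in a k-clique Q and has degree at least k, then N[v] spans at least
--    (k choose 2) + 1 edges. In case of equality t divides m(H) + e(H) for every component H;
--    comparing two such centres in Q leaves only the 5-cycle.
--  * If there is no k-clique, take v in a core with degree at least k; a degree count over N(v)
--    gives the bound, and equality would require a leaf next to every such v, which fails at a
--    vertex of an attached 4-cycle. If no v of degree at least k exists, S is (k-1)-regular.
-- Conversely, disjoint closed neighbourhoods of the k-cliques U_i give the lower bounds, and the
-- matching upper bound for special graphs is the general bound itself.
module Submission where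

open import Defs
open import Data.Nat
open import Data.Nat.Properties
open import Data.Nat.Combinatorics using (nC1≡n; nCk+nC[k+1]≡[n+1]C[k+1]) renaming (_C_ to _choose_)
open import Data.Nat.Divisibility using (_∣_; divides; ∣m∣n⇒∣m+n; ∣m+n∣m⇒∣n; ∣⇒≤; _∣0)
open import Data.Nat.DivMod using (_/_; _%_; m≡m%n+[m/n]*n; m*n/n≡m; m*n%n≡0; n%n≡0; m<n⇒m%n≡m; /-monoˡ-≤)
open import Data.Nat.Solver using (module +-*-Solver)
open import Data.Bool using (Bool; true; false; _∧_; if_then_else_; T)
import Data.Bool as Bool
open import Data.Fin using (Fin; toℕ; zero; suc; fromℕ; fromℕ<; inject₁)
import Data.Fin as Fin
open import Data.Fin.Properties using (any?; all?; toℕ-injective; pigeonhole; toℕ-fromℕ; toℕ-fromℕ<; toℕ-inject₁; toℕ<n)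
open import Data.Fin.Subset using (Subset)
import Data.Fin.Subset as Sub
open import Data.Fin.Subset.Properties using (_∈?_; ∣⊥∣≡0)
open import Data.List using (List; []; _∷_; _++_; length)
import Data.List as List
open import Data.List.Properties using (length-tabulate; length-++)
open import Data.List.Membership.Propositional using () renaming (_∈_ to _∈ₗ_; find to find-any)
import Data.List.Membership.DecPropositional as DecMembership
open import Data.List.Relation.Unary.Any using (Any; here; there)
import Data.List.Relation.Unary.Any as Any
open import Data.List.Relation.Unary.Any.Properties using (tabulate⁺; ++⁺ˡ; ++⁺ʳ)
open import Data.Vec using (lookup; tabulate; []; _∷_)
open import Data.Vec.Properties using (lookup∘tabulate; []=⇒lookup; lookup⇒[]=)
open import Data.Product using (∃-syntax; Σ-syntax; _×_; _,_; proj₁; proj₂)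
open import Data.Sum using (_⊎_; inj₁; inj₂; [_,_]′; map₂; swap)
open import Data.Empty using (⊥; ⊥-elim)
open import Data.Unit using (⊤; tt)
open import Function using (_∘_; id)
open import Function.Bundles using (_⇔_; mk⇔; mk↔ₛ′; Inverse)
open import Function.Definitions using (Injective)
open import Relation.Nullary using (¬_; Dec; yes; no; does; contradiction)
open import Relation.Nullary.Decidable using (_×-dec_; _⊎-dec_; _→-dec_; ¬?; from-yes; decidable-stable)
open import Relation.Binary.Definitions using (tri<; tri≈; tri>)
open import Relation.Binary.PropositionalEquality

-- The constant `τ` is κ + 2, where κ counts the edges of a k-clique: a chosen vertex is paid for by
-- such a clique, one further edge near it and the + 1 in the bound. A k-clique alone lacks the
-- further edge, and as a component hanging on one edge it would bring this shortage into the
-- induction. Such a component is therefore never charged alone: the vertex that it hangs on is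
-- chosen, and all components at that vertex are treated together. There the extremal sets must be
-- known with their structure, since a vertex joined to a pentagon, a square or a special set by one
-- edge usually saves a vertex inside it; the exception is an edge to a centre, which is how larger
-- special sets arise. Bounds and equality cases are proved by the same computation. Estimates are
-- added over components, so a union is tight only if each component is, and structure is read off
-- component by component. The existence of a k-clique is not decided in advance: the argument for
-- large cores runs as if there were none and hands over any k-clique that it meets.

χ : Bool → ℕ
χ b = if b then 1 else 0

-- Sums over `Fin n`

∑-cong : ∀ {n} {f g : Fin n → ℕ} → (∀ i → f i ≡ g i) → ∑ f ≡ ∑ g
∑-cong {zero}  h = refl
∑-cong {suc n} h = cong₂ _+_ (h zero) (∑-cong (h ∘ suc))

∑-mono : ∀ {n} {f g : Fin n → ℕ} → (∀ i → f i ≤ g i) → ∑ f ≤ ∑ g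
∑-mono {zero}  h = z≤n
∑-mono {suc n} h = +-mono-≤ (h zero) (∑-mono (h ∘ suc))

∑-zero : ∀ {n} → ∑ {n} (λ _ → 0) ≡ 0
∑-zero {zero}  = refl
∑-zero {suc n} = ∑-zero {n}

∑-one : ∀ {n} → ∑ {n} (λ _ → 1) ≡ n
∑-one {zero}  = refl
∑-one {suc n} = cong suc ∑-one

+-interchange : ∀ a b c d → (a + b) + (c + d) ≡ (a + c) + (b + d)
+-interchange = solve 4 (λ a b c d → (a :+ b) :+ (c :+ d) := (a :+ c) :+ (b :+ d)) refl
  where open +-*-Solver

∑-+ : ∀ {n} (f g : Fin n → ℕ) → ∑ (λ i → f i + g i) ≡ ∑ f + ∑ g
∑-+ {zero}  f g = refl
∑-+ {suc n} f g = trans (cong ((f zero + g zero) +_) (∑-+ (f ∘ suc) (g ∘ suc)))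
                        (+-interchange (f zero) (g zero) _ _)

∑-* : ∀ {n} c (f : Fin n → ℕ) → ∑ (λ i → c * f i) ≡ c * ∑ f
∑-* {zero}  c f = sym (*-zeroʳ c)
∑-* {suc n} c f = trans (cong (c * f zero +_) (∑-* c (f ∘ suc)))
                        (sym (*-distribˡ-+ c (f zero) _))

∑-swap : ∀ {n p} (f : Fin n → Fin p → ℕ) →
         ∑ (λ i → ∑ (λ j → f i j)) ≡ ∑ (λ j → ∑ (λ i → f i j))
∑-swap {zero}  {p} f = sym (∑-zero {p})
∑-swap {suc n} {p} f = trans (cong (∑ (f zero) +_) (∑-swap (f ∘ suc)))
                             (sym (∑-+ (f zero) (λ j → ∑ (λ i → f (suc i) j))))

∑-δ : ∀ {n} (x : Fin n) (f : Fin n → ℕ) → ∑ (λ y → χ (does (y Fin.≟ x)) * f y) ≡ f x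
∑-δ {suc n} zero f = trans (cong₂ _+_ (+-identityʳ (f zero)) (∑-zero {n})) (+-identityʳ (f zero))
∑-δ {suc n} (suc x) f = ∑-δ x (λ y → f (suc y))

-- Decidable vertex sets

record DSet (n : ℕ) : Set₁ where
  no-eta-equality
  constructor ⟨_,_⟩
  field
    mem  : Fin n → Set
    mem? : ∀ x → Dec (mem x)
open DSet public

private variable
  n : ℕ

infix 4 _∈ˢ_ _∉ˢ_ _⊆ˢ_
_∈ˢ_ _∉ˢ_ : Fin n → DSet n → Set
x ∈ˢ A = mem A x
x ∉ˢ A = ¬ mem A x

_⊆ˢ_ : DSet n → DSet n → Set
A ⊆ˢ B = ∀ x → x ∈ˢ A → x ∈ˢ B

full ∅ˢ : DSet n
full = ⟨ (λ _ → ⊤) , (λ _ → yes tt) ⟩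
∅ˢ   = ⟨ (λ _ → ⊥) , (λ _ → no id) ⟩

sing : Fin n → DSet n
sing x = ⟨ (_≡ x) , (Fin._≟ x) ⟩

infixl 6 _∪ˢ_ _∩ˢ_ _∖_ _─_
_∪ˢ_ _∩ˢ_ _∖_ : DSet n → DSet n → DSet n
A ∪ˢ B = ⟨ (λ x → x ∈ˢ A ⊎ x ∈ˢ B) , (λ x → mem? A x ⊎-dec mem? B x) ⟩
A ∩ˢ B = ⟨ (λ x → x ∈ˢ A × x ∈ˢ B) , (λ x → mem? A x ×-dec mem? B x) ⟩
A ∖ B  = ⟨ (λ x → x ∈ˢ A × x ∉ˢ B) , (λ x → mem? A x ×-dec ¬? (mem? B x)) ⟩

_─_ : DSet n → Fin n → DSet n
A ─ x = A ∖ sing x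

indicator : DSet n → Fin n → ℕ
indicator A x = χ (does (mem? A x))

indicator-∈ : ∀ (A : DSet n) {x} → x ∈ˢ A → indicator A x ≡ 1
indicator-∈ A {x} p with mem? A x
... | yes _ = refl
... | no ¬p = contradiction p ¬p

indicator-∉ : ∀ (A : DSet n) {x} → x ∉ˢ A → indicator A x ≡ 0
indicator-∉ A {x} ¬p with mem? A x
... | yes p = contradiction p ¬p
... | no _  = refl

record Split (S A B : DSet n) : Set where
  field
    left     : A ⊆ˢ S
    right    : B ⊆ˢ S
    cover    : ∀ x → x ∈ˢ S → x ∈ˢ A ⊎ x ∈ˢ B
    disjoint : ∀ x → x ∈ˢ A → x ∉ˢ B

-- Sums and cardinalities over a set

opaque
  sumOn : DSet n → (Fin n → ℕ) → ℕ
  sumOn A f = ∑ (λ x → indicator A x * f x)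

  -- Points where `f` vanishes need no check. With `f = α x`, membership in `B` is thus asked only
  -- for neighbours of `x`, which is how degrees are compared below.
  sumOn-≤ : ∀ (A B : DSet n) f g → (∀ x → x ∈ˢ A → 1 ≤ f x → x ∈ˢ B × f x ≤ g x) →
            sumOn A f ≤ sumOn B g
  sumOn-≤ A B f g h = ∑-mono pt
    where
    pt : ∀ x → indicator A x * f x ≤ indicator B x * g x
    pt x with mem? A x | f x in eq
    ... | no _  | _     = z≤n
    ... | yes p | zero  = z≤n
    ... | yes p | suc i with h x p (subst (1 ≤_) (sym eq) (s≤s z≤n))
    ...   | q , le rewrite indicator-∈ B q = +-monoˡ-≤ 0 (subst (_≤ g x) eq le)

  sumOn-mono : ∀ (A : DSet n) {f g} → (∀ x → x ∈ˢ A → f x ≤ g x) → sumOn A f ≤ sumOn A g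
  sumOn-mono A h = sumOn-≤ A A _ _ (λ x p _ → p , h x p)

  sumOn-⊆ : ∀ (A B : DSet n) {f} → A ⊆ˢ B → sumOn A f ≤ sumOn B f
  sumOn-⊆ A B h = sumOn-≤ A B _ _ (λ x p _ → h x p , ≤-refl)

  sumOn-cong : ∀ (A : DSet n) {f g} → (∀ x → x ∈ˢ A → f x ≡ g x) → sumOn A f ≡ sumOn A g
  sumOn-cong A h = ≤-antisym (sumOn-mono A (λ x p → ≤-reflexive (h x p)))
                             (sumOn-mono A (λ x p → ≤-reflexive (sym (h x p))))

  sumOn-≐ : ∀ (A B : DSet n) {f} → A ⊆ˢ B → B ⊆ˢ A → sumOn A f ≡ sumOn B f
  sumOn-≐ A B h k = ≤-antisym (sumOn-⊆ A B h) (sumOn-⊆ B A k)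

  sumOn-+ : ∀ (A : DSet n) f g → sumOn A (λ x → f x + g x) ≡ sumOn A f + sumOn A g
  sumOn-+ A f g = trans (∑-cong (λ x → *-distribˡ-+ (indicator A x) (f x) (g x))) (∑-+ (λ x → indicator A x * f x) (λ x → indicator A x * g x))

  sumOn-* : ∀ (A : DSet n) c f → sumOn A (λ x → c * f x) ≡ c * sumOn A f
  sumOn-* A c f = trans (∑-cong (λ x → x∙yz≈y∙xz (indicator A x) c (f x))) (∑-* c (λ x → indicator A x * f x))
    where
    x∙yz≈y∙xz : ∀ a b c → a * (b * c) ≡ b * (a * c)
    x∙yz≈y∙xz = solve 3 (λ a b c → a :* (b :* c) := b :* (a :* c)) refl
      where open +-*-Solver

  sumOn-∑ : ∀ {p} (A : DSet n) (f : Fin n → Fin p → ℕ) →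
            sumOn A (λ x → ∑ (f x)) ≡ ∑ (λ j → sumOn A (λ x → f x j))
  sumOn-∑ A f = trans (∑-cong (λ x → sym (∑-* (indicator A x) (f x)))) (∑-swap (λ x j → indicator A x * f x j))

  sumOn-swap : ∀ (A B : DSet n) (f : Fin n → Fin n → ℕ) →
               sumOn A (λ x → sumOn B (f x)) ≡ sumOn B (λ y → sumOn A (λ x → f x y))
  sumOn-swap A B f = trans (sumOn-∑ A (λ x y → indicator B y * f x y)) (∑-cong λ y → sumOn-* A (indicator B y) (λ x → f x y))

  sumOn-∅ : ∀ {n} (A : DSet n) f → (∀ x → x ∈ˢ A → f x ≡ 0) → sumOn A f ≡ 0
  sumOn-∅ {n} A f h = trans (sumOn-cong A h) (trans (∑-cong (λ x → *-zeroʳ (indicator A x))) (∑-zero {n}))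

  sumOn-split : ∀ {S A B : DSet n} → Split S A B → ∀ f → sumOn S f ≡ sumOn A f + sumOn B f
  sumOn-split {S = S} {A} {B} sp f = trans (∑-cong pt) (∑-+ (λ x → indicator A x * f x) (λ x → indicator B x * f x))
    where
    open Split sp
    pt : ∀ x → indicator S x * f x ≡ indicator A x * f x + indicator B x * f x
    pt x with mem? A x | mem? B x
    ... | yes a | yes b = contradiction b (disjoint x a)
    ... | yes a | no ¬b rewrite indicator-∈ S (left x a) = sym (+-identityʳ (f x + 0))
    ... | no ¬a | yes b rewrite indicator-∈ S (right x b) = refl
    ... | no ¬a | no ¬b rewrite indicator-∉ S ([ ¬a , ¬b ]′ ∘ cover x) = refl

  sumOn-sing : ∀ (x : Fin n) (f : Fin n → ℕ) → sumOn (sing x) f ≡ f x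
  sumOn-sing = ∑-δ

card : DSet n → ℕ
card A = sumOn A (λ _ → 1)

sumOn-const : ∀ (A : DSet n) c → sumOn A (λ _ → c) ≡ c * card A
sumOn-const A c = trans (sumOn-cong A (λ _ _ → sym (*-identityʳ c))) (sumOn-* A c (λ _ → 1))

split-remove : ∀ (S A : DSet n) → A ⊆ˢ S → Split S A (S ∖ A)
split-remove S A h = record
  { left = h ; right = λ _ → proj₁ ; cover = cov ; disjoint = λ _ a b → proj₂ b a }
  where
  cov : ∀ x → x ∈ˢ S → x ∈ˢ A ⊎ x ∈ˢ S ∖ A
  cov x s with mem? A x
  ... | yes a = inj₁ a
  ... | no ¬a = inj₂ (s , ¬a)

split-point : ∀ (S : DSet n) {x} → x ∈ˢ S → Split S (sing x) (S ─ x)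
split-point S p = split-remove S _ (λ { _ refl → p })

sumOn-point : ∀ (A : DSet n) {x} f → x ∈ˢ A → sumOn A f ≡ f x + sumOn (A ─ x) f
sumOn-point A {x} f p = trans (sumOn-split (split-point A p) f) (cong (_+ sumOn (A ─ x) f) (sumOn-sing x f))

sumOn-at : ∀ (A : DSet n) {x} f → x ∈ˢ A → f x ≤ sumOn A f
sumOn-at A f p = ≤-trans (m≤m+n _ _) (≤-reflexive (sym (sumOn-point A f p)))

sumOn-two : ∀ (A : DSet n) {x y} f → x ∈ˢ A → y ∈ˢ A → y ≢ x → f x + f y ≤ sumOn A f
sumOn-two A {x} f p q ne =
  ≤-trans (+-monoʳ-≤ (f x) (sumOn-at (A ─ x) f (q , ne))) (≤-reflexive (sym (sumOn-point A f p)))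

sumOn-concentrated : ∀ (A : DSet n) {x} f → x ∈ˢ A → (∀ y → y ∈ˢ A → y ≢ x → f y ≡ 0) →
                     sumOn A f ≡ f x
sumOn-concentrated A {x} f p h =
  trans (sumOn-point A f p)
        (trans (cong (f x +_) (sumOn-∅ (A ─ x) f (λ y q → h y (proj₁ q) (proj₂ q)))) (+-identityʳ _))

find : ∀ (A : DSet n) {Q : Fin n → Set} → (∀ x → Dec (Q x)) →
       (∃[ x ] (x ∈ˢ A × Q x)) ⊎ (∀ x → x ∈ˢ A → ¬ Q x)
find A Q? with any? (λ x → mem? A x ×-dec Q? x)
... | yes p = inj₁ p
... | no ¬p = inj₂ (λ x a q → ¬p (x , a , q))

sumOn-find : ∀ (A : DSet n) f → 1 ≤ sumOn A f → ∃[ x ] (x ∈ˢ A × 1 ≤ f x)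
sumOn-find A f le with find A (λ x → 1 ≤? f x)
... | inj₁ p = p
... | inj₂ ¬p = contradiction (subst (1 ≤_) (sumOn-∅ A f (λ x a → n<1⇒n≡0 (≰⇒> (¬p x a)))) le) λ ()

-- Since `f` is at most 1, the first point found accounts for at most half of the total 2.
sumOn-find₂ : ∀ (A : DSet n) f → (∀ x → f x ≤ 1) → 2 ≤ sumOn A f →
  ∃[ x ] ∃[ y ] (x ∈ˢ A × y ∈ˢ A × y ≢ x × 1 ≤ f x × 1 ≤ f y)
sumOn-find₂ A f f≤1 le with sumOn-find A f (≤-trans (s≤s z≤n) le)
... | x , xA , fx with sumOn-find (A ─ x) f
        (+-cancelˡ-≤ 1 1 _ (≤-trans (subst (2 ≤_) (sumOn-point A f xA) le) (+-monoˡ-≤ _ (f≤1 x))))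
...   | y , (yA , y≢x) , fy = x , y , xA , yA , y≢x , fx , fy

card-⊆ : ∀ (A B : DSet n) → A ⊆ˢ B → card A ≤ card B
card-⊆ A B = sumOn-⊆ A B

card-remove : ∀ (A : DSet n) {x} → x ∈ˢ A → card A ≡ suc (card (A ─ x))
card-remove A = sumOn-point A _

card-⊂ : ∀ (A B : DSet n) {x} → A ⊆ˢ B → x ∈ˢ B → x ∉ˢ A → card A < card B
card-⊂ A B {x} h p q = subst (card A <_) (sym (card-remove B p))
  (s≤s (card-⊆ A (B ─ x) (λ y a → h y a , λ { refl → q a })))

opaque
  unfolding sumOn

  card-full : ∀ n → card (full {n}) ≡ n
  card-full n = trans (∑-cong {n} (λ _ → refl)) (∑-one {n})

card-positive : ∀ (A : DSet n) {x} → x ∈ˢ A → 1 ≤ card A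
card-positive A p = sumOn-at A _ p

card-pick : ∀ (A B : DSet n) → card B < card A → ∃[ x ] (x ∈ˢ A × x ∉ˢ B)
card-pick A B lt with find A (λ x → ¬? (mem? B x))
... | inj₁ p = p
... | inj₂ ¬p = contradiction (card-⊆ A B sub) (<⇒≱ lt)
  where
  sub : A ⊆ˢ B
  sub x a with mem? B x
  ... | yes b = b
  ... | no ¬b = contradiction ¬b (¬p x a)

-- Sums along injections, and enumerations

module _ {h} (A : DSet n) (f : Fin h → Fin n) (f-inj : Injective _≡_ _≡_ f)
         (f∈ : ∀ a → f a ∈ˢ A) where

  private
    -- The number of preimages under `f`. Injectivity makes it the indicator of the image, so a sum
    -- along `f` becomes a weighted sum over all vertices.
    fibre : Fin n → ℕ
    fibre x = ∑ (λ a → χ (does (f a Fin.≟ x)))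

    fibre-image : ∀ a → fibre (f a) ≡ 1
    fibre-image a = trans (∑-cong pt) (trans (∑-δ a (λ _ → 1)) refl)
      where
      pt : ∀ b → χ (does (f b Fin.≟ f a)) ≡ χ (does (b Fin.≟ a)) * 1
      pt b with f b Fin.≟ f a | b Fin.≟ a
      ... | yes _ | yes _ = refl
      ... | yes p | no ¬q = contradiction (f-inj p) ¬q
      ... | no ¬p | yes refl = contradiction refl ¬p
      ... | no _  | no _  = refl

    fibre-≤ : ∀ x → fibre x ≤ indicator A x
    fibre-≤ x with any? (λ a → f a Fin.≟ x)
    ... | yes (a , refl) = ≤-reflexive (trans (fibre-image a) (sym (indicator-∈ A (f∈ a))))
    ... | no ¬p = ≤-trans (≤-reflexive (trans (∑-cong pt) (∑-zero {h}))) z≤n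
      where
      pt : ∀ a → χ (does (f a Fin.≟ x)) ≡ 0
      pt a with f a Fin.≟ x
      ... | yes p = contradiction (a , p) ¬p
      ... | no _  = refl

    ∑-fibre : ∀ g → ∑ (g ∘ f) ≡ ∑ (λ x → fibre x * g x)
    ∑-fibre g = begin
      ∑ (g ∘ f)                                              ≡⟨ ∑-cong (λ a → sym (∑-δ (f a) g)) ⟩
      ∑ (λ a → ∑ (λ x → χ (does (x Fin.≟ f a)) * g x))       ≡⟨ ∑-swap (λ a x → χ (does (x Fin.≟ f a)) * g x) ⟩
      ∑ (λ x → ∑ (λ a → χ (does (x Fin.≟ f a)) * g x))       ≡⟨ ∑-cong (λ x → ∑-cong (λ a → cong (λ b → χ b * g x) (flip x (f a)))) ⟩
      ∑ (λ x → ∑ (λ a → χ (does (f a Fin.≟ x)) * g x))       ≡⟨ ∑-cong (λ x → ∑-cong (λ a → *-comm (χ (does (f a Fin.≟ x))) (g x))) ⟩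
      ∑ (λ x → ∑ (λ a → g x * χ (does (f a Fin.≟ x))))       ≡⟨ ∑-cong (λ x → ∑-* (g x) (λ a → χ (does (f a Fin.≟ x)))) ⟩
      ∑ (λ x → g x * fibre x)                                ≡⟨ ∑-cong (λ x → *-comm (g x) _) ⟩
      ∑ (λ x → fibre x * g x)                                ∎
      where
      open ≡-Reasoning
      flip : ∀ (x y : Fin n) → does (x Fin.≟ y) ≡ does (y Fin.≟ x)
      flip x y with x Fin.≟ y | y Fin.≟ x
      ... | yes _ | yes _ = refl
      ... | no _  | no _  = refl
      ... | yes p | no ¬q = contradiction (sym p) ¬q
      ... | no ¬p | yes q = contradiction (sym q) ¬p

  opaque
    unfolding sumOn

    ∑-image-≤ : ∀ g → ∑ (g ∘ f) ≤ sumOn A g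
    ∑-image-≤ g = ≤-trans (≤-reflexive (∑-fibre g)) (∑-mono (λ x → *-monoˡ-≤ (g x) (fibre-≤ x)))

    ∑-image : (∀ x → x ∈ˢ A → ∃[ a ] (x ≡ f a)) → ∀ g → ∑ (g ∘ f) ≡ sumOn A g
    ∑-image onto g = trans (∑-fibre g) (∑-cong (λ x → cong (_* g x) (pt x)))
      where
      pt : ∀ x → fibre x ≡ indicator A x
      pt x with mem? A x | fibre-≤ x
      ... | no _  | le = n≤0⇒n≡0 le
      ... | yes p | le with onto x p
      ...   | a , refl = fibre-image a

  injection-card : h ≤ card A
  injection-card = ≤-trans (≤-reflexive (sym (∑-one {h}))) (∑-image-≤ (λ _ → 1))

record Enumeration (A : DSet n) (h : ℕ) : Set where
  field
    enum     : Fin h → Fin n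
    enum-inj : Injective _≡_ _≡_ enum
    enum-∈   : ∀ a → enum a ∈ˢ A
    enum-onto : ∀ x → x ∈ˢ A → ∃[ a ] (x ≡ enum a)

enumerate : ∀ h (A : DSet n) → card A ≡ h → Enumeration A h
enumerate zero A eq = record
  { enum = λ () ; enum-inj = λ { {()} } ; enum-∈ = λ ()
  ; enum-onto = λ x p → contradiction (subst (1 ≤_) eq (card-positive A p)) λ () }
enumerate (suc h) A eq with sumOn-find A _ (≤-trans (s≤s z≤n) (≤-reflexive (sym eq)))
... | x , xA , _ = record { enum = f ; enum-inj = inj ; enum-∈ = f∈ ; enum-onto = onto }
  where
  open Enumeration (enumerate h (A ─ x) (suc-injective (trans (sym (card-remove A xA)) eq)))
  f : Fin (suc h) → Fin _
  f zero    = x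
  f (suc a) = enum a
  inj : Injective _≡_ _≡_ f
  inj {zero}  {zero}  _ = refl
  inj {zero}  {suc b} p = contradiction (sym p) (proj₂ (enum-∈ b))
  inj {suc a} {zero}  p = contradiction p (proj₂ (enum-∈ a))
  inj {suc a} {suc b} p = cong suc (enum-inj p)
  f∈ : ∀ a → f a ∈ˢ A
  f∈ zero    = xA
  f∈ (suc a) = proj₁ (enum-∈ a)
  onto : ∀ y → y ∈ˢ A → ∃[ a ] (y ≡ f a)
  onto y p with y Fin.≟ x
  ... | yes eq = zero , eq
  ... | no ne with enum-onto y (p , ne)
  ...   | a , q = suc a , q

-- Degrees and edge counts inside vertex sets

module InGraph {n : ℕ} (G : Graph n) where

  Adj : Fin n → Fin n → Set
  Adj = Edge G

  adj? : ∀ x y → Dec (Adj x y)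
  adj? x y = adj G x y Bool.≟ true

  Adj-sym : ∀ {x y} → Adj x y → Adj y x
  Adj-sym {x} {y} p = trans (adjSym G y x) p

  Adj-irrefl : ∀ {x y} → Adj x y → x ≢ y
  Adj-irrefl {x} p refl with trans (sym p) (loopless G x)
  ... | ()

  α : Fin n → Fin n → ℕ
  α x y = χ (adj G x y)

  α≤1 : ∀ x y → α x y ≤ 1
  α≤1 x y with adj G x y
  ... | true  = ≤-refl
  ... | false = z≤n

  α-adj : ∀ {x y} → Adj x y → α x y ≡ 1
  α-adj p = cong χ p

  α-nonadj : ∀ {x y} → ¬ Adj x y → α x y ≡ 0
  α-nonadj {x} {y} ¬p with adj G x y
  ... | true  = contradiction refl ¬p
  ... | false = refl

  adj-α : ∀ {x y} → 1 ≤ α x y → Adj x y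
  adj-α {x} {y} p with adj G x y
  adj-α p | true = refl
  adj-α () | false

  α-sym : ∀ x y → α x y ≡ α y x
  α-sym x y = cong χ (adjSym G x y)

  deg : DSet n → Fin n → ℕ
  deg B x = sumOn B (α x)

  -- Ordered pairs are counted: for disjoint sets this is the number of edges between them, but
  -- `e S S` is twice the number of edges inside `S`.
  e : DSet n → DSet n → ℕ
  e A B = sumOn A (deg B)

  private
    -- Each edge is oriented by the order of its ends so that `m` agrees with `edgeCount` on the
    -- whole graph. All later counting goes through `double-m`, which forgets the orientation.
    β : Fin n → Fin n → ℕ
    β x y = χ ((suc (toℕ x) ≤ᵇ toℕ y) ∧ adj G x y)

    ≤ᵇ-true : ∀ a b → a ≤ b → (a ≤ᵇ b) ≡ true
    ≤ᵇ-true a b p with a ≤ᵇ b | ≤⇒≤ᵇ p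
    ... | true | _ = refl

    ≤ᵇ-false : ∀ a b → b < a → (a ≤ᵇ b) ≡ false
    ≤ᵇ-false a b p with a ≤ᵇ b in eq
    ... | false = refl
    ... | true  = contradiction (≤ᵇ⇒≤ a b (subst T (sym eq) tt)) (<⇒≱ p)

    β-+ : ∀ x y → β x y + β y x ≡ α x y
    β-+ x y with <-cmp (toℕ x) (toℕ y)
    ... | tri< lt _ _ rewrite ≤ᵇ-true (suc (toℕ x)) (toℕ y) lt
                            | ≤ᵇ-false (suc (toℕ y)) (toℕ x) (m<n⇒m<1+n lt) = +-identityʳ _
    ... | tri> _ _ gt rewrite ≤ᵇ-true (suc (toℕ y)) (toℕ x) gt
                            | ≤ᵇ-false (suc (toℕ x)) (toℕ y) (m<n⇒m<1+n gt) = α-sym y x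
    ... | tri≈ _ eq _ with toℕ-injective eq
    ...   | refl rewrite ≤ᵇ-false (suc (toℕ x)) (toℕ x) ≤-refl = sym (α-nonadj (λ p → Adj-irrefl p refl))

  m : DSet n → ℕ
  m S = sumOn S (λ x → sumOn S (β x))

  opaque
    unfolding sumOn

    m-full : m full ≡ edgeCount G
    m-full = ∑-cong {n} (λ x → trans (+-identityʳ _) (∑-cong {n} (λ y → +-identityʳ _)))

    deg-full : ∀ x → deg full x ≡ degree G x
    deg-full x = ∑-cong {n} (λ y → +-identityʳ _)

  double-m : ∀ S → 2 * m S ≡ e S S
  double-m S = begin
    2 * m S                                                   ≡⟨ cong (m S +_) (+-identityʳ _) ⟩
    m S + m S                                                 ≡⟨ cong (m S +_) (sumOn-swap S S β) ⟩
    m S + sumOn S (λ y → sumOn S (λ x → β x y))               ≡⟨ sym (sumOn-+ S _ _) ⟩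
    sumOn S (λ x → sumOn S (β x) + sumOn S (λ y → β y x))     ≡⟨ sumOn-cong S (λ x _ → trans (sym (sumOn-+ S (β x) (λ y → β y x))) (sumOn-cong S (λ y _ → β-+ x y))) ⟩
    e S S                                                     ∎
    where open ≡-Reasoning

  e-sym : ∀ A B → e A B ≡ e B A
  e-sym A B = trans (sumOn-swap A B α) (sumOn-cong B (λ y _ → sumOn-cong A (λ x _ → α-sym x y)))

  deg-split : ∀ {S A B} → Split S A B → ∀ x → deg S x ≡ deg A x + deg B x
  deg-split sp x = sumOn-split sp (α x)

  e-splitˡ : ∀ {S A B} → Split S A B → ∀ C → e S C ≡ e A C + e B C
  e-splitˡ sp C = sumOn-split sp (deg C)

  e-splitʳ : ∀ {S A B} → Split S A B → ∀ C → e C S ≡ e C A + e C B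
  e-splitʳ sp C = trans (sumOn-cong C (λ x _ → deg-split sp x)) (sumOn-+ C _ _)

  m-split : ∀ {S A B} → Split S A B → m S ≡ m A + e A B + m B
  m-split {S} {A} {B} sp = *-cancelˡ-≡ _ _ 2 (begin
    2 * m S                                    ≡⟨ double-m S ⟩
    e S S                                      ≡⟨ e-splitˡ sp S ⟩
    e A S + e B S                              ≡⟨ cong₂ _+_ (e-splitʳ sp A) (e-splitʳ sp B) ⟩
    (e A A + e A B) + (e B A + e B B)          ≡⟨ cong₂ (λ u v → (u + e A B) + (e B A + v)) (sym (double-m A)) (sym (double-m B)) ⟩
    (2 * m A + e A B) + (e B A + 2 * m B)      ≡⟨ cong (λ u → (2 * m A + e A B) + (u + 2 * m B)) (e-sym B A) ⟩
    (2 * m A + e A B) + (e A B + 2 * m B)      ≡⟨ solve 3 (λ p q r → (con 2 :* p :+ q) :+ (q :+ con 2 :* r) := con 2 :* (p :+ q :+ r)) refl (m A) (e A B) (m B) ⟩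
    2 * (m A + e A B + m B)                    ∎)
    where
    open ≡-Reasoning
    open +-*-Solver

  e-sing : ∀ x B → e (sing x) B ≡ deg B x
  e-sing x B = sumOn-sing x (deg B)

  m-sing : ∀ x → m (sing x) ≡ 0
  m-sing x = *-cancelˡ-≡ _ _ 2 (begin
    2 * m (sing x)   ≡⟨ double-m (sing x) ⟩
    e (sing x) (sing x) ≡⟨ e-sing x (sing x) ⟩
    deg (sing x) x   ≡⟨ sumOn-sing x (α x) ⟩
    α x x            ≡⟨ α-nonadj (λ p → Adj-irrefl p refl) ⟩
    0                ∎)
    where open ≡-Reasoning

  m-add : ∀ {S R x} → Split S (sing x) R → m S ≡ deg R x + m R
  m-add {S} {R} {x} sp = trans (m-split sp) (cong₂ (λ u v → u + v + m R) (m-sing x) (e-sing x R))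

  deg-≐ : ∀ A B → A ⊆ˢ B → B ⊆ˢ A → ∀ x → deg A x ≡ deg B x
  deg-≐ A B h k x = sumOn-≐ A B h k

  e-≐ʳ : ∀ C A B → A ⊆ˢ B → B ⊆ˢ A → e C A ≡ e C B
  e-≐ʳ C A B h k = sumOn-cong C (λ x _ → deg-≐ A B h k x)

  m-≐ : ∀ A B → A ⊆ˢ B → B ⊆ˢ A → m A ≡ m B
  m-≐ A B h k = *-cancelˡ-≡ _ _ 2 (trans (double-m A) (trans (sumOn-≐ A B h k)
                  (trans (e-≐ʳ B A B h k) (sym (double-m B)))))

  deg-≤ : ∀ A B x → (∀ y → y ∈ˢ A → Adj x y → y ∈ˢ B) → deg A x ≤ deg B x
  deg-≤ A B x h = sumOn-≤ A B _ _ (λ y a p → h y a (adj-α p) , ≤-refl)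

  deg-at : ∀ B {x y} → y ∈ˢ B → Adj x y → 1 ≤ deg B x
  deg-at B {x} b p = ≤-trans (≤-reflexive (sym (α-adj p))) (sumOn-at B (α x) b)

  deg-two : ∀ B {x y z} → y ∈ˢ B → z ∈ˢ B → z ≢ y → Adj x y → Adj x z → 2 ≤ deg B x
  deg-two B {x} b c ne p q =
    ≤-trans (≤-reflexive (cong₂ _+_ (sym (α-adj p)) (sym (α-adj q)))) (sumOn-two B (α x) b c ne)

  deg-none : ∀ B x → (∀ y → y ∈ˢ B → ¬ Adj x y) → deg B x ≡ 0
  deg-none B x h = sumOn-∅ B (α x) (λ y b → α-nonadj (h y b))

  deg-find : ∀ B x → 1 ≤ deg B x → ∃[ y ] (y ∈ˢ B × Adj x y)
  deg-find B x le with sumOn-find B (α x) le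
  ... | y , b , p = y , b , adj-α p

  deg-find₂ : ∀ B x → 2 ≤ deg B x → ∃[ y ] ∃[ z ] (y ∈ˢ B × z ∈ˢ B × z ≢ y × Adj x y × Adj x z)
  deg-find₂ B x le with sumOn-find₂ B (α x) (α≤1 x) le
  ... | y , z , b , c , ne , p , q = y , z , b , c , ne , adj-α p , adj-α q

  deg≤card : ∀ B x → deg B x ≤ card B
  deg≤card B x = sumOn-mono B (λ y _ → α≤1 x y)

  deg-remove-self : ∀ B {x} → deg B x ≡ deg (B ─ x) x
  deg-remove-self B {x} = ≤-antisym
    (deg-≤ B (B ─ x) x (λ y b p → b , Adj-irrefl (Adj-sym p)))
    (deg-≤ (B ─ x) B x (λ y b _ → proj₁ b))

  deg<card : ∀ B {x} → x ∈ˢ B → deg B x < card B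
  deg<card B {x} b = subst₂ _<_ (sym (deg-remove-self B)) (sym (card-remove B b)) (s≤s (deg≤card (B ─ x) x))

  deg-complete : ∀ B x → (∀ y → y ∈ˢ B → Adj x y) → deg B x ≡ card B
  deg-complete B x h = sumOn-cong B (λ y b → α-adj (h y b))

  -- A neighbour in `S` but not in `X` would be counted by `deg S x` and missing from `deg X x`.
  neighbours-inside : ∀ X S {x} → X ⊆ˢ S → deg S x ≤ deg X x → ∀ y → y ∈ˢ S → Adj x y → y ∈ˢ X
  neighbours-inside X S {x} h le y s p with mem? X y
  ... | yes q = q
  ... | no ¬q = contradiction le (<⇒≱ (begin-strict
      deg X x                  ≤⟨ sumOn-⊆ X (S ─ y) (λ z q → h z q , λ { refl → ¬q q }) ⟩
      deg (S ─ y) x            <⟨ n<1+n _ ⟩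
      1 + deg (S ─ y) x        ≡⟨ cong (_+ deg (S ─ y) x) (sym (α-adj p)) ⟩
      α x y + deg (S ─ y) x    ≡⟨ sym (sumOn-point S (α x) s) ⟩
      deg S x                  ∎))
    where open ≤-Reasoning

  e-at : ∀ A B {x y} → x ∈ˢ A → y ∈ˢ B → Adj x y → 1 ≤ e A B
  e-at A B a b p = ≤-trans (deg-at B b p) (sumOn-at A (deg B) a)

  e-none : ∀ A B → (∀ x y → x ∈ˢ A → y ∈ˢ B → ¬ Adj x y) → e A B ≡ 0
  e-none A B h = sumOn-∅ A (deg B) (λ x a → deg-none B x (λ y b → h x y a b))

  e-two : ∀ A B {x y x′ y′} → x ∈ˢ A → y ∈ˢ B → Adj x y → x′ ∈ˢ A → y′ ∈ˢ B → Adj x′ y′ →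
          ¬ (x′ ≡ x × y′ ≡ y) → 2 ≤ e A B
  e-two A B {x} {y} {x′} {y′} a b p a′ b′ p′ ne with x′ Fin.≟ x
  ... | no x≢ = ≤-trans (+-mono-≤ (deg-at B b p) (deg-at B b′ p′)) (sumOn-two A (deg B) a a′ x≢)
  ... | yes refl = ≤-trans (deg-two B b b′ (λ y≡ → ne (refl , y≡)) p p′) (sumOn-at A (deg B) a)

  unique-edge : ∀ A B {x y x′ y′} → e A B ≡ 1 → x ∈ˢ A → y ∈ˢ B → Adj x y →
                x′ ∈ˢ A → y′ ∈ˢ B → Adj x′ y′ → x′ ≡ x × y′ ≡ y
  unique-edge A B {x} {y} {x′} {y′} eq a b p a′ b′ p′ with x′ Fin.≟ x | y′ Fin.≟ y
  ... | yes h | yes k = h , k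
  ... | no h  | _     = contradiction (subst (2 ≤_) eq (e-two A B a b p a′ b′ p′ (h ∘ proj₁))) λ { (s≤s ()) }
  ... | yes _ | no k  = contradiction (subst (2 ≤_) eq (e-two A B a b p a′ b′ p′ (k ∘ proj₂))) λ { (s≤s ()) }

  -- Connected sets and components

  record Conn (S : DSet n) : Set₁ where
    field
      inhabited : ∃[ x ] x ∈ˢ S
      -- Connectedness as an induction principle in place of paths: a property that holds at one
      -- vertex and passes along edges holds everywhere. The property may be arbitrary, so even
      -- reachability statements can be spread.
      spread    : ∀ (X : Fin n → Set) {x} → x ∈ˢ S → X x →
                  (∀ a b → a ∈ˢ S → b ∈ˢ S → X a → Adj a b → X b) → ∀ y → y ∈ˢ S → X y
  open Conn public

  conn-sing : ∀ x → Conn (sing x)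
  conn-sing x = record { inhabited = x , refl ; spread = λ { X refl px _ y refl → px } }

  conn-grow : ∀ C {c x} → Conn C → c ∈ˢ C → Adj c x → Conn (C ∪ˢ sing x)
  conn-grow C {c} {x} conn cC cx = record
    { inhabited = c , inj₁ cC
    ; spread = λ where
        X {z} (inj₁ zC) Xz cl →
          let onC = spread conn X zC Xz (λ a b aC bC → cl a b (inj₁ aC) (inj₁ bC))
          in λ where
            y (inj₁ yC) → onC y yC
            y (inj₂ refl) → cl c x (inj₁ cC) (inj₂ refl) (onC c cC) cx
        X (inj₂ refl) Xx cl →
          let Xc = cl x c (inj₂ refl) (inj₁ cC) Xx (Adj-sym cx)
              onC = spread conn X cC Xc (λ a b aC bC → cl a b (inj₁ aC) (inj₁ bC))
          in λ where
            y (inj₁ yC) → onC y yC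
            y (inj₂ refl) → Xx
    }

  ClosedIn : DSet n → DSet n → Set
  ClosedIn H R = ∀ a b → a ∈ˢ H → b ∈ˢ R → Adj a b → b ∈ˢ H

  record Comp (H R : DSet n) : Set₁ where
    field
      conn   : Conn H
      sub    : H ⊆ˢ R
      closed : ClosedIn H R
  open Comp public

  split-add : ∀ (C : DSet n) {x} → x ∉ˢ C → Split (C ∪ˢ sing x) (sing x) C
  split-add C x∉ = record
    { left = λ _ → inj₂ ; right = λ _ → inj₁
    ; cover = λ { _ (inj₁ c) → inj₂ c ; _ (inj₂ q) → inj₁ q }
    ; disjoint = λ { _ refl c → x∉ c } }

  card-add : ∀ (C : DSet n) {x} → x ∉ˢ C → card (C ∪ˢ sing x) ≡ suc (card C)
  card-add C {x} x∉ = trans (sumOn-split (split-add C x∉) _) (cong (_+ card C) (sumOn-sing x _))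

  frontier : ∀ C R → (∃[ c ] (c ∈ˢ C × ∃[ x ] (x ∈ˢ R × x ∉ˢ C × Adj c x))) ⊎ ClosedIn C R
  frontier C R with find C (λ c → any? (λ x → mem? R x ×-dec (¬? (mem? C x)) ×-dec adj? c x))
  ... | inj₁ p = inj₁ p
  ... | inj₂ ¬p = inj₂ cl
    where
    cl : ClosedIn C R
    cl a b aC bR p with mem? C b
    ... | yes q = q
    ... | no ¬q = contradiction (b , bR , ¬q , p) (¬p a aC)

  component : ∀ R {r} → r ∈ˢ R → Σ[ H ∈ DSet n ] (Comp H R × r ∈ˢ H)
  component R {r} rR = grow (card R) (sing r) (m≤n+m _ _) (conn-sing r) (λ { _ refl → rR }) refl
    where
    grow : ∀ fuel C → card R ≤ card C + fuel → Conn C → C ⊆ˢ R → r ∈ˢ C → Σ[ H ∈ DSet n ] (Comp H R × r ∈ˢ H)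
    grow fuel C le cn sb rC with frontier C R
    ... | inj₂ cl = C , record { conn = cn ; sub = sb ; closed = cl } , rC
    grow zero C le cn sb rC | inj₁ (c , cC , x , xR , x∉ , p) =
      contradiction (subst (card R ≤_) (+-identityʳ _) le) (<⇒≱ (card-⊂ C R sb xR x∉))
    grow (suc fuel) C le cn sb rC | inj₁ (c , cC , x , xR , x∉ , p) =
      grow fuel (C ∪ˢ sing x)
        (subst (card R ≤_) (trans (+-suc _ fuel) (cong (_+ fuel) (sym (card-add C x∉)))) le)
        (conn-grow C cn cC p) (λ { _ (inj₁ q) → sb _ q ; _ (inj₂ refl) → xR }) (inj₁ rC)

  comp-⊆ : ∀ {H H′ R x} → Comp H R → Comp H′ R → x ∈ˢ H → x ∈ˢ H′ → H ⊆ˢ H′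
  comp-⊆ {H} {H′} c c′ p p′ = spread (conn c) (_∈ˢ H′) p p′ (λ a b _ bH aH′ ab → closed c′ a b aH′ (sub c b bH) ab)

  -- Components are split off one at a time. What remains is always closed under adjacency in `R₀`,
  -- so each piece split off is a component of `R₀` itself, not only of the remainder.
  compInd : ∀ {ℓ} R₀ (Q : DSet n → Set ℓ) → (∀ R → (∀ x → x ∉ˢ R) → Q R) →
    (∀ R H R′ → Split R H R′ → R ⊆ˢ R₀ → Comp H R₀ → (∀ a b → a ∈ˢ H → b ∈ˢ R′ → ¬ Adj a b) → Q R′ → Q R) →
    Q R₀
  compInd R₀ Q base extend = go (card R₀) R₀ ≤-refl (λ _ → id) (λ _ _ _ b _ → b)
    where
    go : ∀ fuel R → card R ≤ fuel → R ⊆ˢ R₀ → ClosedIn R R₀ → Q R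
    go fuel R le sb cl with find R (λ _ → yes tt)
    ... | inj₂ none = base R (λ x p → none x p tt)
    go zero R le sb cl | inj₁ (r , rR , _) = contradiction (≤-trans (card-positive R rR) le) λ ()
    go (suc fuel) R le sb cl | inj₁ (r , rR , _) with component R rR
    ... | H , cH , rH = extend R H (R ∖ H) (split-remove R H (sub cH)) sb
            (record { conn = conn cH ; sub = λ x → sb x ∘ sub cH x
                    ; closed = λ a b aH bR₀ p → closed cH a b aH (cl a b (sub cH a aH) bR₀ p) p })
            (λ a b aH bR′ p → proj₂ bR′ (closed cH a b aH (proj₁ bR′) p))
            (go fuel (R ∖ H)
              (≤-pred (≤-trans (card-⊂ (R ∖ H) R (λ _ → proj₁) rR (λ q → proj₂ q rH)) le))
              (λ x → sb x ∘ proj₁)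
              (λ a b aR′ bR₀ p → cl a b (proj₁ aR′) bR₀ p ,
                 λ bH → proj₂ aR′ (closed cH b a bH (proj₁ aR′) (Adj-sym p))))

  -- Without such an edge `H` would be closed under adjacency in `S`, and connectedness would carry
  -- it to `x`.
  comp-edge : ∀ {S A R H x} → Conn S → Split S A R → x ∈ˢ A → Comp H R →
              ∃[ a ] ∃[ h ] (a ∈ˢ A × h ∈ˢ H × Adj a h)
  comp-edge {S} {A} {R} {H} {x} cS sp xA cH with find A (λ a → any? (λ h → mem? H h ×-dec adj? a h))
  ... | inj₁ (a , aA , h , hH , p) = a , h , aA , hH , p
  ... | inj₂ ¬p with inhabited (conn cH)
  ...   | h , hH = ⊥-elim (disjoint x xA (sub cH x (spread cS (_∈ˢ H) (right h (sub cH h hH)) hH cl x (left x xA))))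
    where
    open Split sp
    cl : ∀ a b → a ∈ˢ S → b ∈ˢ S → a ∈ˢ H → Adj a b → b ∈ˢ H
    cl a b _ bS aH p with cover b bS
    ... | inj₁ bA = contradiction (a , aH , Adj-sym p) (¬p b bA)
    ... | inj₂ bR = closed cH a b aH bR p

  -- Each vertex reached from C costs at least one edge.
  growth : ∀ S C {c} → Conn S → c ∈ˢ C → C ⊆ˢ S → m C + card S ≤ m S + card C
  growth S C₀ {c₀} cS = go (card S) C₀ (m≤n+m _ _)
    where
    go : ∀ fuel C → card S ≤ card C + fuel → c₀ ∈ˢ C → C ⊆ˢ S → m C + card S ≤ m S + card C
    go fuel C le c∈ sb with frontier C S
    ... | inj₂ cl = ≤-reflexive (cong₂ _+_ (m-≐ C S sb S⊆C) (sumOn-≐ S C S⊆C sb))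
      where
      S⊆C : S ⊆ˢ C
      S⊆C = spread cS (_∈ˢ C) (sb _ c∈) c∈ (λ a b _ bS aC → cl a b aC bS)
    go zero C le c∈ sb | inj₁ (c , cC , x , xS , x∉ , p) =
      contradiction (subst (card S ≤_) (+-identityʳ _) le) (<⇒≱ (card-⊂ C S sb xS x∉))
    go (suc fuel) C le c∈ sb | inj₁ (c , cC , x , xS , x∉ , p) = ≤-pred (begin
      suc (m C + card S)              ≤⟨ +-monoˡ-≤ (m C + card S) (deg-at C cC (Adj-sym p)) ⟩
      deg C x + (m C + card S)        ≡⟨ sym (+-assoc (deg C x) _ _) ⟩
      deg C x + m C + card S          ≡⟨ cong (_+ card S) (sym (m-add (split-add C x∉))) ⟩
      m C′ + card S                   ≤⟨ go fuel C′
         (subst (card S ≤_) (trans (+-suc _ fuel) (cong (_+ fuel) (sym (card-add C x∉)))) le)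
         (inj₁ c∈) (λ { _ (inj₁ q) → sb _ q ; _ (inj₂ refl) → xS }) ⟩
      m S + card C′                   ≡⟨ cong (m S +_) (card-add C x∉) ⟩
      m S + suc (card C)              ≡⟨ +-suc _ _ ⟩
      suc (m S + card C)              ∎)
      where
      open ≤-Reasoning
      C′ = C ∪ˢ sing x

  card≤m+1 : ∀ S → Conn S → card S ≤ suc (m S)
  card≤m+1 S cS with inhabited cS
  ... | c , cS′ = begin
      card S                    ≡⟨ cong (_+ card S) (sym (m-sing c)) ⟩
      m (sing c) + card S       ≤⟨ growth S (sing c) cS refl (λ { _ refl → cS′ }) ⟩
      m S + card (sing c)       ≡⟨ cong (m S +_) (sumOn-sing c _) ⟩
      m S + 1                   ≡⟨ +-comm (m S) 1 ⟩
      suc (m S)                 ∎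
    where open ≤-Reasoning

2*choose2 : ∀ k → 2 * (suc k choose 2) ≡ suc k * k
2*choose2 zero    = refl
2*choose2 (suc k) = begin
  2 * (suc (suc k) choose 2)             ≡⟨ cong (2 *_) (sym (nCk+nC[k+1]≡[n+1]C[k+1] (suc k) 1)) ⟩
  2 * (suc k choose 1 + suc k choose 2)       ≡⟨ cong (λ z → 2 * (z + suc k choose 2)) (nC1≡n (suc k)) ⟩
  2 * (suc k + suc k choose 2)           ≡⟨ *-distribˡ-+ 2 (suc k) _ ⟩
  2 * suc k + 2 * (suc k choose 2)       ≡⟨ cong (2 * suc k +_) (2*choose2 k) ⟩
  2 * suc k + suc k * k             ≡⟨ solve 1 (λ k → con 2 :* (con 1 :+ k) :+ (con 1 :+ k) :* k := (con 2 :+ k) :* (con 1 :+ k)) refl k ⟩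
  suc (suc k) * suc k               ∎
  where
  open ≡-Reasoning
  open +-*-Solver

-- Cores, isolation and k-cliques

module Isolation {n : ℕ} (G : Graph n) (k′ : ℕ) where

  open InGraph G

  k : ℕ
  k = suc k′

  opaque
    -- Kept abstract: it enters the arithmetic only through the two equations that follow, the first
    -- of them doubled so that k(k-1) is never halved.
    κ : ℕ
    κ = k choose 2

    2*κ : 2 * κ ≡ k * k′
    2*κ = 2*choose2 k′

    2+κ≡t : 2 + κ ≡ t k
    2+κ≡t = refl

  τ : ℕ
  τ = 2 + κ

  Core : DSet n → Set
  Core X = ∀ x → x ∈ˢ X → k′ ≤ deg X x

  Hit : List (Fin n) → Fin n → Set
  Hit D x = Any (λ d → x ≡ d ⊎ Adj d x) D

  record Isol (D : List (Fin n)) (S : DSet n) : Set₁ where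
    constructor isol
    field
      no-core : ∀ X → X ⊆ˢ S → (∀ x → x ∈ˢ X → ¬ Hit D x) → Core X → ∀ x → x ∉ˢ X
  open Isol public

  core-card : ∀ X {x} → Core X → x ∈ˢ X → k ≤ card X
  core-card X cX p = ≤-trans (s≤s (cX _ p)) (deg<card X p)

  isol-mono : ∀ {D D′ S S′} → (∀ {x} → Hit D x → Hit D′ x) → S′ ⊆ˢ S → Isol D S → Isol D′ S′
  isol-mono h sb iso = isol λ X X⊆ ¬hit → no-core iso X (λ x → sb x ∘ X⊆ x) (λ x p → ¬hit x p ∘ h)

  -- No edge joins `A` to `B`, so the part of a core in either of them keeps all its degrees and is
  -- again a core.
  isol-split : ∀ {D₁ D₂ D S A B} → Split S A B → (∀ a b → a ∈ˢ A → b ∈ˢ B → ¬ Adj a b) →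
    (∀ {x} → Hit D₁ x → Hit D x) → (∀ {x} → Hit D₂ x → Hit D x) → Isol D₁ A → Isol D₂ B → Isol D S
  isol-split {D₁} {D₂} {D} {S} {A} {B} sp apart h₁ h₂ i₁ i₂ = isol go
    where
    inA : ∀ y z → y ∈ˢ A → z ∈ˢ S → Adj y z → z ∈ˢ A
    inA y z yA zS yz with Split.cover sp z zS
    ... | inj₁ zA = zA
    ... | inj₂ zB = contradiction yz (apart y z yA zB)
    inB : ∀ y z → y ∈ˢ B → z ∈ˢ S → Adj y z → z ∈ˢ B
    inB y z yB zS yz with Split.cover sp z zS
    ... | inj₂ zB = zB
    ... | inj₁ zA = contradiction (Adj-sym yz) (apart z y zA yB)
    go : ∀ X → X ⊆ˢ S → (∀ x → x ∈ˢ X → ¬ Hit D x) → Core X → ∀ x → x ∉ˢ X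
    go X X⊆ ¬hit core x p with Split.cover sp x (X⊆ x p)
    ... | inj₁ a = no-core i₁ (X ∩ˢ A) (λ _ → proj₂) (λ y q → ¬hit y (proj₁ q) ∘ h₁)
      (λ y q → ≤-trans (core y (proj₁ q)) (deg-≤ X (X ∩ˢ A) y (λ z r yz → r , inA y z (proj₂ q) (X⊆ z r) yz))) x (p , a)
    ... | inj₂ b = no-core i₂ (X ∩ˢ B) (λ _ → proj₂) (λ y q → ¬hit y (proj₁ q) ∘ h₂)
      (λ y q → ≤-trans (core y (proj₁ q)) (deg-≤ X (X ∩ˢ B) y (λ z r yz → r , inB y z (proj₂ q) (X⊆ z r) yz))) x (p , b)

  isol-empty : ∀ {D S} → (∀ x → x ∉ˢ S) → Isol D S
  isol-empty ∉ = isol λ X X⊆ _ _ x p → ∉ x (X⊆ x p)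

  -- A vertex of degree below k - 1 lies in no core. Removing such vertices as long as there are any
  -- leaves either nothing or a core.
  core? : ∀ R → Isol [] R ⊎ Σ[ X ∈ DSet n ] (X ⊆ˢ R × Core X × ∃[ x ] x ∈ˢ X)
  core? R₀ = go (card R₀) R₀ ≤-refl
    where
    go : ∀ fuel R → card R ≤ fuel → Isol [] R ⊎ Σ[ X ∈ DSet n ] (X ⊆ˢ R × Core X × ∃[ x ] x ∈ˢ X)
    go fuel R le with find R (λ x → suc (deg R x) ≤? k′)
    go fuel R le | inj₂ ¬low with find R (λ _ → yes tt)
    ... | inj₁ (x , xR , _) = inj₂ (R , (λ _ → id) , (λ y q → ≤-pred (≰⇒> (¬low y q))) , x , xR)
    ... | inj₂ none = inj₁ (isol-empty (λ x q → none x q tt))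
    go zero R le | inj₁ (x , xR , _) = contradiction (≤-trans (card-positive R xR) le) λ ()
    go (suc fuel) R le | inj₁ (x , xR , low) with go fuel (R ─ x) (≤-pred (subst (_≤ suc fuel) (card-remove R xR) le))
    ... | inj₂ (X , sb , rest) = inj₂ (X , (λ y → proj₁ ∘ sb y) , rest)
    ... | inj₁ iso = inj₁ (isol λ X X⊆ ¬hit core → no-core iso X
            (λ y q → X⊆ y q , λ { refl → <⇒≱ low (≤-trans (core y q) (sumOn-⊆ X R X⊆)) }) ¬hit core)

  record Clique (Q : DSet n) : Set where
    field
      size     : card Q ≡ k
      pairwise : ∀ x y → x ∈ˢ Q → y ∈ˢ Q → x ≢ y → Adj x y

  clique-deg : ∀ {Q} → Clique Q → ∀ {x} → x ∈ˢ Q → deg Q x ≡ k′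
  clique-deg {Q} cl {x} p = suc-injective (begin
    suc (deg Q x)          ≡⟨ cong suc (deg-remove-self Q) ⟩
    suc (deg (Q ─ x) x)    ≡⟨ cong suc (deg-complete (Q ─ x) x (λ y q → Clique.pairwise cl x y p (proj₁ q) (proj₂ q ∘ sym))) ⟩
    suc (card (Q ─ x))     ≡⟨ sym (card-remove Q p) ⟩
    card Q                 ≡⟨ Clique.size cl ⟩
    k                      ∎)
    where open ≡-Reasoning

  regular-2m : ∀ {S} → (∀ x → x ∈ˢ S → deg S x ≡ k′) → 2 * m S ≡ k′ * card S
  regular-2m {S} reg = trans (double-m S) (trans (sumOn-cong S reg) (sumOn-const S k′))

  clique-m : ∀ {Q} → Clique Q → m Q ≡ κ
  clique-m {Q} cl = *-cancelˡ-≡ _ _ 2 (begin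
    2 * m Q        ≡⟨ regular-2m (λ x → clique-deg cl) ⟩
    k′ * card Q    ≡⟨ cong (k′ *_) (Clique.size cl) ⟩
    k′ * k         ≡⟨ *-comm k′ k ⟩
    k * k′         ≡⟨ sym 2*κ ⟩
    2 * κ          ∎)
    where open ≡-Reasoning

  clique-inhabited : ∀ {Q} → Clique Q → ∃[ x ] x ∈ˢ Q
  clique-inhabited {Q} cl with sumOn-find Q _ (≤-trans (s≤s z≤n) (≤-reflexive (sym (Clique.size cl))))
  ... | x , p , _ = x , p

  clique-conn : ∀ {Q} → Clique Q → Conn Q
  clique-conn {Q} cl = record { inhabited = clique-inhabited cl ; spread = sp }
    where
    sp : ∀ (X : Fin n → Set) {x} → x ∈ˢ Q → X x →
         (∀ a b → a ∈ˢ Q → b ∈ˢ Q → X a → Adj a b → X b) → ∀ y → y ∈ˢ Q → X y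
    sp X {x} xQ Xx step′ y yQ with x Fin.≟ y
    ... | yes refl = Xx
    ... | no ne = step′ x y xQ yQ Xx (Clique.pairwise cl x y xQ yQ ne)

  -- On at most k vertices, degree k - 1 requires every other vertex as a neighbour; a single
  -- non-neighbour leaves at most k - 2.
  small-core-clique : ∀ X {x} → Core X → x ∈ˢ X → card X ≤ k → Clique X
  small-core-clique X core xX le = record
    { size = ≤-antisym le (core-card X core xX)
    ; pairwise = λ a b aX bX ne → neighbour a b aX bX ne }
    where
    neighbour : ∀ a b → a ∈ˢ X → b ∈ˢ X → a ≢ b → Adj a b
    neighbour a b aX bX ne with adj? a b
    ... | yes p = p
    ... | no ¬p = contradiction (core a aX) (<⇒≱ (begin-strict
        deg X a               ≤⟨ deg-≤ X (X ─ a ─ b) a (λ y q p → (q , Adj-irrefl (Adj-sym p)) , λ { refl → ¬p p }) ⟩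
        deg (X ─ a ─ b) a     ≤⟨ deg≤card (X ─ a ─ b) a ⟩
        card (X ─ a ─ b)      <⟨ ≤-pred (≤-trans (≤-reflexive (trans (cong suc (sym (card-remove (X ─ a) (bX , ne ∘ sym)))) (sym (card-remove X aX)))) le) ⟩
        k′                    ∎))
      where open ≤-Reasoning

  -- A vertex of the core has at most k - 1 neighbours in `S` and at least k - 1 in the core, hence
  -- none outside. So the core spreads over the connected set `S`, and one hit vertex of `S` rules
  -- it out.
  core-in-regular : ∀ {S X x} → Conn S → X ⊆ˢ S → Core X → (∀ y → y ∈ˢ X → deg S y ≤ k′) → x ∈ˢ X → S ⊆ˢ X
  core-in-regular {S} {X} {x} cS X⊆ core low xX =
    spread cS (_∈ˢ X) (X⊆ x xX) xX
      (λ a b _ bS aX ab → neighbours-inside X S X⊆ (≤-trans (low a aX) (core a aX)) b bS ab)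

  regular-isol : ∀ {S D h} → Conn S → (∀ y → y ∈ˢ S → deg S y ≤ k′) → h ∈ˢ S → Hit D h → Isol D S
  regular-isol cS low hS hit = isol λ X X⊆ ¬hit core x p →
    ¬hit _ (core-in-regular cS X⊆ core (λ y → low y ∘ X⊆ y) p _ hS) hit

  clique-isol : ∀ {Q D h} → Clique Q → h ∈ˢ Q → Hit D h → Isol D Q
  clique-isol cl = regular-isol (clique-conn cl) (λ y q → ≤-reflexive (clique-deg cl q))

  record IsoOn {h} (H : Graph h) (S : DSet n) : Set where
    field
      emb      : Fin h → Fin n
      emb-inj  : Injective _≡_ _≡_ emb
      emb-∈    : ∀ a → emb a ∈ˢ S
      emb-onto : ∀ x → x ∈ˢ S → ∃[ a ] (x ≡ emb a)
      emb-adj  : ∀ a b → adj G (emb a) (emb b) ≡ adj H a b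

    sum-over : ∀ g → sumOn S g ≡ ∑ (g ∘ emb)
    sum-over g = sym (∑-image S emb emb-inj emb-∈ emb-onto g)

    deg-emb : ∀ a → deg S (emb a) ≡ degree H a
    deg-emb a = trans (sum-over (α (emb a))) (∑-cong (λ b → cong χ (emb-adj a b)))

    2*m-emb : 2 * m S ≡ ∑ (degree H)
    2*m-emb = trans (double-m S) (trans (sum-over (deg S)) (∑-cong deg-emb))

  -- The k-clique constituents of a special set

  petal : DSet n → (Fin n → Fin n) → Fin n → DSet n
  petal R ctr c = ⟨ (λ y → y ∈ˢ R × ctr y ≡ c × y ≢ c)
                  , (λ y → mem? R y ×-dec (ctr y Fin.≟ c) ×-dec ¬? (y Fin.≟ c)) ⟩

  -- The k-clique constituents on R: ctr sends each vertex of G_i to v_i (so the v_i are the fixed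
  -- points), petal v_i is U_i and hook v_i is u_i¹.
  record Constituents (R : DSet n) : Set where
    field
      ctr hook    : Fin n → Fin n
      ctr-∈       : ∀ x → x ∈ˢ R → ctr x ∈ˢ R
      ctr-idem    : ∀ x → x ∈ˢ R → ctr (ctr x) ≡ ctr x
      petal-adj   : ∀ x y → x ∈ˢ R → y ∈ˢ R → ctr x ≢ x → ctr y ≢ y → ctr x ≡ ctr y → x ≢ y → Adj x y
      separate    : ∀ x y → x ∈ˢ R → y ∈ˢ R → Adj x y → ctr x ≡ ctr y ⊎ (ctr x ≡ x × ctr y ≡ y)
      petal-size  : ∀ c → c ∈ˢ R → ctr c ≡ c → card (petal R ctr c) ≡ k
      hook-∈      : ∀ c → c ∈ˢ R → ctr c ≡ c → hook c ∈ˢ petal R ctr c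
      hook-adj    : ∀ c → c ∈ˢ R → ctr c ≡ c → Adj c (hook c)
      hook-unique : ∀ c y → c ∈ˢ R → ctr c ≡ c → y ∈ˢ petal R ctr c → Adj c y → y ≡ hook c

    centres : DSet n
    centres = ⟨ (λ x → x ∈ˢ R × ctr x ≡ x) , (λ x → mem? R x ×-dec (ctr x Fin.≟ x)) ⟩
  open Constituents public

  petal-clique : ∀ {R} (P : Constituents R) {c} → c ∈ˢ R → ctr P c ≡ c → Clique (petal R (ctr P) c)
  petal-clique P {c} cR cc = record
    { size = petal-size P c cR cc
    ; pairwise = λ { x y (xR , refl , x≢) (yR , yc , y≢) ne →
        petal-adj P x y xR yR (x≢ ∘ sym) (λ q → y≢ (trans (sym q) yc)) (sym yc) ne } }

  -- The edges that cross run between centres only, so petals and hooks of either side are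
  -- unaffected, and a crossing edge falls under the second alternative of `separate`.
  merge : ∀ {S A B} → Split S A B → (PA : Constituents A) (PB : Constituents B) →
    (∀ a b → a ∈ˢ A → b ∈ˢ B → Adj a b → ctr PA a ≡ a × ctr PB b ≡ b) →
    Σ[ P ∈ Constituents S ] ((∀ x → x ∈ˢ A → ctr P x ≡ ctr PA x) × (∀ x → x ∈ˢ B → ctr P x ≡ ctr PB x))
  merge {S} {A} {B} sp PA PB cross = record
    { ctr = c ; hook = hk
    ; ctr-∈ = ctr∈ ; ctr-idem = idem ; petal-adj = padj ; separate = sep ; petal-size = psize
    ; hook-∈ = hk∈ ; hook-adj = hkadj ; hook-unique = hkuniq } , cA , cB
    where
    open Split sp
    pick : (Fin n → Fin n) → (Fin n → Fin n) → Fin n → Fin n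
    pick f g x = if does (mem? A x) then f x else g x
    pickA : ∀ f g {x} → x ∈ˢ A → pick f g x ≡ f x
    pickA f g {x} p with mem? A x
    ... | yes _ = refl
    ... | no ¬p = contradiction p ¬p
    pickB : ∀ f g {x} → x ∈ˢ B → pick f g x ≡ g x
    pickB f g {x} p with mem? A x
    ... | yes a = contradiction p (disjoint x a)
    ... | no ¬p = refl
    c hk : Fin n → Fin n
    c = pick (ctr PA) (ctr PB)
    hk = pick (hook PA) (hook PB)
    cA : ∀ x → x ∈ˢ A → c x ≡ ctr PA x
    cA x = pickA (ctr PA) (ctr PB)
    cB : ∀ x → x ∈ˢ B → c x ≡ ctr PB x
    cB x = pickB (ctr PA) (ctr PB)
    -- Each side is closed under its own `ctr`, so a common centre would lie in both sides.
    apart : ∀ {x y} → x ∈ˢ A → y ∈ˢ B → c x ≢ c y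
    apart {x} {y} a b eq = disjoint (ctr PA x) (ctr-∈ PA x a)
      (subst (_∈ˢ B) (trans (sym (cB y b)) (trans (sym eq) (cA x a))) (ctr-∈ PB y b))
    ctr∈ : ∀ x → x ∈ˢ S → c x ∈ˢ S
    ctr∈ x s with cover x s
    ... | inj₁ a = left _ (subst (_∈ˢ A) (sym (cA x a)) (ctr-∈ PA x a))
    ... | inj₂ b = right _ (subst (_∈ˢ B) (sym (cB x b)) (ctr-∈ PB x b))
    idem : ∀ x → x ∈ˢ S → c (c x) ≡ c x
    idem x s with cover x s
    ... | inj₁ a rewrite cA x a = trans (cA _ (ctr-∈ PA x a)) (ctr-idem PA x a)
    ... | inj₂ b rewrite cB x b = trans (cB _ (ctr-∈ PB x b)) (ctr-idem PB x b)
    padj : ∀ x y → x ∈ˢ S → y ∈ˢ S → c x ≢ x → c y ≢ y → c x ≡ c y → x ≢ y → Adj x y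
    padj x y xS yS x≢ y≢ eq ne with cover x xS | cover y yS
    ... | inj₁ xA | inj₁ yA rewrite cA x xA | cA y yA = petal-adj PA x y xA yA x≢ y≢ eq ne
    ... | inj₂ xB | inj₂ yB rewrite cB x xB | cB y yB = petal-adj PB x y xB yB x≢ y≢ eq ne
    ... | inj₁ xA | inj₂ yB = contradiction eq (apart xA yB)
    ... | inj₂ xB | inj₁ yA = contradiction (sym eq) (apart yA xB)
    sep : ∀ x y → x ∈ˢ S → y ∈ˢ S → Adj x y → c x ≡ c y ⊎ (c x ≡ x × c y ≡ y)
    sep x y xS yS p with cover x xS | cover y yS
    ... | inj₁ xA | inj₁ yA rewrite cA x xA | cA y yA = separate PA x y xA yA p
    ... | inj₂ xB | inj₂ yB rewrite cB x xB | cB y yB = separate PB x y xB yB p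
    ... | inj₁ xA | inj₂ yB rewrite cA x xA | cB y yB = inj₂ (cross x y xA yB p)
    ... | inj₂ xB | inj₁ yA rewrite cB x xB | cA y yA with cross y x yA xB (Adj-sym p)
    ...   | q , r = inj₂ (r , q)
    toA : ∀ {x} → x ∈ˢ A → c x ≡ x → petal S c x ⊆ˢ petal A (ctr PA) x
    toA {x} xA cx y (yS , yx , ne) with cover y yS
    ... | inj₁ yA = yA , trans (sym (cA y yA)) yx , ne
    ... | inj₂ yB = contradiction (trans cx (sym yx)) (apart xA yB)
    fromA : ∀ {x} → petal A (ctr PA) x ⊆ˢ petal S c x
    fromA y (yA , yx , ne) = left y yA , trans (cA y yA) yx , ne
    toB : ∀ {x} → x ∈ˢ B → c x ≡ x → petal S c x ⊆ˢ petal B (ctr PB) x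
    toB {x} xB cx y (yS , yx , ne) with cover y yS
    ... | inj₂ yB = yB , trans (sym (cB y yB)) yx , ne
    ... | inj₁ yA = contradiction (trans yx (sym cx)) (apart yA xB)
    fromB : ∀ {x} → petal B (ctr PB) x ⊆ˢ petal S c x
    fromB y (yB , yx , ne) = right y yB , trans (cB y yB) yx , ne
    psize : ∀ x → x ∈ˢ S → c x ≡ x → card (petal S c x) ≡ k
    psize x s cx with cover x s
    ... | inj₁ a = trans (sumOn-≐ _ _ (toA a cx) fromA) (petal-size PA x a (trans (sym (cA x a)) cx))
    ... | inj₂ b = trans (sumOn-≐ _ _ (toB b cx) fromB) (petal-size PB x b (trans (sym (cB x b)) cx))
    hk∈ : ∀ x → x ∈ˢ S → c x ≡ x → hk x ∈ˢ petal S c x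
    hk∈ x s cx with cover x s
    ... | inj₁ a = subst (_∈ˢ petal S c x) (sym (pickA (hook PA) (hook PB) a))
                     (fromA _ (hook-∈ PA x a (trans (sym (cA x a)) cx)))
    ... | inj₂ b = subst (_∈ˢ petal S c x) (sym (pickB (hook PA) (hook PB) b))
                     (fromB _ (hook-∈ PB x b (trans (sym (cB x b)) cx)))
    hkadj : ∀ x → x ∈ˢ S → c x ≡ x → Adj x (hk x)
    hkadj x s cx with cover x s
    ... | inj₁ a = subst (Adj x) (sym (pickA (hook PA) (hook PB) a)) (hook-adj PA x a (trans (sym (cA x a)) cx))
    ... | inj₂ b = subst (Adj x) (sym (pickB (hook PA) (hook PB) b)) (hook-adj PB x b (trans (sym (cB x b)) cx))
    hkuniq : ∀ x y → x ∈ˢ S → c x ≡ x → y ∈ˢ petal S c x → Adj x y → y ≡ hk x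
    hkuniq x y s cx yp p with cover x s
    ... | inj₁ a = trans (hook-unique PA x y a (trans (sym (cA x a)) cx) (toA a cx y yp) p) (sym (pickA (hook PA) (hook PB) a))
    ... | inj₂ b = trans (hook-unique PB x y b (trans (sym (cB x b)) cx) (toB b cx y yp) p) (sym (pickB (hook PA) (hook PB) b))

  merge-centres : ∀ {S A B} (sp : Split S A B) (PA : Constituents A) (PB : Constituents B) cross →
    Split (centres (proj₁ (merge sp PA PB cross))) (centres PA) (centres PB)
  merge-centres {S} {A} {B} sp PA PB cross = record
    { left = λ { x (a , q) → left x a , trans (cA x a) q }
    ; right = λ { x (b , q) → right x b , trans (cB x b) q }
    ; cover = cov
    ; disjoint = λ x a b → disjoint x (proj₁ a) (proj₁ b) }
    where
    open Split sp
    P  = proj₁ (merge sp PA PB cross)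
    cA = proj₁ (proj₂ (merge sp PA PB cross))
    cB = proj₂ (proj₂ (merge sp PA PB cross))
    cov : ∀ x → x ∈ˢ centres P → x ∈ˢ centres PA ⊎ x ∈ˢ centres PB
    cov x (s , q) with cover x s
    ... | inj₁ a = inj₁ (a , trans (sym (cA x a)) q)
    ... | inj₂ b = inj₂ (b , trans (sym (cB x b)) q)

  single : ∀ {F x h} → x ∈ˢ F → h ∈ˢ F → Clique (F ─ x) → Adj x h → (∀ y → y ∈ˢ F → Adj x y → y ≡ h) → Constituents F
  single {F} {x} {h} xF hF cl xh uniq = record
    { ctr = λ _ → x ; hook = λ _ → h
    ; ctr-∈ = λ _ _ → xF ; ctr-idem = λ _ _ → refl
    ; petal-adj = λ a b aF bF a≢ b≢ _ ne → Clique.pairwise cl a b (aF , a≢ ∘ sym) (bF , b≢ ∘ sym) ne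
    ; separate = λ _ _ _ _ _ → inj₁ refl
    ; petal-size = λ { _ _ refl → trans (sumOn-≐ _ (F ─ x) (λ { y (yF , _ , ne) → yF , ne }) (λ { y (yF , ne) → yF , refl , ne })) (Clique.size cl) }
    ; hook-∈ = λ { _ _ refl → hF , refl , Adj-irrefl (Adj-sym xh) }
    ; hook-adj = λ { _ _ refl → xh }
    ; hook-unique = λ { _ y _ refl (yF , _) p → uniq y yF p } }

  single-centres : ∀ {F x h} (xF : x ∈ˢ F) (hF : h ∈ˢ F) cl xh uniq →
    let P = single {F} {x} {h} xF hF cl xh uniq in centres P ⊆ˢ sing x × sing x ⊆ˢ centres P
  single-centres xF hF cl xh uniq = (λ y p → sym (proj₂ p)) , (λ { y refl → xF , refl })

  listOf : (A : DSet n) → List (Fin n)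
  listOf A = List.tabulate (Enumeration.enum (enumerate (card A) A refl))

  length-listOf : ∀ A → length (listOf A) ≡ card A
  length-listOf A = length-tabulate (Enumeration.enum (enumerate (card A) A refl))

  hit-listOf : ∀ A {x d} → d ∈ˢ A → x ≡ d ⊎ Adj d x → Hit (listOf A) x
  hit-listOf A {x} p h with Enumeration.enum-onto (enumerate (card A) A refl) _ p
  ... | a , refl = tabulate⁺ {f = Enumeration.enum (enumerate (card A) A refl)} a h

-- Special sets met outside their centres

module OffCentre {n : ℕ} (G : Graph n) (k′ : ℕ) where

  open InGraph G
  open Isolation G k′

  card-two : ∀ (A : DSet n) {x y} → x ∈ˢ A → y ∈ˢ A → y ≢ x → 2 ≤ card A
  card-two A = sumOn-two A (λ _ → 1)

  card-three : ∀ (A : DSet n) {x y z} → x ∈ˢ A → y ∈ˢ A → z ∈ˢ A → y ≢ x → z ≢ x → z ≢ y → 3 ≤ card A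
  card-three A {x} p q r yx zx zy =
    subst (3 ≤_) (sym (card-remove A p)) (s≤s (card-two (A ─ x) (q , yx) (r , zx) zy))

  card-sing : ∀ (x : Fin n) → card (sing x) ≡ 1
  card-sing x = sumOn-sing x _

  card-pair : ∀ (x y : Fin n) → card (sing x ∪ˢ sing y) ≤ 2
  card-pair x y with y Fin.≟ x
  ... | no ne = ≤-reflexive (trans (card-add (sing x) ne) (cong suc (card-sing x)))
  ... | yes refl = ≤-trans (card-⊆ (sing x ∪ˢ sing x) (sing x) (λ { _ (inj₁ p) → p ; _ (inj₂ p) → p }))
                           (≤-trans (≤-reflexive (card-sing x)) (s≤s z≤n))

  module _ {I : DSet n} {x w : Fin n} (P : Constituents I) (cI : Conn I) (wI : w ∈ˢ I) (w≢ : ctr P w ≢ w) (xw : Adj x w) where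

    private
      c u : Fin n
      c = ctr P w
      u = hook P c
      c∈ : c ∈ˢ I
      c∈ = ctr-∈ P w wI
      cc : ctr P c ≡ c
      cc = ctr-idem P w wI
      U : DSet n
      U = petal I (ctr P) c
      |U| : card U ≡ k
      |U| = petal-size P c c∈ cc
      wU : w ∈ˢ U
      wU = wI , refl , w≢ ∘ sym
      uU : u ∈ˢ U
      uU = hook-∈ P c c∈ cc
      D : List (Fin n)
      D = listOf (centres P ─ c)
      |D| : suc (length D) ≡ card (centres P)
      |D| = trans (cong suc (length-listOf (centres P ─ c))) (sym (card-remove (centres P) (c∈ , cc)))

      module _ {X : DSet n} (X⊆ : X ⊆ˢ I) (¬hit : ∀ y → y ∈ˢ X → ¬ Hit (x ∷ D) y) (core : Core X) where

        ≢w : ∀ z → z ∈ˢ X → z ≢ w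
        ≢w z zX refl = ¬hit z zX (here (inj₂ xw))

        centre⇒c : ∀ z → z ∈ˢ X → ctr P z ≡ z → z ≡ c
        centre⇒c z zX cz with z Fin.≟ c
        ... | yes q = q
        ... | no ne = contradiction (there (hit-listOf (centres P ─ c) ((X⊆ z zX , cz) , ne) (inj₁ refl))) (¬hit z zX)

        -- Of the k vertices of the petal, neither `z` nor `v` is a neighbour of `z` in `X`; at most
        -- k - 2 remain, too few for a core.
        crowded : ∀ {c′ v} z → z ∈ˢ X → card (petal I (ctr P) c′) ≡ k → v ∈ˢ petal I (ctr P) c′ → z ∈ˢ petal I (ctr P) c′ →
          z ≢ v → ¬ (∀ y → y ∈ˢ X → Adj z y → y ∈ˢ petal I (ctr P) c′ × y ≢ v)
        crowded {c′} {v} z zX sz v∈ z∈ ne nb = <⇒≱ (begin-strict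
          deg X z                   ≤⟨ deg-≤ X (A ─ v ─ z) z (λ y yX zy → nb y yX zy , Adj-irrefl (Adj-sym zy)) ⟩
          deg (A ─ v ─ z) z         ≤⟨ deg≤card (A ─ v ─ z) z ⟩
          card (A ─ v ─ z)          <⟨ n<1+n _ ⟩
          suc (card (A ─ v ─ z))    ≡⟨ suc-injective (trans (cong suc (sym (card-remove (A ─ v) (z∈ , ne)))) (trans (sym (card-remove A v∈)) sz)) ⟩
          k′                        ∎) (core z zX)
          where
          open ≤-Reasoning
          A = petal I (ctr P) c′

        -- In a petal whose centre is in `D` the hook is hit; in the petal of `c` the vertex `w` is
        -- hit by `x`. Either way the petal has lost a vertex and `crowded` applies. Only `u`
        -- escapes, because `c` may replace the lost neighbour.
        petal⇒u : ∀ z → z ∈ˢ X → ctr P z ≢ z → z ≡ u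
        petal⇒u z zX z≢ with ctr P z Fin.≟ c
        ... | no c′≢ = ⊥-elim (crowded {ctr P z} {hook P (ctr P z)} z zX (petal-size P _ c′∈ cc′) (hook-∈ P _ c′∈ cc′)
                 (zI , refl , z≢ ∘ sym) (hookless z zX) nb)
          where
          zI = X⊆ z zX
          c′∈ = ctr-∈ P z zI
          cc′ = ctr-idem P z zI
          hookless : ∀ y → y ∈ˢ X → y ≢ hook P (ctr P z)
          hookless y yX refl = ¬hit y yX (there (hit-listOf (centres P ─ c) ((c′∈ , cc′) , c′≢) (inj₂ (hook-adj P _ c′∈ cc′))))
          nb : ∀ y → y ∈ˢ X → Adj z y → y ∈ˢ petal I (ctr P) (ctr P z) × y ≢ hook P (ctr P z)
          nb y yX zy with separate P z y zI (X⊆ y yX) zy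
          ... | inj₂ (q , _) = contradiction q z≢
          ... | inj₁ eq = (X⊆ y yX , sym eq , λ y≡ → c′≢ (trans (sym y≡) (centre⇒c y yX (trans (sym eq) (sym y≡))))) , hookless y yX
        ... | yes zc with z Fin.≟ u
        ...   | yes q = q
        ...   | no z≢u = ⊥-elim (crowded {c} {w} z zX |U| wU (zI , zc , z≢c) (≢w z zX) nb)
          where
          zI = X⊆ z zX
          z≢c : z ≢ c
          z≢c q = z≢ (trans zc (sym q))
          nb : ∀ y → y ∈ˢ X → Adj z y → y ∈ˢ U × y ≢ w
          nb y yX zy with separate P z y zI (X⊆ y yX) zy
          ... | inj₂ (q , _) = contradiction q z≢
          ... | inj₁ eq = (X⊆ y yX , trans (sym eq) zc , y≢c) , ≢w y yX
            where
            y≢c : y ≢ c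
            y≢c y≡ = z≢u (hook-unique P c z c∈ cc (zI , zc , z≢c) (Adj-sym (subst (Adj z) y≡ zy)))

        c-or-u : ∀ z → z ∈ˢ X → z ≡ c ⊎ z ≡ u
        c-or-u z zX with ctr P z Fin.≟ z
        ... | yes q = inj₁ (centre⇒c z zX q)
        ... | no ¬q = inj₂ (petal⇒u z zX ¬q)

    Recentred : Set
    Recentred = card (centres P) ≡ 1 × Σ[ P′ ∈ Constituents I ]
      (ctr P′ w ≡ w × card (centres P′) ≡ 1 × m (centres P′) ≡ 0)

    -- The list D omits the centre of w. It fails only if I is a path on k + 1 ≤ 3 vertices with
    -- end w, and then w can itself be taken as the centre.
    off-centre : (Σ[ D ∈ List (Fin n) ] (suc (length D) ≡ card (centres P) × Isol (x ∷ D) I)) ⊎ Recentred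
    off-centre with find (centres P ─ c) (adj? c)
    -- Here `c` is hit by a neighbouring centre from `D`, so a core could only be the single vertex
    -- `u`. But then `u` differs from `w`, the petal has two vertices, and k is at least 2.
    ... | inj₁ (c″ , c″∈ , cc″) = inj₁ (D , |D| , isol λ X X⊆ ¬hit core z zX →
            let only : X ⊆ˢ sing u
                only y yX = [ (λ { refl → contradiction (there (hit-listOf (centres P ─ c) c″∈ (inj₂ (Adj-sym cc″)))) (¬hit y yX) }) , id ]′
                              (c-or-u X⊆ ¬hit core y yX)
            in contradiction (≤-trans (core-card X core zX) (≤-trans (card-⊆ X (sing u) only) (≤-reflexive (card-sing u))))
                 (<⇒≱ (subst (2 ≤_) |U| (card-two U wU uU (λ q → ≢w X⊆ ¬hit core z zX (trans (only z zX) q))))))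
    -- With no centre next to `c`, connectedness makes `c` the only centre: the set is a single
    -- k-clique with a pendant edge, and `D` is empty.
    ... | inj₂ none = go (u Fin.≟ w)
      where
      all-c : ∀ y → y ∈ˢ I → ctr P y ≡ c
      all-c = spread cI (λ y → ctr P y ≡ c) c∈ cc cl
        where
        cl : ∀ a b → a ∈ˢ I → b ∈ˢ I → ctr P a ≡ c → Adj a b → ctr P b ≡ c
        cl a b aI bI ac ab with separate P a b aI bI ab
        ... | inj₁ eq = trans (sym eq) ac
        ... | inj₂ (ca , cb) with b Fin.≟ c
        ...   | yes q = trans cb q
        ...   | no ne = contradiction (subst (λ z → Adj z b) (trans (sym ca) ac) ab) (none b ((bI , cb) , ne))
      centres≐ : card (centres P) ≡ 1
      centres≐ = trans (sumOn-≐ (centres P) (sing c) (λ { y (yI , q) → trans (sym q) (all-c y yI) }) (λ { y refl → c∈ , cc })) (card-sing c)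
      in-petal : ∀ y → y ∈ˢ I → y ≢ c → y ∈ˢ U
      in-petal y yI ne = yI , all-c y yI , ne
      size′ : card (I ─ w) ≡ k
      size′ = trans (suc-injective (trans (sym (card-remove I wI)) (card-remove I c∈)))
                    (trans (sumOn-≐ (I ─ c) U (λ { y (yI , ne) → in-petal y yI ne }) (λ { y (yI , _ , ne) → yI , ne })) |U|)
      recentre : ∀ {h} → h ∈ˢ I → (∀ a b → a ∈ˢ I ─ w → b ∈ˢ I ─ w → a ≢ b → Adj a b) → Adj w h →
                 (∀ y → y ∈ˢ I → Adj w y → y ≡ h) → Recentred
      recentre hI pw wh uq = centres≐ , single wI hI cl wh uq , refl , trans (sumOn-≐ _ (sing w) (proj₁ sc) (proj₂ sc)) (card-sing w)
                              , trans (m-≐ _ (sing w) (proj₁ sc) (proj₂ sc)) (m-sing w)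
        where
        cl : Clique (I ─ w)
        cl = record { size = size′ ; pairwise = pw }
        sc = single-centres {I} {w} wI hI cl wh uq
      go : Dec (u ≡ w) → _ ⊎ Recentred
      go (yes u≡w) with k ≤? 1
      ... | no k≰1 = inj₁ (D , |D| , isol λ X X⊆ ¬hit core z zX →
              k≰1 (≤-trans (core-card X core zX) (≤-trans (card-⊆ X (sing c)
                (λ y yX → [ id , (λ q → contradiction (trans q u≡w) (≢w X⊆ ¬hit core y yX)) ]′ (c-or-u X⊆ ¬hit core y yX)))
                (≤-reflexive (card-sing c)))))
      ... | yes k≤1 = inj₂ (recentre c∈ (λ a b a∈ b∈ ne → ⊥-elim (two a∈ b∈ (ne ∘ sym)))
                        (Adj-sym (subst (Adj c) u≡w (hook-adj P c c∈ cc))) uq)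
        where
        two : ∀ {a b} → a ∈ˢ I ─ w → b ∈ˢ I ─ w → b ≢ a → ⊥
        two a∈ b∈ ne = <⇒≱ (card-two (I ─ w) a∈ b∈ ne) (≤-trans (≤-reflexive size′) k≤1)
        uq : ∀ y → y ∈ˢ I → Adj w y → y ≡ c
        uq y yI wy with y Fin.≟ c
        ... | yes q = q
        ... | no ne = ⊥-elim (two (c∈ , w≢) (yI , Adj-irrefl (Adj-sym wy)) ne)
      go (no u≢w) with k ≤? 2
      ... | no k≰2 = inj₁ (D , |D| , isol λ X X⊆ ¬hit core z zX →
              k≰2 (≤-trans (core-card X core zX) (≤-trans (card-⊆ X (sing c ∪ˢ sing u) (λ y yX → c-or-u X⊆ ¬hit core y yX)) (card-pair c u))))
      ... | yes k≤2 = inj₂ (recentre (proj₁ uU) pw (petal-adj P w u wI (proj₁ uU) w≢ (λ q → proj₂ (proj₂ uU) (trans (sym q) (proj₁ (proj₂ uU)))) (sym (proj₁ (proj₂ uU))) (u≢w ∘ sym)) uq)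
        where
        is-u : ∀ y → y ∈ˢ U → y ≢ w → y ≡ u
        is-u y yU y≢w with y Fin.≟ u
        ... | yes q = q
        ... | no y≢u = contradiction (≤-trans (≤-reflexive |U|) k≤2) (<⇒≱ (card-three U wU uU yU u≢w y≢w y≢u))
        pw : ∀ a b → a ∈ˢ I ─ w → b ∈ˢ I ─ w → a ≢ b → Adj a b
        pw a b (aI , a≢w) (bI , b≢w) ne with a Fin.≟ c | b Fin.≟ c
        ... | yes refl | yes refl = contradiction refl ne
        ... | yes refl | no b≢c rewrite is-u b (in-petal b bI b≢c) b≢w = hook-adj P c c∈ cc
        ... | no a≢c | yes refl rewrite is-u a (in-petal a aI a≢c) a≢w = Adj-sym (hook-adj P c c∈ cc)
        ... | no a≢c | no b≢c = contradiction (trans (is-u a (in-petal a aI a≢c) a≢w) (sym (is-u b (in-petal b bI b≢c) b≢w))) ne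
        uq : ∀ y → y ∈ˢ I → Adj w y → y ≡ u
        uq y yI wy with y Fin.≟ c
        ... | yes refl = contradiction (sym (hook-unique P c w c∈ cc wU (Adj-sym wy))) u≢w
        ... | no ne = is-u y (in-petal y yI ne) (Adj-irrefl (Adj-sym wy))

-- This passes tightness of a sum of estimates on to each summand.
+-≡-split : ∀ {a b c d} → a ≤ b → c ≤ d → a + c ≡ b + d → a ≡ b × c ≡ d
+-≡-split {a} {b} {c} {d} a≤b c≤d eq = a≡b , +-cancelˡ-≡ a c d (trans eq (cong (_+ d) (sym a≡b)))
  where
  a≡b : a ≡ b
  a≡b = ≤-antisym a≤b (+-cancelʳ-≤ d b a (≤-trans (≤-reflexive (sym eq)) (+-monoʳ-≤ a c≤d)))

opaque
  -- Without `a` the 5-cycle is a path on four vertices. An inner vertex of this path dominates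
  -- three of them, and the one left over spans no edge.
  C5-far-vertex : ∀ a → ∃[ d ] ∀ b c → adj C5 b c ≡ true →
    b ≡ a ⊎ c ≡ a ⊎ (b ≡ d ⊎ adj C5 d b ≡ true) ⊎ (c ≡ d ⊎ adj C5 d c ≡ true)
  C5-far-vertex = from-yes (all? λ a → any? λ d → all? λ b → all? λ c →
    (adj C5 b c Bool.≟ true) →-dec
    ((b Fin.≟ a) ⊎-dec (c Fin.≟ a) ⊎-dec
     ((b Fin.≟ d) ⊎-dec (adj C5 d b Bool.≟ true)) ⊎-dec ((c Fin.≟ d) ⊎-dec (adj C5 d c Bool.≟ true))))

  C4-total : ∑ (degree C4) ≡ 2 * 4
  C4-total = refl

  C5-total : ∑ (degree C5) ≡ 2 * 5
  C5-total = refl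

  C4-degree : ∀ a → degree C4 a ≡ 2
  C4-degree = from-yes (all? λ a → degree C4 a ≟ 2)

-- Components left by deleting one vertex

module Hub {n : ℕ} (G : Graph n) (k′ : ℕ) where

  open InGraph G
  open Isolation G k′
  open OffCentre G k′

  -- That the centres form a tree is recorded only by their number of edges; they are connected
  -- because `S` is. Unlike a tree structure, the counts simply add up when sets are merged.
  data Extremal (S : DSet n) (q : ℕ) : Set where
    special  : (P : Constituents S) → card (centres P) ≡ q → suc (m (centres P)) ≡ q → Extremal S q
    pentagon : k ≡ 2 → IsoOn C5 S → Extremal S q
    square   : k ≡ 3 → IsoOn C4 S → Extremal S q

  -- A k-clique needs one vertex although `τ` exceeds its number of edges by 2, so it fits neither
  -- bound and is listed apart.
  data Result (S : DSet n) : Set₁ where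
    clique : Clique S → Result S
    strict : ∀ D → Isol D S → τ * length D ≤ m S → Result S
    tight  : ∀ D → Isol D S → τ * length D ≡ suc (m S) → Extremal S (length D) → Result S

  -- Intended for a union of components of S - x. The vertex `x` helps to isolate but is paid for
  -- later. In the tight case `x` is ready to become a further centre: together with the centres of
  -- `R` it makes `length D + 1` vertices with `length D` edges, the count of a tree.
  record Part (x : Fin n) (R : DSet n) : Set₁ where
    field
      D       : List (Fin n)
      isolate : Isol (x ∷ D) R
      bound   : τ * length D ≤ m R + deg R x
      if-tight : τ * length D ≡ m R + deg R x → Σ[ P ∈ Constituents R ]
                ((∀ r → r ∈ˢ R → Adj x r → ctr P r ≡ r) × card (centres P) ≡ length D ×
                 m (centres P) + deg (centres P) x ≡ length D)

  τ≡3 : k ≡ 2 → τ ≡ 3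
  τ≡3 p = trans 2+κ≡t (cong t p)

  τ≡5 : k ≡ 3 → τ ≡ 5
  τ≡5 p = trans 2+κ≡t (cong t p)

  pentagon-m : ∀ {S} → IsoOn C5 S → m S ≡ 5
  pentagon-m {S} io = *-cancelˡ-≡ (m S) 5 2 (trans (IsoOn.2*m-emb io) C5-total)

  square-m : ∀ {S} → IsoOn C4 S → m S ≡ 4
  square-m {S} io = *-cancelˡ-≡ (m S) 4 2 (trans (IsoOn.2*m-emb io) C4-total)

  square-deg : ∀ {S} → IsoOn C4 S → ∀ {y} → y ∈ˢ S → deg S y ≡ 2
  square-deg io {y} yS with IsoOn.emb-onto io y yS
  ... | a , refl = trans (IsoOn.deg-emb io a) (C4-degree a)

  square-isol : ∀ {S D h} → k ≡ 3 → Conn S → IsoOn C4 S → h ∈ˢ S → Hit D h → Isol D S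
  square-isol k≡3 cS io = regular-isol cS (λ y yS → ≤-reflexive (trans (square-deg io yS) (sym (suc-injective k≡3))))

  pentagon-isol : ∀ {S x h} → k ≡ 2 → IsoOn C5 S → h ∈ˢ S → Adj x h → ∃[ d ] Isol (x ∷ d ∷ []) S
  pentagon-isol {S} {x} {h} k≡2 io hS xh with IsoOn.emb-onto io h hS
  ... | a , refl with C5-far-vertex a
  ...   | d , far = f d , isol go
    where
    open IsoOn io renaming (emb to f)
    dom : ∀ {c} → c ≡ d ⊎ adj C5 d c ≡ true → f c ≡ f d ⊎ Adj (f d) (f c)
    dom (inj₁ refl) = inj₁ refl
    dom (inj₂ p) = inj₂ (trans (emb-adj _ _) p)
    go : ∀ X → X ⊆ˢ S → (∀ y → y ∈ˢ X → ¬ Hit (x ∷ f d ∷ []) y) → Core X → ∀ y → y ∉ˢ X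
    go X X⊆ ¬hit core y yX with deg-find X y (≤-trans (≤-reflexive (sym (suc-injective k≡2))) (core y yX))
    ... | z , zX , yz with emb-onto y (X⊆ y yX) | emb-onto z (X⊆ z zX)
    ...   | b , refl | c , refl with far b c (trans (sym (emb-adj b c)) yz)
    ...     | inj₁ refl = ¬hit y yX (here (inj₂ xh))
    ...     | inj₂ (inj₁ refl) = ¬hit z zX (here (inj₂ xh))
    ...     | inj₂ (inj₂ (inj₁ p)) = ¬hit y yX (there (here (dom p)))
    ...     | inj₂ (inj₂ (inj₂ p)) = ¬hit z zX (there (here (dom p)))

  slack-part : ∀ {x R} D → Isol (x ∷ D) R → τ * length D < m R + deg R x → Part x R
  slack-part D iso lt = record { D = D ; isolate = iso ; bound = <⇒≤ lt ; if-tight = λ eq → contradiction eq (<⇒≢ lt) }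

  -- The hit at `h` by itself destroys a k-clique or a square, and leaves one vertex to choose in a
  -- pentagon instead of two. A special set met once outside its centres either saves a vertex or
  -- can be recentred at `h`. So only a single edge to a centre can be tight.
  component-part : ∀ {x H h} → Conn H → h ∈ˢ H → Adj x h → Result H → Part x H
  component-part {x} {H} {h} cH hH xh = part
    where
    1≤d : 1 ≤ deg H x
    1≤d = deg-at H hH xh
    part : Result H → Part x H
    part (clique cl) = slack-part [] (clique-isol cl hH (here (inj₂ xh)))
      (subst (_< m H + deg H x) (sym (*-zeroʳ τ)) (≤-trans 1≤d (m≤n+m _ _)))
    part (strict D iso le) = slack-part D (isol-mono there (λ _ → id) iso)
      (≤-trans (s≤s le) (≤-trans (≤-reflexive (+-comm 1 (m H))) (+-monoʳ-≤ (m H) 1≤d)))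
    part (tight D iso eq ext) with m≤n⇒m<n∨m≡n 1≤d
    ... | inj₁ 2≤d = slack-part D (isol-mono there (λ _ → id) iso)
      (≤-trans (≤-reflexive (trans (cong suc eq) (+-comm 2 (m H)))) (+-monoʳ-≤ (m H) 2≤d))
    ... | inj₂ d≡1 = byShape ext
      where
      total : m H + deg H x ≡ suc (m H)
      total = trans (cong (m H +_) (sym d≡1)) (+-comm (m H) 1)
      only-h : ∀ r → r ∈ˢ H → Adj x r → r ≡ h
      only-h r rH xr with r Fin.≟ h
      ... | yes q = q
      ... | no ne = contradiction (deg-two H hH rH ne xh xr) (<⇒≱ (≤-reflexive (cong suc (sym d≡1))))
      at-centre : ∀ (P : Constituents H) → ctr P h ≡ h → card (centres P) ≡ length D → suc (m (centres P)) ≡ length D → Part x H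
      at-centre P ch cd md = record
        { D = D ; isolate = isol-mono there (λ _ → id) iso
        ; bound = ≤-reflexive (trans eq (sym total))
        ; if-tight = λ _ → P , (λ r rH xr → subst (λ z → ctr P z ≡ z) (sym (only-h r rH xr)) ch) , cd
                , trans (cong (m (centres P) +_) centre-deg) (trans (+-comm _ 1) md) }
        where
        centre-deg : deg (centres P) x ≡ 1
        centre-deg = ≤-antisym (≤-trans (sumOn-⊆ (centres P) H (λ _ → proj₁)) (≤-reflexive (sym d≡1)))
                               (deg-at (centres P) (hH , ch) xh)
      byShape : Extremal H (length D) → Part x H
      byShape (pentagon k≡2 io) with pentagon-isol k≡2 io hH xh
      ... | d , iso′ = slack-part (d ∷ []) iso′ (subst₂ _<_ (sym (cong (_* 1) (τ≡3 k≡2))) (sym (trans total (cong suc (pentagon-m io)))) (s≤s (s≤s (s≤s (s≤s z≤n)))))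
      byShape (square k≡3 io) = slack-part [] (square-isol k≡3 cH io hH (here (inj₂ xh)))
        (subst (_< m H + deg H x) (sym (*-zeroʳ τ)) (≤-trans 1≤d (m≤n+m _ _)))
      byShape (special P cd md) with ctr P h Fin.≟ h
      ... | yes ch = at-centre P ch cd md
      ... | no ¬ch with off-centre P cH hH ¬ch xh
      ...   | inj₁ (D′ , |D′| , iso′) = slack-part D′ iso′ (begin-strict
              τ * length D′          <⟨ m<n+m (τ * length D′) {τ} (s≤s z≤n) ⟩
              τ + τ * length D′      ≡⟨ sym (*-suc τ (length D′)) ⟩
              τ * suc (length D′)    ≡⟨ cong (τ *_) (trans |D′| cd) ⟩
              τ * length D           ≡⟨ trans eq (sym total) ⟩
              m H + deg H x          ∎)
              where open ≤-Reasoning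
      ...   | inj₂ (c≡1 , P′ , cw , c′≡1 , m′≡0) =
              at-centre P′ cw (trans c′≡1 |D|≡1) (trans (cong suc m′≡0) |D|≡1)
              where
              |D|≡1 : 1 ≡ length D
              |D|≡1 = trans (sym c≡1) cd

  empty-part : ∀ {x R} → (∀ y → y ∉ˢ R) → Part x R
  empty-part {x} {R} none = record
    { D = [] ; isolate = isol-empty none
    ; bound = ≤-trans (≤-reflexive (*-zeroʳ τ)) z≤n
    ; if-tight = λ _ → P , (λ r rR → ⊥-elim (none r rR))
            , sumOn-∅ (centres P) _ (λ y q → ⊥-elim (none y (proj₁ q)))
            , cong₂ _+_ (sumOn-∅ (centres P) _ (λ y q → ⊥-elim (none y (proj₁ q))))
                        (sumOn-∅ (centres P) _ (λ y q → ⊥-elim (none y (proj₁ q)))) }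
    where
    P : Constituents R
    P = record
      { ctr = id ; hook = id ; ctr-∈ = λ _ → id ; ctr-idem = λ _ _ → refl
      ; petal-adj = λ x _ xR → ⊥-elim (none x xR) ; separate = λ x _ xR → ⊥-elim (none x xR)
      ; petal-size = λ x xR → ⊥-elim (none x xR) ; hook-∈ = λ x xR → ⊥-elim (none x xR)
      ; hook-adj = λ x xR → ⊥-elim (none x xR) ; hook-unique = λ x _ xR → ⊥-elim (none x xR) }

  m-apart : ∀ {R A B} → Split R A B → (∀ a b → a ∈ˢ A → b ∈ˢ B → ¬ Adj a b) → m R ≡ m A + m B
  m-apart {R} {A} {B} sp apart =
    trans (m-split sp) (cong (_+ m B) (trans (cong (m A +_) (e-none A B apart)) (+-identityʳ (m A))))

  -- No centre of one side is adjacent to a centre of the other, so edges among centres and edges to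
  -- `x` both add up.
  part-union : ∀ {x R A B} → Split R A B → (∀ a b → a ∈ˢ A → b ∈ˢ B → ¬ Adj a b) → Part x A → Part x B → Part x R
  part-union {x} {R} {A} {B} sp apart pa pb = record
    { D = PA.D ++ PB.D
    ; isolate = isol-split sp apart hitA hitB PA.isolate PB.isolate
    ; bound = ≤-trans (≤-reflexive len) (≤-trans (+-mono-≤ PA.bound PB.bound) (≤-reflexive (sym total)))
    ; if-tight = λ eq → both (+-≡-split PA.bound PB.bound (trans (sym len) (trans eq total))) }
    where
    module PA = Part pa
    module PB = Part pb
    hitA : ∀ {y} → Hit (x ∷ PA.D) y → Hit (x ∷ PA.D ++ PB.D) y
    hitA (here p) = here p
    hitA (there p) = there (++⁺ˡ p)
    hitB : ∀ {y} → Hit (x ∷ PB.D) y → Hit (x ∷ PA.D ++ PB.D) y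
    hitB (here p) = here p
    hitB (there p) = there (++⁺ʳ PA.D p)
    len : τ * length (PA.D ++ PB.D) ≡ τ * length PA.D + τ * length PB.D
    len = trans (cong (τ *_) (length-++ PA.D)) (*-distribˡ-+ τ (length PA.D) _)
    total : m R + deg R x ≡ (m A + deg A x) + (m B + deg B x)
    total = trans (cong₂ _+_ (m-apart sp apart) (deg-split sp x)) (+-interchange (m A) (m B) _ _)
    both : τ * length PA.D ≡ m A + deg A x × τ * length PB.D ≡ m B + deg B x → _
    both (ea , eb) with PA.if-tight ea | PB.if-tight eb
    ... | P , adjP , cP , mP | Q , adjQ , cQ , mQ = PQ , adjPQ
        , trans (sumOn-split sp′ _) (trans (cong₂ _+_ cP cQ) (sym (length-++ PA.D)))
        , trans (cong₂ _+_ (m-apart sp′ (λ a b p q → apart a b (proj₁ p) (proj₁ q))) (deg-split sp′ x))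
                (trans (+-interchange (m (centres P)) (m (centres Q)) _ _)
                       (trans (cong₂ _+_ mP mQ) (sym (length-++ PA.D))))
      where
      cross : ∀ a b → a ∈ˢ A → b ∈ˢ B → Adj a b → ctr P a ≡ a × ctr Q b ≡ b
      cross a b aA bB ab = contradiction ab (apart a b aA bB)
      PQ = proj₁ (merge sp P Q cross)
      sp′ : Split (centres PQ) (centres P) (centres Q)
      sp′ = merge-centres sp P Q cross
      adjPQ : ∀ r → r ∈ˢ R → Adj x r → ctr PQ r ≡ r
      adjPQ r rR xr with Split.cover sp r rR
      ... | inj₁ rA = trans (proj₁ (proj₂ (merge sp P Q cross)) r rA) (adjP r rA xr)
      ... | inj₂ rB = trans (proj₂ (proj₂ (merge sp P Q cross)) r rB) (adjQ r rB xr)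

  module _ {S : DSet n} (cS : Conn S) (IH : ∀ H → card H < card S → Conn H → Result H)
           {x : Fin n} (xS : x ∈ˢ S) where

    private
      edge-to : ∀ {R H} → R ⊆ˢ S → x ∉ˢ R → (∀ h a → h ∈ˢ R → a ∈ˢ S → Adj h a → a ∈ˢ R ⊎ a ≡ x) →
                Comp H R → ∃[ h ] (h ∈ˢ H × Adj x h)
      edge-to {R} {H} R⊆ x∉ touch cH with comp-edge cS (split-swap (split-remove S R R⊆)) (xS , x∉) cH
        where
        split-swap : ∀ {S A B} → Split {n} S A B → Split S B A
        split-swap sp = record { left = right ; right = left ; cover = λ y p → swap (cover y p) ; disjoint = λ y b a → disjoint y a b }
          where open Split sp
      ... | a , h , (aS , a∉) , hH , ah with touch h a (sub cH h hH) aS (Adj-sym ah)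
      ...   | inj₁ aR = contradiction aR a∉
      ...   | inj₂ refl = h , hH , ah

    hub-part : ∀ R → R ⊆ˢ S → x ∉ˢ R → (∀ h a → h ∈ˢ R → a ∈ˢ S → Adj h a → a ∈ˢ R ⊎ a ≡ x) → Part x R
    hub-part R₀ R⊆ x∉ touch = compInd R₀ (Part x) (λ R → empty-part) extend
      where
      extend : ∀ R H R′ → Split R H R′ → R ⊆ˢ R₀ → Comp H R₀ → (∀ a b → a ∈ˢ H → b ∈ˢ R′ → ¬ Adj a b) → Part x R′ → Part x R
      extend R H R′ sp _ cH apart rest with edge-to R⊆ x∉ touch cH
      ... | h , hH , xh = part-union sp apart
              (component-part (conn cH) hH xh
                (IH H (card-⊂ H S (λ y → R⊆ y ∘ sub cH y) xS (x∉ ∘ sub cH x)) (conn cH))) rest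

    module AtHub {C : DSet n} (cC : Conn C) (C⊆ : C ⊆ˢ S) (x∉C : x ∉ˢ C)
             (touchC : ∀ h a → h ∈ˢ C → a ∈ˢ S → Adj h a → a ∈ˢ C ⊎ a ≡ x)
             (rest : Part x (S ─ x ∖ C)) where

      private
        R = S ─ x ∖ C

        R⊆ : R ⊆ˢ S
        R⊆ y = proj₁ ∘ proj₁

        x∉R : x ∉ˢ R
        x∉R p = proj₂ (proj₁ p) refl

        open Part rest

        sp : Split (S ─ x) C R
        sp = split-remove (S ─ x) C (λ y p → C⊆ y p , λ { refl → x∉C p })

        apart : ∀ a b → a ∈ˢ C → b ∈ˢ R → ¬ Adj a b
        apart a b aC bR ab with touchC a b aC (R⊆ b bR) ab
        ... | inj₁ bC = proj₂ bR bC
        ... | inj₂ refl = x∉R bR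

        edge : ∃[ h ] (h ∈ˢ C × Adj x h)
        edge = edge-to {C} {C} C⊆ x∉C touchC (record { conn = cC ; sub = λ _ → id ; closed = λ _ _ _ b _ → b })

        1≤d : 1 ≤ deg C x
        1≤d = deg-at C (proj₁ (proj₂ edge)) (proj₂ (proj₂ edge))

        isolates : (∀ {E h} → h ∈ˢ C → Hit E h → Isol E C) → Isol (x ∷ D) S
        isolates isoC = isol λ X X⊆ ¬hit → no-core onB X (λ y p → X⊆ y p , λ { refl → ¬hit y p (here (inj₁ refl)) }) ¬hit
          where
          onB : Isol (x ∷ D) (S ─ x)
          onB = isol-split sp apart id id (isoC (proj₁ (proj₂ edge)) (here (inj₂ (proj₂ (proj₂ edge))))) isolate

        count : m S ≡ m C + (deg C x + (m R + deg R x))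
        count = begin
          m S                                        ≡⟨ m-add (split-point S xS) ⟩
          deg (S ─ x) x + m (S ─ x)                  ≡⟨ cong₂ _+_ (deg-split sp x) (m-apart sp apart) ⟩
          (deg C x + deg R x) + (m C + m R)          ≡⟨ solve 4 (λ a b c d → (a :+ b) :+ (c :+ d) := c :+ (a :+ (d :+ b))) refl (deg C x) (deg R x) (m C) (m R) ⟩
          m C + (deg C x + (m R + deg R x))          ∎
          where
          open ≡-Reasoning
          open +-*-Solver

      -- The four edges of the square and one edge to `x` amount to `τ` = 5, which pays for `x`
      -- without using the + 1 of the bound.
      with-square : k ≡ 3 → IsoOn C4 C → Result S
      with-square k≡3 io = strict (x ∷ D) (isolates (square-isol k≡3 cC io)) (begin
        τ * suc (length D)                    ≡⟨ *-suc τ (length D) ⟩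
        τ + τ * length D                      ≡⟨ cong (_+ τ * length D) (τ≡5 k≡3) ⟩
        4 + (1 + τ * length D)                ≤⟨ +-monoʳ-≤ 4 (+-mono-≤ 1≤d bound) ⟩
        4 + (deg C x + (m R + deg R x))       ≡⟨ cong (_+ (deg C x + (m R + deg R x))) (sym (square-m io)) ⟩
        m C + (deg C x + (m R + deg R x))     ≡⟨ sym count ⟩
        m S                                   ∎)
        where open ≤-Reasoning

      -- The clique and one edge to `x` supply κ + 1, one short of `τ`. Any surplus elsewhere makes
      -- the bound strict. Without surplus `x` is the centre of a new constituent with petal `C`,
      -- and it is joined to the other constituents at their centres.
      with-clique : Clique C → Result S
      with-clique cl with m≤n⇒m<n∨m≡n (+-mono-≤ 1≤d bound)
      ... | inj₁ lt = strict (x ∷ D) (isolates (clique-isol cl)) (begin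
        τ * suc (length D)                    ≡⟨ *-suc τ (length D) ⟩
        τ + τ * length D                      ≡⟨ solve 2 (λ c d → con 2 :+ c :+ d := c :+ (con 1 :+ (con 1 :+ d))) refl κ (τ * length D) ⟩
        κ + suc (1 + τ * length D)        ≤⟨ +-monoʳ-≤ κ lt ⟩
        κ + (deg C x + (m R + deg R x))   ≡⟨ cong (_+ (deg C x + (m R + deg R x))) (sym (clique-m cl)) ⟩
        m C + (deg C x + (m R + deg R x))     ≡⟨ sym count ⟩
        m S                                   ∎)
        where
        open ≤-Reasoning
        open +-*-Solver
      ... | inj₂ eq with +-≡-split 1≤d bound eq
      ...   | d≡1 , tightR with if-tight tightR
      ...     | P , adjP , cP , mP = tight (x ∷ D) (isolates (clique-isol cl)) tot
                (special PQ (trans (sumOn-split spc _) (cong₂ _+_ c₁ cP))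
                  (cong suc (trans (m-split spc) (trans (cong₂ (λ u v → u + v + m (centres P)) m₁ e₁) (trans (+-comm _ (m (centres P))) mP)))))
        where
        h  = proj₁ edge
        hC = proj₁ (proj₂ edge)
        xh = proj₂ (proj₂ edge)
        F : DSet n
        F = sing x ∪ˢ C
        tot : τ * suc (length D) ≡ suc (m S)
        tot = begin
          τ * suc (length D)                        ≡⟨ *-suc τ (length D) ⟩
          τ + τ * length D                          ≡⟨ solve 2 (λ c d → con 2 :+ c :+ d := con 1 :+ (c :+ (con 1 :+ d))) refl κ (τ * length D) ⟩
          suc (κ + (1 + τ * length D))          ≡⟨ cong₂ (λ u v → suc (u + v)) (sym (clique-m cl)) eq ⟩
          suc (m C + (deg C x + (m R + deg R x)))   ≡⟨ cong suc (sym count) ⟩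
          suc (m S)                                 ∎
          where
          open ≡-Reasoning
          open +-*-Solver
        F─x : Clique (F ─ x)
        F─x = record
          { size = trans (sumOn-≐ (F ─ x) C (λ { y (inj₁ q , ne) → contradiction q ne ; y (inj₂ q , _) → q })
                                            (λ y q → inj₂ q , λ { refl → x∉C q })) (Clique.size cl)
          ; pairwise = λ { a b (inj₁ q , ne) → contradiction q ne
                         ; a b (inj₂ q , _) (inj₁ r , ne) → contradiction r ne
                         ; a b (inj₂ q , _) (inj₂ r , _) → Clique.pairwise cl a b q r } }
        uq : ∀ y → y ∈ˢ F → Adj x y → y ≡ h
        uq y (inj₁ refl) xy = contradiction refl (Adj-irrefl xy)
        uq y (inj₂ yC) xy with y Fin.≟ h
        ... | yes q = q
        ... | no ne = contradiction (deg-two C hC yC ne xh xy) (<⇒≱ (≤-reflexive (cong suc (sym d≡1))))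
        Q : Constituents F
        Q = single (inj₁ refl) (inj₂ hC) F─x xh uq
        scF = single-centres {F} {x} (inj₁ refl) (inj₂ hC) F─x xh uq
        spF : Split S F R
        spF = record
          { left = λ { y (inj₁ refl) → xS ; y (inj₂ q) → C⊆ y q } ; right = R⊆ ; cover = cov
          ; disjoint = λ { y (inj₁ refl) → x∉R ; y (inj₂ q) r → proj₂ r q } }
          where
          cov : ∀ y → y ∈ˢ S → y ∈ˢ F ⊎ y ∈ˢ R
          cov y yS with y Fin.≟ x | mem? C y
          ... | yes q | _ = inj₁ (inj₁ q)
          ... | no _  | yes q = inj₁ (inj₂ q)
          ... | no ne | no ¬q = inj₂ ((yS , ne) , ¬q)
        cross : ∀ a b → a ∈ˢ F → b ∈ˢ R → Adj a b → ctr Q a ≡ a × ctr P b ≡ b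
        cross a b (inj₁ refl) bR ab = refl , adjP b bR ab
        cross a b (inj₂ aC) bR ab = contradiction ab (apart a b aC bR)
        PQ : Constituents S
        PQ = proj₁ (merge spF Q P cross)
        spc : Split (centres PQ) (centres Q) (centres P)
        spc = merge-centres spF Q P cross
        c₁ : card (centres Q) ≡ 1
        c₁ = trans (sumOn-≐ (centres Q) (sing x) (proj₁ scF) (proj₂ scF)) (card-sing x)
        m₁ : m (centres Q) ≡ 0
        m₁ = trans (m-≐ (centres Q) (sing x) (proj₁ scF) (proj₂ scF)) (m-sing x)
        e₁ : e (centres Q) (centres P) ≡ deg (centres P) x
        e₁ = trans (sumOn-≐ (centres Q) (sing x) (proj₁ scF) (proj₂ scF)) (e-sing x (centres P))

    private
      hub-rest : ∀ {C} → (∀ h a → h ∈ˢ C → a ∈ˢ S → Adj h a → a ∈ˢ C ⊎ a ≡ x) → Part x (S ─ x ∖ C)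
      hub-rest {C} touchC = hub-part R (λ y → proj₁ ∘ proj₁) x∉R touchR
        where
        R = S ─ x ∖ C
        x∉R : x ∉ˢ R
        x∉R p = proj₂ (proj₁ p) refl
        touchR : ∀ h a → h ∈ˢ R → a ∈ˢ S → Adj h a → a ∈ˢ R ⊎ a ≡ x
        touchR h a hR aS ha with a Fin.≟ x | mem? C a
        ... | yes q | _ = inj₂ q
        ... | no ne | no ¬p = inj₁ ((aS , ne) , ¬p)
        ... | no ne | yes p with touchC a h p (proj₁ (proj₁ hR)) (Adj-sym ha)
        ...   | inj₁ hC = contradiction hC (proj₂ hR)
        ...   | inj₂ refl = contradiction hR x∉R

    hub-clique : ∀ {C} → Clique C → C ⊆ˢ S → x ∉ˢ C →
      (∀ h a → h ∈ˢ C → a ∈ˢ S → Adj h a → a ∈ˢ C ⊎ a ≡ x) → Result S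
    hub-clique {C} cl C⊆ x∉C touchC = AtHub.with-clique (clique-conn cl) C⊆ x∉C touchC (hub-rest {C} touchC) cl

    hub-square : ∀ {C} → k ≡ 3 → Conn C → IsoOn C4 C → C ⊆ˢ S → x ∉ˢ C →
      (∀ h a → h ∈ˢ C → a ∈ˢ S → Adj h a → a ∈ˢ C ⊎ a ≡ x) → Result S
    hub-square {C} k≡3 cC io C⊆ x∉C touchC = AtHub.with-square cC C⊆ x∉C touchC (hub-rest {C} touchC) k≡3 io

-- Deleting the closed neighbourhood of a vertex of a k-clique

next₄ : Fin 4 → Fin 4
next₄ zero = suc zero
next₄ (suc zero) = suc (suc zero)
next₄ (suc (suc zero)) = suc (suc (suc zero))
next₄ (suc (suc (suc zero))) = zero

next₅ : Fin 5 → Fin 5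
next₅ zero = suc zero
next₅ (suc zero) = suc (suc zero)
next₅ (suc (suc zero)) = suc (suc (suc zero))
next₅ (suc (suc (suc zero))) = suc (suc (suc (suc zero)))
next₅ (suc (suc (suc (suc zero)))) = zero

opaque
  C4-next : ∀ a b → adj C4 a b ≡ true → b ≡ next₄ a ⊎ a ≡ next₄ b
  C4-next = from-yes (all? λ a → all? λ b → (adj C4 a b Bool.≟ true) →-dec ((b Fin.≟ next₄ a) ⊎-dec (a Fin.≟ next₄ b)))

  C5-next : ∀ a b → adj C5 a b ≡ true → b ≡ next₅ a ⊎ a ≡ next₅ b
  C5-next = from-yes (all? λ a → all? λ b → (adj C5 a b Bool.≟ true) →-dec ((b Fin.≟ next₅ a) ⊎-dec (a Fin.≟ next₅ b)))

injective-from-< : ∀ {h n} (p : Fin h → Fin n) → (∀ a b → a Fin.< b → p a ≢ p b) → Injective _≡_ _≡_ p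
injective-from-< p lt {a} {b} eq with <-cmp (toℕ a) (toℕ b)
... | tri< l _ _ = contradiction eq (lt a b l)
... | tri≈ _ q _ = toℕ-injective q
... | tri> _ _ g = contradiction (sym eq) (lt b a g)

module CliqueCase {n : ℕ} (G : Graph n) (k′ : ℕ) where

  open InGraph G
  open Isolation G k′
  open OffCentre G k′
  open Hub G k′

  -- Since every neighbour in `S` of an image vertex comes from an edge of `H`, the copy is induced,
  -- and by connectedness it fills `S`.
  iso-on-closed : ∀ {h S} (H : Graph h) (p : Fin h → Fin n) → Conn S → Fin h → Injective _≡_ _≡_ p → (∀ a → p a ∈ˢ S) →
    (∀ a b → adj H a b ≡ true → Adj (p a) (p b)) →
    (∀ a y → y ∈ˢ S → Adj (p a) y → ∃[ b ] (adj H a b ≡ true × y ≡ p b)) → IsoOn H S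
  iso-on-closed {h} {S} H p cS a₀ inj p∈ edge nbr = record
    { emb = p ; emb-inj = inj ; emb-∈ = p∈
    ; emb-onto = spread cS (λ y → ∃[ a ] (y ≡ p a)) (p∈ a₀) (a₀ , refl) (λ { _ b _ bS (a , refl) ab → let c , _ , eq = nbr a b bS ab in c , eq })
    ; emb-adj = same }
    where
    same : ∀ a b → adj G (p a) (p b) ≡ adj H a b
    same a b with adj H a b in eq
    ... | true = edge a b eq
    ... | false with adj G (p a) (p b) in eq′
    ...   | false = refl
    ...   | true with nbr a (p b) (p∈ b) eq′
    ...     | c , ac , q with inj q
    ...       | refl = trans (sym ac) eq

  clique-≐ : ∀ {A B} → A ⊆ˢ B → B ⊆ˢ A → Clique A → Clique B
  clique-≐ {A} {B} h g cl = record
    { size = trans (sumOn-≐ B A g h) (Clique.size cl)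
    ; pairwise = λ x y xB yB → Clique.pairwise cl x y (g x xB) (g y yB) }

  nbhd far : DSet n → Fin n → DSet n
  nbhd S v = ⟨ (λ y → y ∈ˢ S × (y ≡ v ⊎ Adj v y)) , (λ y → mem? S y ×-dec ((y Fin.≟ v) ⊎-dec adj? v y)) ⟩
  far S v  = S ∖ nbhd S v

  nbhd-split : ∀ S v → Split S (nbhd S v) (far S v)
  nbhd-split S v = split-remove S (nbhd S v) (λ _ → proj₁)

  isol-nbhd : ∀ {S v D} → Isol D (far S v) → Isol (v ∷ D) S
  isol-nbhd iso = isol λ X X⊆ ¬hit → no-core iso X (λ y p → X⊆ y p , λ q → ¬hit y p (here (proj₂ q))) (λ y p → ¬hit y p ∘ there)

  -- If a single edge joins `H` to N[v], its end `a` is the only outside vertex with a neighbour in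
  -- `H`, which qualifies `a` as a hub.
  comp-touch : ∀ {S v H a h} → Comp H (far S v) → e (nbhd S v) H ≡ 1 → a ∈ˢ nbhd S v → h ∈ˢ H → Adj a h →
    ∀ h′ b → h′ ∈ˢ H → b ∈ˢ S → Adj h′ b → b ∈ˢ H ⊎ b ≡ a
  comp-touch {S} {v} {H} cH e≡1 aA hH ah h′ b h′H bS h′b with Split.cover (nbhd-split S v) b bS
  ... | inj₁ bA = inj₂ (proj₁ (unique-edge (nbhd S v) H e≡1 aA hH ah bA h′H (Adj-sym h′b)))
  ... | inj₂ bR = inj₁ (closed cH h′ b h′H bR h′b)

  nbhd-card : ∀ S {v} → v ∈ˢ S → card (nbhd S v) ≡ suc (deg S v)
  nbhd-card S {v} vS = trans (card-remove A (vS , inj₁ refl)) (cong suc (sym (trans same (deg-complete (A ─ v) v nb))))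
    where
    A = nbhd S v
    nb : ∀ y → y ∈ˢ A ─ v → Adj v y
    nb y ((_ , inj₁ q) , ne) = contradiction q ne
    nb y ((_ , inj₂ p) , _) = p
    same : deg S v ≡ deg (A ─ v) v
    same = ≤-antisym (deg-≤ S (A ─ v) v (λ y yS vy → (yS , inj₂ vy) , Adj-irrefl (Adj-sym vy)))
                     (deg-≤ (A ─ v) S v (λ y q _ → proj₁ (proj₁ q)))

  module _ {S : DSet n} (cS : Conn S) (IH : ∀ H → card H < card S → Conn H → Result H) where

    -- What a component in the equality case reveals without mention of the set chosen in it. The
    -- divisibility allows two different centres to be compared; the few edges to N[v] limit how the
    -- component is attached.
    Good : Fin n → DSet n → Set
    Good v H = τ ∣ m H + e (nbhd S v) H × (e (nbhd S v) H ≡ 1 ⊎ (e (nbhd S v) H ≡ 2 × Clique H))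

    good-≐ : ∀ {v H H′} → H ⊆ˢ H′ → H′ ⊆ˢ H → Good v H → Good v H′
    good-≐ {v} {H} {H′} h g (dv , shape)
      rewrite m-≐ H H′ h g | e-≐ʳ (nbhd S v) H H′ h g = dv , map₂ (λ { (q , cl) → q , clique-≐ h g cl }) shape

    -- In contrast to `Part`, the set `D` isolates without help: a component of S - N[v] may touch
    -- neighbours of `v`, but these are not chosen.
    record FarPart (v : Fin n) (R : DSet n) : Set₁ where
      field
        D        : List (Fin n)
        isolate  : Isol D R
        bound    : τ * length D ≤ m R + e (nbhd S v) R
        if-tight : τ * length D ≡ m R + e (nbhd S v) R → ∀ H → Comp H (far S v) → H ⊆ˢ R → Good v H

    far-union : ∀ {v R A B} → Split R A B → (∀ a b → a ∈ˢ A → b ∈ˢ B → ¬ Adj a b) → Comp A (far S v) → FarPart v A → FarPart v B → FarPart v R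
    far-union {v} {R} {A} {B} sp apart cA pa pb = record
      { D = PA.D ++ PB.D
      ; isolate = isol-split sp apart ++⁺ˡ (++⁺ʳ PA.D) PA.isolate PB.isolate
      ; bound = ≤-trans (≤-reflexive len) (≤-trans (+-mono-≤ PA.bound PB.bound) (≤-reflexive (sym total)))
      ; if-tight = λ eq → both (+-≡-split PA.bound PB.bound (trans (sym len) (trans eq total))) }
      where
      module PA = FarPart pa
      module PB = FarPart pb
      N = nbhd S v
      len : τ * length (PA.D ++ PB.D) ≡ τ * length PA.D + τ * length PB.D
      len = trans (cong (τ *_) (length-++ PA.D)) (*-distribˡ-+ τ (length PA.D) _)
      total : m R + e N R ≡ (m A + e N A) + (m B + e N B)
      total = trans (cong₂ _+_ (m-apart sp apart) (e-splitʳ sp N)) (+-interchange (m A) (m B) _ _)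
      both : τ * length PA.D ≡ m A + e N A × τ * length PB.D ≡ m B + e N B → ∀ H → Comp H (far S v) → H ⊆ˢ R → Good v H
      both (ea , eb) H cH H⊆ with find H (mem? A)
      ... | inj₁ (h , hH , hA) = good-≐ (comp-⊆ cA cH hA hH) (comp-⊆ cH cA hH hA) (PA.if-tight ea A cA (λ _ → id))
      ... | inj₂ none = PB.if-tight eb H cH (λ y yH → [ (λ yA → contradiction yA (none y yH)) , id ]′ (Split.cover sp y (H⊆ y yH)))

    far-slack : ∀ {v R} D → Isol D R → τ * length D < m R + e (nbhd S v) R → FarPart v R
    far-slack D iso lt = record { D = D ; isolate = iso ; bound = <⇒≤ lt ; if-tight = λ eq → contradiction eq (<⇒≢ lt) }

    far-tight : ∀ {v R} D → Isol D R → τ * length D ≡ m R + e (nbhd S v) R →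
      e (nbhd S v) R ≡ 1 ⊎ (e (nbhd S v) R ≡ 2 × Clique R) → Comp R (far S v) → FarPart v R
    far-tight {v} {R} D iso eq shape cR = record
      { D = D ; isolate = iso ; bound = ≤-reflexive eq
      ; if-tight = λ _ H cH H⊆ → let h , hH = inhabited (conn cH) in
          good-≐ (comp-⊆ cR cH (H⊆ h hH) hH) H⊆ (divides (length D) (trans (sym eq) (*-comm τ (length D))) , shape) }

    -- One edge to N[v] makes up for the + 1 of a tight component. A k-clique needs two, as `τ` is κ
    -- + 2. If it has just one edge, the end of that edge is a hub, and the hub argument settles all
    -- of `S` at once.
    far-component : ∀ {v H} → v ∈ˢ S → Comp H (far S v) → Result S ⊎ FarPart v H
    far-component {v} {H} vS cH with comp-edge cS (nbhd-split S v) (vS , inj₁ refl) cH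
    ... | a , h , aA , hH , ah = go (IH H (card-⊂ H S H⊆ vS (λ p → proj₂ (sub cH v p) (vS , inj₁ refl))) (conn cH))
      where
      N = nbhd S v
      H⊆ : H ⊆ˢ S
      H⊆ y p = proj₁ (sub cH y p)
      1≤e : 1 ≤ e N H
      1≤e = e-at N H aA hH ah
      go : Result H → Result S ⊎ FarPart v H
      go (strict D iso le) = inj₂ (far-slack D iso (≤-trans (s≤s le) (≤-trans (≤-reflexive (+-comm 1 (m H))) (+-monoʳ-≤ (m H) 1≤e))))
      go (tight D iso eq _) with m≤n⇒m<n∨m≡n 1≤e
      ... | inj₁ 2≤e = inj₂ (far-slack D iso (≤-trans (≤-reflexive (trans (cong suc eq) (+-comm 2 (m H)))) (+-monoʳ-≤ (m H) 2≤e)))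
      ... | inj₂ 1≡e = inj₂ (far-tight D iso (trans eq (trans (+-comm 1 (m H)) (cong (m H +_) 1≡e))) (inj₁ (sym 1≡e)) cH)
      go (clique cl) with m≤n⇒m<n∨m≡n 1≤e
      ... | inj₂ 1≡e = inj₁ (hub-clique cS IH (proj₁ aA) cl H⊆ (λ p → proj₂ (sub cH a p) aA) (comp-touch {S} {v} cH (sym 1≡e) aA hH ah))
      ... | inj₁ 2≤e with m≤n⇒m<n∨m≡n 2≤e
      ...   | inj₁ 3≤e = inj₂ (far-slack (h ∷ []) (clique-isol cl hH (here (inj₁ refl))) (begin-strict
                τ * 1          ≡⟨ *-identityʳ τ ⟩
                2 + κ          <⟨ n<1+n _ ⟩
                3 + κ          ≡⟨ +-comm 3 κ ⟩
                κ + 3          ≡⟨ cong (_+ 3) (sym (clique-m cl)) ⟩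
                m H + 3        ≤⟨ +-monoʳ-≤ (m H) 3≤e ⟩
                m H + e N H    ∎))
              where open ≤-Reasoning
      ...   | inj₂ 2≡e = inj₂ (far-tight (h ∷ []) (clique-isol cl hH (here (inj₁ refl)))
                (trans (*-identityʳ τ) (trans (+-comm 2 κ) (cong₂ _+_ (sym (clique-m cl)) 2≡e))) (inj₂ (sym 2≡e , cl)) cH)

    far-part : ∀ v → v ∈ˢ S → Result S ⊎ FarPart v (far S v)
    far-part v vS = compInd (far S v) (λ R → Result S ⊎ FarPart v R)
      (λ R none → inj₂ (record
        { D = [] ; isolate = isol-empty none ; bound = ≤-trans (≤-reflexive (*-zeroʳ τ)) z≤n
        ; if-tight = λ _ H cH H⊆ → let h , hH = inhabited (conn cH) in ⊥-elim (none h (H⊆ h hH)) }))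
      extend
      where
      extend : ∀ R H R′ → Split R H R′ → R ⊆ˢ far S v → Comp H (far S v) → (∀ a b → a ∈ˢ H → b ∈ˢ R′ → ¬ Adj a b) →
        Result S ⊎ FarPart v R′ → Result S ⊎ FarPart v R
      extend R H R′ sp _ cH apart (inj₁ r) = inj₁ r
      extend R H R′ sp _ cH apart (inj₂ rest) with far-component vS cH
      ... | inj₁ r = inj₁ r
      ... | inj₂ p = inj₂ (far-union sp apart cH p rest)

    -- The equality case at `v`: one edge leaves `Q` within N[v], so `v` has a unique exit from `Q`,
    -- and no other vertex of `Q` sees that exit.
    record Balanced (Q : DSet n) (v : Fin n) : Set₁ where
      field
        out       : Fin n
        out-∈     : out ∈ˢ S
        out-∉     : out ∉ˢ Q
        out-adj   : Adj v out
        nbrs      : ∀ y → y ∈ˢ S → Adj v y → y ∈ˢ Q ⊎ y ≡ out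
        only-v    : ∀ y → y ∈ˢ Q → Adj y out → y ≡ v
        D         : List (Fin n)
        isolates  : Isol D S
        tight-D   : τ * length D ≡ suc (m S)
        good      : ∀ H → Comp H (far S v) → Good v H

    -- A degree of at least k provides a neighbour of `v` outside `Q`, hence κ + 1 edges in N[v];
    -- with the + 1 of the bound they pay for `v`. Equality leaves exactly one edge between `Q` and
    -- the rest of N[v].
    balance : ∀ {Q v} → Clique Q → Q ⊆ˢ S → v ∈ˢ Q → k ≤ deg S v → Result S ⊎ Balanced Q v
    balance {Q} {v} cl Q⊆ vQ k≤d with far-part v (Q⊆ v vQ)
    ... | inj₁ r = inj₁ r
    ... | inj₂ p = decide (card-pick N Q (≤-trans (≤-reflexive (cong suc (Clique.size cl))) (≤-trans (s≤s k≤d) (≤-reflexive (sym (nbhd-card S vS))))))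
      where
      open FarPart p
      vS = Q⊆ v vQ
      N = nbhd S v
      R = far S v
      B = N ∖ Q
      Q⊆N : Q ⊆ˢ N
      Q⊆N y yQ with y Fin.≟ v
      ... | yes q = Q⊆ y yQ , inj₁ q
      ... | no ne = Q⊆ y yQ , inj₂ (Clique.pairwise cl v y vQ yQ (ne ∘ sym))
      spN : Split N Q B
      spN = split-remove N Q Q⊆N
      count : m S ≡ κ + ((e Q B + m B) + (m R + e N R))
      count = begin
        m S                                           ≡⟨ m-split (nbhd-split S v) ⟩
        m N + e N R + m R                             ≡⟨ cong (λ z → z + e N R + m R) (m-split spN) ⟩
        m Q + e Q B + m B + e N R + m R               ≡⟨ cong (λ z → z + e Q B + m B + e N R + m R) (clique-m cl) ⟩
        κ + e Q B + m B + e N R + m R                 ≡⟨ solve 5 (λ a b c d f → a :+ b :+ c :+ d :+ f := a :+ ((b :+ c) :+ (f :+ d))) refl κ (e Q B) (m B) (e N R) (m R) ⟩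
        κ + ((e Q B + m B) + (m R + e N R))           ∎
        where
        open ≡-Reasoning
        open +-*-Solver
      decide : ∃[ x ] (x ∈ˢ N × x ∉ˢ Q) → Result S ⊎ Balanced Q v
      decide (x , xN , x∉Q) with m≤n⇒m<n∨m≡n (+-mono-≤ 1≤eb bound)
        where
        vx : Adj v x
        vx = [ (λ { refl → contradiction vQ x∉Q }) , id ]′ (proj₂ xN)
        1≤eb : 1 ≤ e Q B + m B
        1≤eb = ≤-trans (e-at Q B vQ (xN , x∉Q) vx) (m≤m+n _ _)
      ... | inj₁ lt = inj₁ (strict (v ∷ D) (isol-nbhd isolate) (begin
        τ * suc (length D)                            ≡⟨ *-suc τ (length D) ⟩
        τ + τ * length D                              ≡⟨ solve 2 (λ c d → con 2 :+ c :+ d := c :+ (con 1 :+ (con 1 :+ d))) refl κ (τ * length D) ⟩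
        κ + suc (1 + τ * length D)                    ≤⟨ +-monoʳ-≤ κ lt ⟩
        κ + ((e Q B + m B) + (m R + e N R))           ≡⟨ sym count ⟩
        m S                                           ∎))
        where
        open ≤-Reasoning
        open +-*-Solver
      ... | inj₂ eq = inj₂ (record
          { out = x ; out-∈ = proj₁ xN ; out-∉ = x∉Q ; out-adj = vx
          ; nbrs = nb
          ; only-v = λ y yQ yx → proj₁ (unique-edge Q B eb≡1 vQ (xN , x∉Q) vx yQ (xN , x∉Q) yx)
          ; D = v ∷ D ; isolates = isol-nbhd isolate ; tight-D = tot
          ; good = λ H cH → if-tight (proj₂ parts) H cH (sub cH) })
        where
        vx : Adj v x
        vx = [ (λ { refl → contradiction vQ x∉Q }) , id ]′ (proj₂ xN)
        1≤eb : 1 ≤ e Q B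
        1≤eb = e-at Q B vQ (xN , x∉Q) vx
        parts : 1 ≡ e Q B + m B × τ * length D ≡ m R + e N R
        parts = +-≡-split (≤-trans 1≤eb (m≤m+n _ _)) bound eq
        eb≡1 : e Q B ≡ 1
        eb≡1 = ≤-antisym (≤-trans (m≤m+n _ _) (≤-reflexive (sym (proj₁ parts)))) 1≤eb
        nb : ∀ y → y ∈ˢ S → Adj v y → y ∈ˢ Q ⊎ y ≡ x
        nb y yS vy with mem? Q y
        ... | yes yQ = inj₁ yQ
        ... | no y∉ = inj₂ (proj₂ (unique-edge Q B eb≡1 vQ (xN , x∉Q) vx vQ ((yS , inj₂ vy) , y∉) vy))
        tot : τ * suc (length D) ≡ suc (m S)
        tot = begin
          τ * suc (length D)                            ≡⟨ *-suc τ (length D) ⟩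
          τ + τ * length D                              ≡⟨ solve 2 (λ c d → con 2 :+ c :+ d := con 1 :+ (c :+ (con 1 :+ d))) refl κ (τ * length D) ⟩
          suc (κ + (1 + τ * length D))                  ≡⟨ cong (λ z → suc (κ + z)) eq ⟩
          suc (κ + ((e Q B + m B) + (m R + e N R)))     ≡⟨ cong suc (sym count) ⟩
          suc (m S)                                     ∎
          where
          open ≡-Reasoning
          open +-*-Solver

    outside-deg : ∀ {Q y h} → Clique Q → Q ⊆ˢ S → y ∈ˢ Q → h ∈ˢ S → h ∉ˢ Q → Adj y h → k ≤ deg S y
    outside-deg {Q} {y} {h} cl Q⊆ yQ hS h∉ yh = begin
      suc k′                         ≡⟨ +-comm 1 k′ ⟩
      k′ + 1                         ≤⟨ +-mono-≤ (≤-reflexive (sym (clique-deg cl yQ))) (deg-at (S ∖ Q) (hS , h∉) yh) ⟩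
      deg Q y + deg (S ∖ Q) y        ≡⟨ sym (deg-split (split-remove S Q Q⊆) y) ⟩
      deg S y                        ∎
      where open ≤-Reasoning

    balance-out : ∀ {Q y h} → Clique Q → Q ⊆ˢ S → y ∈ˢ Q → h ∈ˢ S → h ∉ˢ Q → Adj y h →
      Result S ⊎ Σ[ B ∈ Balanced Q y ] (h ≡ Balanced.out B)
    balance-out cl Q⊆ yQ hS h∉ yh with balance cl Q⊆ yQ (outside-deg cl Q⊆ yQ hS h∉ yh)
    ... | inj₁ r = inj₁ r
    ... | inj₂ B with Balanced.nbrs B _ hS yh
    ...   | inj₁ hQ = contradiction hQ h∉
    ...   | inj₂ q = inj₂ (B , q)

    module TwoExits {Q : DSet n} (cl : Clique Q) (Q⊆ : Q ⊆ˢ S) {v y : Fin n} (vQ : v ∈ˢ Q) (yQ : y ∈ˢ Q) (y≢v : y ≢ v)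
                    (Bv : Balanced Q v) (By : Balanced Q y) where

      private
        module V = Balanced Bv
        module Y = Balanced By
        x h : Fin n
        x = V.out
        h = Y.out
        N : DSet n
        N = nbhd S v
        M : DSet n
        M = nbhd S y
        vS = Q⊆ v vQ
        yS = Q⊆ y yQ
        Q⊆N : ∀ z → z ∈ˢ Q → z ∈ˢ N
        Q⊆N z zQ with z Fin.≟ v
        ... | yes q = Q⊆ z zQ , inj₁ q
        ... | no ne = Q⊆ z zQ , inj₂ (Clique.pairwise cl v z vQ zQ (ne ∘ sym))
        Q⊆M : ∀ z → z ∈ˢ Q → z ∈ˢ M
        Q⊆M z zQ with z Fin.≟ y
        ... | yes q = Q⊆ z zQ , inj₁ q
        ... | no ne = Q⊆ z zQ , inj₂ (Clique.pairwise cl y z yQ zQ (ne ∘ sym))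
        hM : h ∈ˢ M
        hM = Y.out-∈ , inj₂ Y.out-adj
        xN : x ∈ˢ N
        xN = V.out-∈ , inj₂ V.out-adj
        -- An edge from `v` to `h` would make `h` the exit of `v`, which `v` alone in `Q` may see;
        -- but `y` sees it.
        h∉N : h ∉ˢ N
        h∉N (_ , inj₁ q) = Y.out-∉ (subst (_∈ˢ Q) (sym q) vQ)
        h∉N (_ , inj₂ vh) with V.nbrs h Y.out-∈ vh
        ... | inj₁ hQ = Y.out-∉ hQ
        ... | inj₂ q  = y≢v (V.only-v y yQ (subst (Adj y) q Y.out-adj))

      hFar : h ∈ˢ far S v
      hFar = Y.out-∈ , h∉N

      module _ {J : DSet n} (cJ : Comp J (far S v)) (hJ : h ∈ˢ J) where

        private
          J⊆ : J ⊆ˢ S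
          J⊆ z p = proj₁ (sub cJ z p)
          J∉N : ∀ z → z ∈ˢ J → z ∉ˢ N
          J∉N z p = proj₂ (sub cJ z p)
          J∉M : ∀ z → z ∈ˢ J → z ≢ h → z ∉ˢ M
          J∉M z zJ z≢ (_ , inj₁ refl) = J∉N z zJ (Q⊆N z yQ)
          J∉M z zJ z≢ (_ , inj₂ yz) with Y.nbrs z (J⊆ z zJ) yz
          ... | inj₁ zQ = J∉N z zJ (Q⊆N z zQ)
          ... | inj₂ q  = z≢ q

        -- Counting J - h from the centre y shows τ ∣ m J, and from the centre v it shows τ ∣ m J + 1.
        no-bridge : τ ∣ m J + e N J → e N J ≡ 1 → ⊥
        no-bridge dv e≡1 = <⇒≱ (s≤s (s≤s z≤n)) (∣⇒≤ (∣m+n∣m⇒∣n (subst (λ z → τ ∣ m J + z) e≡1 dv) τ∣mJ))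
          where
          only : ∀ a r → a ∈ˢ N → r ∈ˢ J → Adj a r → r ≡ h
          only a r aN rJ ar = proj₂ (unique-edge N J e≡1 (Q⊆N y yQ) hJ Y.out-adj aN rJ ar)
          -- The edge from `y` to `h` is the only one between N[v] and `J`. So a component of J - h
          -- has no neighbour in N[v], its only neighbour in N[y] is `h`, and it is cut off by N[y]
          -- as well.
          to-far : ∀ {H} → Comp H (J ─ h) → Comp H (far S y)
          to-far {H} cH = record
            { conn = conn cH
            ; sub = λ r rH → let rJ , r≢h = sub cH r rH in J⊆ r rJ , J∉M r rJ r≢h
            ; closed = cl′ }
            where
            cl′ : ClosedIn H (far S y)
            cl′ a b aH (bS , b∉M) ab with sub cH a aH | Split.cover (nbhd-split S v) b bS
            ... | aJ , a≢h | inj₁ bN = contradiction (only b a bN aJ (Adj-sym ab)) a≢h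
            ... | aJ , a≢h | inj₂ bF = closed cH a b aH (closed cJ a b aJ bF ab , λ { refl → b∉M hM }) ab
          at-h : ∀ {H} → Comp H (J ─ h) → e M H ≡ deg H h
          at-h {H} cH = sumOn-concentrated M (deg H) hM (λ a aM a≢h → deg-none H a (λ r rH ar → clear a aM a≢h r (sub cH r rH) ar))
            where
            clear : ∀ a → a ∈ˢ M → a ≢ h → ∀ r → r ∈ˢ J ─ h → ¬ Adj a r
            clear a (_ , inj₁ refl) a≢h r (rJ , r≢h) ar = r≢h (only a r (Q⊆N a yQ) rJ ar)
            clear a (aS , inj₂ ya) a≢h r (rJ , r≢h) ar with Y.nbrs a aS ya
            ... | inj₁ aQ = r≢h (only a r (Q⊆N a aQ) rJ ar)
            ... | inj₂ q  = a≢h q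
          τ∣rest : τ ∣ m (J ─ h) + deg (J ─ h) h
          τ∣rest = compInd (J ─ h) (λ R → τ ∣ m R + deg R h)
            (λ R none → subst (τ ∣_) (sym (cong₂ _+_ (sumOn-∅ R _ (λ z p → ⊥-elim (none z p))) (sumOn-∅ R _ (λ z p → ⊥-elim (none z p))))) (τ ∣0))
            (λ R H R′ sp _ cH apart ih → subst (τ ∣_)
              (sym (trans (cong₂ _+_ (m-apart sp apart) (deg-split sp h)) (+-interchange (m H) (m R′) _ _)))
              (∣m∣n⇒∣m+n (subst (λ z → τ ∣ m H + z) (at-h cH) (proj₁ (Y.good H (to-far cH)))) ih))
          τ∣mJ : τ ∣ m J
          τ∣mJ = subst (τ ∣_) (trans (+-comm (m (J ─ h)) _) (sym (m-add (split-point J hJ)))) τ∣rest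

        second-edge : e N J ≡ 2 → ∃[ a ] (a ∈ˢ N × ∃[ r ] (r ∈ˢ J × Adj a r × ¬ (a ≡ y × r ≡ h)))
        second-edge e≡2 with find N (λ a → any? (λ r → mem? J r ×-dec adj? a r ×-dec ¬? ((a Fin.≟ y) ×-dec (r Fin.≟ h))))
        ... | inj₁ p = p
        ... | inj₂ none = contradiction (≤-trans (≤-reflexive (sym e≡2)) (≤-trans (≤-reflexive at-y) (≤-trans (≤-reflexive at-h) (α≤1 y h)))) λ { (s≤s ()) }
          where
          at-y : e N J ≡ deg J y
          at-y = sumOn-concentrated N (deg J) (Q⊆N y yQ) (λ a aN a≢y → deg-none J a (λ r rJ ar → none a aN (r , rJ , ar , λ q → a≢y (proj₁ q))))
          at-h : deg J y ≡ α y h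
          at-h = sumOn-concentrated J (α y) hJ (λ r rJ r≢h → α-nonadj (λ yr → none y (Q⊆N y yQ) (r , rJ , yr , λ q → r≢h (proj₂ q))))

        module _ (clJ : Clique J) (Bh : Balanced J h) (y≡out : y ≡ Balanced.out Bh)
                 {y₂ h₂ : Fin n} (y₂N : y₂ ∈ˢ N) (h₂J : h₂ ∈ˢ J) (y₂h₂ : Adj y₂ h₂) (ne : ¬ (y₂ ≡ y × h₂ ≡ h)) where

          private
            -- All neighbours of `v` lie in N[v], the only exit of `y` is `h`, and the only exit of
            -- `h` from `J` is `y`. Hence the second edge avoids these three vertices.
            y₂≢v : y₂ ≢ v
            y₂≢v refl = J∉N h₂ h₂J (J⊆ h₂ h₂J , inj₂ y₂h₂)
            y₂≢y : y₂ ≢ y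
            y₂≢y refl with Y.nbrs h₂ (J⊆ h₂ h₂J) y₂h₂
            ... | inj₁ q = J∉N h₂ h₂J (Q⊆N h₂ q)
            ... | inj₂ q = ne (refl , q)
            h₂≢h : h₂ ≢ h
            h₂≢h refl with Balanced.nbrs Bh y₂ (proj₁ y₂N) (Adj-sym y₂h₂)
            ... | inj₁ q = J∉N y₂ q y₂N
            ... | inj₂ q = y₂≢y (trans q (sym y≡out))
            h₂Far : h₂ ∈ˢ far S y
            h₂Far = J⊆ h₂ h₂J , J∉M h₂ h₂J h₂≢h
            y₂-cases : y₂ ∈ˢ Q ⊎ y₂ ≡ x
            y₂-cases with proj₂ y₂N
            ... | inj₁ q = contradiction q y₂≢v
            ... | inj₂ vy₂ = V.nbrs y₂ (proj₁ y₂N) vy₂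
            xFar : x ∈ˢ far S y
            xFar = V.out-∈ , λ { (_ , inj₁ q) → V.out-∉ (subst (_∈ˢ Q) (sym q) yQ) ; (_ , inj₂ yx) → y≢v (V.only-v y yQ yx) }
            2≤k : 2 ≤ k
            2≤k = subst (2 ≤_) (Clique.size cl) (card-two Q vQ yQ y≢v)

            module _ {J′ : DSet n} (cJ′ : Comp J′ (far S y)) (h₂J′ : h₂ ∈ˢ J′) where
              J─h⊆ : (J ─ h) ⊆ˢ J′
              J─h⊆ j (jJ , j≢h) with h₂ Fin.≟ j
              ... | yes refl = h₂J′
              ... | no h₂≢j = closed cJ′ h₂ j h₂J′ (J⊆ j jJ , J∉M j jJ j≢h) (Clique.pairwise clJ h₂ j h₂J jJ h₂≢j)
              x∈J′ : y₂ ≡ x → x ∈ˢ J′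
              x∈J′ refl = closed cJ′ h₂ x h₂J′ xFar (Adj-sym y₂h₂)
              -- If `y₂` is in `Q`, it is in N[y] and sees `h₂`. Otherwise it is the exit `x` of
              -- `v`, which joins `J′` through `h₂`, and `v` in N[y] sees it.
              another : ∃[ z ] (z ∈ˢ M × z ≢ h × 1 ≤ deg J′ z)
              another with y₂-cases
              ... | inj₁ y₂Q = y₂ , Q⊆M y₂ y₂Q , (λ { refl → Y.out-∉ y₂Q }) , deg-at J′ h₂J′ y₂h₂
              ... | inj₂ q = v , Q⊆M v vQ , (λ { refl → Y.out-∉ vQ }) , deg-at J′ (x∈J′ q) V.out-adj
              k≤e : k ≤ e M J′
              k≤e = let z , zM , z≢h , 1≤d = another in begin
                suc k′                    ≡⟨ +-comm 1 k′ ⟩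
                k′ + 1                    ≤⟨ +-mono-≤ (≤-reflexive (trans (sym (clique-deg clJ hJ)) (deg-remove-self J))) 1≤d ⟩
                deg (J ─ h) h + deg J′ z  ≤⟨ +-monoˡ-≤ (deg J′ z) (deg-≤ (J ─ h) J′ h (λ j p _ → J─h⊆ j p)) ⟩
                deg J′ h + deg J′ z       ≤⟨ sumOn-two M (deg J′) hM zM z≢h ⟩
                e M J′                    ∎
                where open ≤-Reasoning

          -- The set `J′` contains J - h, so `h` sends k - 1 edges to it, and `another` finds one
          -- more from N[y]. As `Good` allows at most two, k = 2. Then `Q`, `J` and `J′` are single
          -- edges, and `v`, `y`, `h`, `h₂`, `x` form a cycle.
          close : Result S
          close with component (far S y) h₂Far
          ... | J′ , cJ′ , h₂J′ with proj₂ (Y.good J′ cJ′)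
          ...   | inj₁ e≡1 = contradiction (≤-trans 2≤k (≤-trans (k≤e cJ′ h₂J′) (≤-reflexive e≡1))) λ { (s≤s ()) }
          ...   | inj₂ (e≡2 , clJ′) with ≤-antisym (≤-trans (k≤e cJ′ h₂J′) (≤-reflexive e≡2)) 2≤k
          ...     | k≡2 = finish y₂-cases
            where
            two-only : ∀ {A} → Clique A → ∀ {a b} c → a ∈ˢ A → b ∈ˢ A → b ≢ a → c ∈ˢ A → c ≡ a ⊎ c ≡ b
            two-only {A} clA {a} {b} c aA bA b≢a cA with c Fin.≟ a | c Fin.≟ b
            ... | yes q | _ = inj₁ q
            ... | no _ | yes q = inj₂ q
            ... | no c≢a | no c≢b = contradiction (card-three A aA bA cA b≢a c≢a c≢b) (<⇒≱ (≤-reflexive (cong suc (trans (Clique.size clA) k≡2))))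
            other : ∀ {A} → Clique A → ∀ {a b} c → a ∈ˢ A → b ∈ˢ A → b ≢ a → c ∈ˢ A → Adj a c → c ≡ b
            other clA c aA bA b≢a cA ac with two-only clA c aA bA b≢a cA
            ... | inj₁ q = contradiction (sym q) (Adj-irrefl ac)
            ... | inj₂ q = q
            x∉J : x ∉ˢ J
            x∉J p = J∉N x p xN
            v∉J′ : v ∉ˢ J′
            v∉J′ p = proj₂ (sub cJ′ v p) (Q⊆M v vQ)
            J′⊆ : J′ ⊆ˢ S
            J′⊆ z p = proj₁ (sub cJ′ z p)
            finish : y₂ ∈ˢ Q ⊎ y₂ ≡ x → Result S
            finish (inj₁ y₂Q) = [ (λ q → contradiction q y₂≢v) , (λ q → contradiction q y₂≢y) ]′ (two-only cl y₂ vQ yQ y≢v y₂Q)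
            -- The vertices `h₂` and `x` have exits from `J` and `J′`, so they are balanced too.
            -- Unique exits at all five vertices exclude chords and further neighbours.
            finish (inj₂ y₂≡x) with balance-out clJ J⊆ h₂J V.out-∈ x∉J (Adj-sym (subst (λ z → Adj z h₂) y₂≡x y₂h₂))
                                  | balance-out clJ′ J′⊆ (x∈J′ cJ′ h₂J′ y₂≡x) vS v∉J′ (Adj-sym V.out-adj)
            ... | inj₁ r | _ = r
            ... | inj₂ _ | inj₁ r = r
            ... | inj₂ (B₂ , x≡out) | inj₂ (Bx , v≡out) =
                  tight V.D V.isolates V.tight-D (pentagon k≡2 (iso-on-closed C5 p cS zero (injective-from-< p distinct) p∈ edges nbr))
              where
              h₂x : Adj h₂ x
              h₂x = Adj-sym (subst (λ z → Adj z h₂) y₂≡x y₂h₂)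
              xJ′ : x ∈ˢ J′
              xJ′ = x∈J′ cJ′ h₂J′ y₂≡x
              vy : Adj v y
              vy = Clique.pairwise cl v y vQ yQ (y≢v ∘ sym)
              hh₂ : Adj h h₂
              hh₂ = Clique.pairwise clJ h h₂ hJ h₂J (h₂≢h ∘ sym)
              h₂≢x : h₂ ≢ x
              h₂≢x = Adj-irrefl h₂x
              p : Fin 5 → Fin n
              p zero = v
              p (suc zero) = y
              p (suc (suc zero)) = h
              p (suc (suc (suc zero))) = h₂
              p (suc (suc (suc (suc zero)))) = x
              p∈ : ∀ a → p a ∈ˢ S
              p∈ zero = vS
              p∈ (suc zero) = yS
              p∈ (suc (suc zero)) = Y.out-∈
              p∈ (suc (suc (suc zero))) = J⊆ h₂ h₂J
              p∈ (suc (suc (suc (suc zero)))) = V.out-∈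
              around : ∀ a → Adj (p a) (p (next₅ a))
              around zero = vy
              around (suc zero) = Y.out-adj
              around (suc (suc zero)) = hh₂
              around (suc (suc (suc zero))) = h₂x
              around (suc (suc (suc (suc zero)))) = Adj-sym V.out-adj
              edges : ∀ a b → adj C5 a b ≡ true → Adj (p a) (p b)
              edges a b ab with C5-next a b ab
              ... | inj₁ refl = around a
              ... | inj₂ refl = Adj-sym (around b)
              distinct : ∀ a b → a Fin.< b → p a ≢ p b
              distinct zero (suc zero) _ q = y≢v (sym q)
              distinct zero (suc (suc zero)) _ q = Y.out-∉ (subst (_∈ˢ Q) q vQ)
              distinct zero (suc (suc (suc zero))) _ q = J∉N h₂ h₂J (subst (_∈ˢ N) q (Q⊆N v vQ))
              distinct zero (suc (suc (suc (suc zero)))) _ q = V.out-∉ (subst (_∈ˢ Q) q vQ)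
              distinct (suc zero) (suc (suc zero)) _ q = Y.out-∉ (subst (_∈ˢ Q) q yQ)
              distinct (suc zero) (suc (suc (suc zero))) _ q = J∉N h₂ h₂J (subst (_∈ˢ N) q (Q⊆N y yQ))
              distinct (suc zero) (suc (suc (suc (suc zero)))) _ q = V.out-∉ (subst (_∈ˢ Q) q yQ)
              distinct (suc (suc zero)) (suc (suc (suc zero))) _ q = h₂≢h (sym q)
              distinct (suc (suc zero)) (suc (suc (suc (suc zero)))) _ q = x∉J (subst (_∈ˢ J) q hJ)
              distinct (suc (suc (suc zero))) (suc (suc (suc (suc zero)))) _ q = h₂≢x q
              distinct (suc zero) (suc zero) (s≤s ())
              distinct (suc (suc _)) (suc zero) (s≤s ())
              distinct (suc (suc zero)) (suc (suc zero)) (s≤s (s≤s ()))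
              distinct (suc (suc (suc _))) (suc (suc zero)) (s≤s (s≤s ()))
              distinct (suc (suc (suc zero))) (suc (suc (suc zero))) (s≤s (s≤s (s≤s ())))
              distinct (suc (suc (suc (suc _)))) (suc (suc (suc zero))) (s≤s (s≤s (s≤s ())))
              distinct (suc (suc (suc (suc zero)))) (suc (suc (suc (suc zero)))) (s≤s (s≤s (s≤s (s≤s ()))))
              nbr : ∀ a z → z ∈ˢ S → Adj (p a) z → ∃[ b ] (adj C5 a b ≡ true × z ≡ p b)
              nbr zero z zS az with V.nbrs z zS az
              ... | inj₁ zQ = suc zero , refl , other cl z vQ yQ y≢v zQ az
              ... | inj₂ q = suc (suc (suc (suc zero))) , refl , q
              nbr (suc zero) z zS az with Y.nbrs z zS az
              ... | inj₁ zQ = zero , refl , other cl z yQ vQ (y≢v ∘ sym) zQ az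
              ... | inj₂ q = suc (suc zero) , refl , q
              nbr (suc (suc zero)) z zS az with Balanced.nbrs Bh z zS az
              ... | inj₁ zJ = suc (suc (suc zero)) , refl , other clJ z hJ h₂J h₂≢h zJ az
              ... | inj₂ q = suc zero , refl , trans q (sym y≡out)
              nbr (suc (suc (suc zero))) z zS az with Balanced.nbrs B₂ z zS az
              ... | inj₁ zJ = suc (suc zero) , refl , other clJ z h₂J hJ (h₂≢h ∘ sym) zJ az
              ... | inj₂ q = suc (suc (suc (suc zero))) , refl , trans q (sym x≡out)
              nbr (suc (suc (suc (suc zero)))) z zS az with Balanced.nbrs Bx z zS az
              ... | inj₁ zJ′ = suc (suc (suc zero)) , refl , other clJ′ z xJ′ h₂J′ h₂≢x zJ′ az
              ... | inj₂ q = zero , refl , trans q (sym v≡out)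

        double : e N J ≡ 2 → Clique J → Result S
        double e≡2 clJ with balance-out clJ J⊆ hJ yS (λ p → J∉N y p (Q⊆N y yQ)) (Adj-sym Y.out-adj) | second-edge e≡2
        ... | inj₁ r | _ = r
        ... | inj₂ (Bh , y≡out) | y₂ , y₂N , h₂ , h₂J , y₂h₂ , ne = close clJ Bh y≡out y₂N h₂J y₂h₂ ne

      two-exits : Result S
      two-exits with component (far S v) hFar
      ... | J , cJ , hJ with V.good J cJ
      ...   | dv , inj₁ e≡1 = ⊥-elim (no-bridge cJ hJ dv e≡1)
      ...   | _ , inj₂ (e≡2 , clJ) = double cJ hJ e≡2 clJ

    clique-case : ∀ {Q} → Clique Q → Q ⊆ˢ S → Result S
    clique-case {Q} cl Q⊆ with find Q (λ z → k ≤? deg S z)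
    ... | inj₂ low = clique (clique-≐ Q⊆ (core-in-regular cS Q⊆ (λ z zQ → ≤-reflexive (sym (clique-deg cl zQ)))
                       (λ z zQ → ≤-pred (≰⇒> (low z zQ))) (proj₂ (clique-inhabited cl))) cl)
    ... | inj₁ (v , vQ , k≤d) with balance cl Q⊆ vQ k≤d
    ...   | inj₁ r = r
    ...   | inj₂ Bv with find (Q ─ v) (λ z → any? (λ h → mem? S h ×-dec ¬? (mem? Q h) ×-dec adj? z h))
    ...     | inj₁ (y , (yQ , y≢v) , h , hS , h∉ , yh) with balance-out cl Q⊆ yQ hS h∉ yh
    ...       | inj₁ r = r
    ...       | inj₂ (By , _) = TwoExits.two-exits cl Q⊆ vQ yQ y≢v Bv By
    -- Only `v` has a neighbour outside `Q`, and only one, so `Q` hangs on that exit, which serves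
    -- as the hub.
    clique-case {Q} cl Q⊆ | inj₁ (v , vQ , k≤d) | inj₂ Bv | inj₂ none =
      hub-clique cS IH (Balanced.out-∈ Bv) cl Q⊆ (Balanced.out-∉ Bv) touch
      where
      touch : ∀ h a → h ∈ˢ Q → a ∈ˢ S → Adj h a → a ∈ˢ Q ⊎ a ≡ Balanced.out Bv
      touch h a hQ aS ha with h Fin.≟ v
      ... | yes refl = Balanced.nbrs Bv a aS ha
      ... | no h≢v with mem? Q a
      ...   | yes aQ = inj₁ aQ
      ...   | no a∉ = contradiction (a , aS , a∉ , ha) (none h (hQ , h≢v))

-- Regular sets and large cores, and the classification

module CoreCase {n : ℕ} (G : Graph n) (k′ : ℕ) where

  open InGraph G
  open Isolation G k′
  open OffCentre G k′
  open Hub G k′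
  open CliqueCase G k′

  HasClique : DSet n → Set₁
  HasClique S = Σ[ Q ∈ DSet n ] (Clique Q × Q ⊆ˢ S)

  twice-τ : ∀ {j} → k′ ≡ 2 + j → 2 * τ ≡ 10 + 5 * j + j * j
  twice-τ {j} eq = begin
    2 * (2 + κ)              ≡⟨ *-distribˡ-+ 2 2 κ ⟩
    4 + 2 * κ                ≡⟨ cong (4 +_) 2*κ ⟩
    4 + suc k′ * k′          ≡⟨ cong (λ z → 4 + suc z * z) eq ⟩
    4 + (3 + j) * (2 + j)    ≡⟨ solve 1 (λ j → con 4 :+ (con 3 :+ j) :* (con 2 :+ j) := con 10 :+ con 5 :* j :+ j :* j) refl j ⟩
    10 + 5 * j + j * j       ∎
    where
    open ≡-Reasoning
    open +-*-Solver

  deg-saturated : ∀ B z → card B ≤ deg B z → ∀ y → y ∈ˢ B → Adj z y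
  deg-saturated B z le y yB with adj? z y
  ... | yes p = p
  ... | no ¬p = contradiction le (<⇒≱ (begin-strict
      deg B z          ≤⟨ deg-≤ B (B ─ y) z (λ w wB zw → wB , λ { refl → ¬p zw }) ⟩
      deg (B ─ y) z    ≤⟨ deg≤card (B ─ y) z ⟩
      card (B ─ y)     <⟨ ≤-reflexive (sym (card-remove B yB)) ⟩
      card B           ∎))
    where open ≤-Reasoning

  two-nbrs : ∀ B {x a b} → deg B x ≡ 2 → a ∈ˢ B → b ∈ˢ B → b ≢ a → Adj x a → Adj x b → ∀ y → y ∈ˢ B → Adj x y → y ≡ a ⊎ y ≡ b
  two-nbrs B {x} {a} {b} d≡2 aB bB b≢a xa xb y yB xy with y Fin.≟ a | y Fin.≟ b
  ... | yes q | _ = inj₁ q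
  ... | no _  | yes q = inj₂ q
  ... | no y≢a | no y≢b = contradiction d≡2 (<⇒≢ (begin-strict
      2                              <⟨ s≤s (deg-two (B ─ a) (bB , b≢a) (yB , y≢a) y≢b xb xy) ⟩
      1 + deg (B ─ a) x              ≡⟨ cong (_+ deg (B ─ a) x) (sym (α-adj xa)) ⟩
      α x a + deg (B ─ a) x          ≡⟨ sym (sumOn-point B (α x) aB) ⟩
      deg B x                        ∎) ∘ sym)
    where open ≤-Reasoning

  card-add-≤ : ∀ (A : DSet n) x → card (A ∪ˢ sing x) ≤ suc (card A)
  card-add-≤ A x with mem? A x
  ... | no x∉ = ≤-reflexive (card-add A x∉)
  ... | yes xA = ≤-trans (card-⊆ (A ∪ˢ sing x) A (λ { _ (inj₁ q) → q ; _ (inj₂ refl) → xA })) (n≤1+n _)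

  -- The fourth vertex `z` is not adjacent to `v`, so its two neighbours must be `b` and `c`.
  square-from-regular : ∀ {S} → Conn S → card S ≡ 4 → (∀ y → y ∈ˢ S → deg S y ≡ 2) → IsoOn C4 S
  square-from-regular {S} cS c≡4 reg with inhabited cS
  ... | v , vS with deg-find₂ S v (≤-reflexive (sym (reg v vS)))
  ...   | b , c , bS , cS′ , c≢b , vb , vc with card-pick S (sing v ∪ˢ sing b ∪ˢ sing c)
            (≤-trans (s≤s (≤-trans (card-add-≤ (sing v ∪ˢ sing b) c) (s≤s (card-pair v b)))) (≤-reflexive (sym c≡4)))
  ...     | z , zS , z∉ = iso-on-closed C4 p cS zero (injective-from-< p distinct) p∈ edges nbr
    where
    z≢v : z ≢ v
    z≢v q = z∉ (inj₁ (inj₁ q))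
    z≢b : z ≢ b
    z≢b q = z∉ (inj₁ (inj₂ q))
    z≢c : z ≢ c
    z≢c q = z∉ (inj₂ q)
    v-nbrs = two-nbrs S (reg v vS) bS cS′ c≢b vb vc
    ¬vz : ¬ Adj v z
    ¬vz vz = [ z≢b , z≢c ]′ (v-nbrs z zS vz)
    B = S ─ z ─ v
    |B| : card B ≡ 2
    |B| = suc-injective (suc-injective (trans (cong suc (sym (card-remove (S ─ z) (vS , z≢v ∘ sym)))) (trans (sym (card-remove S zS)) c≡4)))
    z-all : ∀ y → y ∈ˢ B → Adj z y
    z-all = deg-saturated B z (≤-trans (≤-reflexive (trans |B| (sym (reg z zS))))
              (deg-≤ S B z (λ y yS zy → (yS , Adj-irrefl (Adj-sym zy)) , λ { refl → ¬vz (Adj-sym zy) })))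
    zb = z-all b ((bS , z≢b ∘ sym) , Adj-irrefl (Adj-sym vb))
    zc = z-all c ((cS′ , z≢c ∘ sym) , Adj-irrefl (Adj-sym vc))
    p : Fin 4 → Fin n
    p zero = v
    p (suc zero) = b
    p (suc (suc zero)) = z
    p (suc (suc (suc zero))) = c
    p∈ : ∀ a → p a ∈ˢ S
    p∈ zero = vS
    p∈ (suc zero) = bS
    p∈ (suc (suc zero)) = zS
    p∈ (suc (suc (suc zero))) = cS′
    around : ∀ a → Adj (p a) (p (next₄ a))
    around zero = vb
    around (suc zero) = Adj-sym zb
    around (suc (suc zero)) = zc
    around (suc (suc (suc zero))) = Adj-sym vc
    edges : ∀ a b → adj C4 a b ≡ true → Adj (p a) (p b)
    edges a b ab with C4-next a b ab
    ... | inj₁ refl = around a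
    ... | inj₂ refl = Adj-sym (around b)
    distinct : ∀ a b → a Fin.< b → p a ≢ p b
    distinct zero (suc zero) _ = Adj-irrefl vb
    distinct zero (suc (suc zero)) _ = z≢v ∘ sym
    distinct zero (suc (suc (suc zero))) _ = Adj-irrefl vc
    distinct (suc zero) (suc (suc zero)) _ = z≢b ∘ sym
    distinct (suc zero) (suc (suc (suc zero))) _ = c≢b ∘ sym
    distinct (suc (suc zero)) (suc (suc (suc zero))) _ = z≢c
    distinct (suc zero) (suc zero) (s≤s ())
    distinct (suc (suc _)) (suc zero) (s≤s ())
    distinct (suc (suc zero)) (suc (suc zero)) (s≤s (s≤s ()))
    distinct (suc (suc (suc _))) (suc (suc zero)) (s≤s (s≤s ()))
    distinct (suc (suc (suc zero))) (suc (suc (suc zero))) (s≤s (s≤s (s≤s ())))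
    nbr : ∀ a y → y ∈ˢ S → Adj (p a) y → ∃[ b ] (adj C4 a b ≡ true × y ≡ p b)
    nbr zero y yS ay with v-nbrs y yS ay
    ... | inj₁ q = suc zero , refl , q
    ... | inj₂ q = suc (suc (suc zero)) , refl , q
    nbr (suc zero) y yS ay with two-nbrs S (reg b bS) vS zS z≢v (Adj-sym vb) (Adj-sym zb) y yS ay
    ... | inj₁ q = zero , refl , q
    ... | inj₂ q = suc (suc zero) , refl , q
    nbr (suc (suc zero)) y yS ay with two-nbrs S (reg z zS) bS cS′ c≢b zb zc y yS ay
    ... | inj₁ q = suc zero , refl , q
    ... | inj₂ q = suc (suc (suc zero)) , refl , q
    nbr (suc (suc (suc zero))) y yS ay with two-nbrs S (reg c cS′) vS zS z≢v (Adj-sym vc) (Adj-sym zc) y yS ay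
    ... | inj₁ q = zero , refl , q
    ... | inj₂ q = suc (suc zero) , refl , q

  halve-< : ∀ {a b} → 2 * a < 2 * suc b → a ≤ b
  halve-< {a} {b} lt = ≤-pred (*-cancelˡ-< 2 a (suc b) lt)

  -- For degree 0 or 1 a connected set has no more than k vertices. For degree 2 + j and k + 1 + i
  -- vertices, 2(m + 1) exceeds 2τ by j + i(2 + j). This vanishes only for four vertices of degree
  -- 2.
  regular-case : ∀ {S} → Conn S → (∀ y → y ∈ˢ S → deg S y ≡ k′) → Result S
  regular-case {S} cS reg with card S ≤? k | inhabited cS
  ... | yes le | v , vS = clique (small-core-clique S (λ y yS → ≤-reflexive (sym (reg y yS))) vS le)
  ... | no ¬le | v , vS = byDegree k′ refl
    where
    k<c : k < card S
    k<c = ≰⇒> ¬le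
    iso : Isol (v ∷ []) S
    iso = regular-isol cS (λ y yS → ≤-reflexive (reg y yS)) vS (here (inj₁ refl))
    2m : ∀ {j} → k′ ≡ j → 2 * m S ≡ j * card S
    2m eq = trans (regular-2m reg) (cong (_* card S) eq)
    byDegree : ∀ j → k′ ≡ j → Result S
    byDegree zero eq = contradiction k<c (≤⇒≯ (≤-trans (card≤m+1 S cS) (s≤s (≤-trans (≤-reflexive (m+n≡0⇒m≡0 (m S) (2m eq))) z≤n))))
    byDegree (suc zero) eq = contradiction (subst (λ z → suc z < card S) eq k<c) (≤⇒≯ (≤-trans (card≤m+1 S cS) (s≤s (+-cancelʳ-≤ (m S) _ _ (begin
        m S + m S        ≡⟨ cong (m S +_) (sym (+-identityʳ _)) ⟩
        2 * m S          ≡⟨ trans (2m eq) (+-identityʳ _) ⟩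
        card S           ≤⟨ card≤m+1 S cS ⟩
        suc (m S)        ∎)))))
      where open ≤-Reasoning
    byDegree (suc (suc j)) eq with m≤n⇒∃[o]m+o≡n k<c
    ... | i , c≡ = shape j i refl refl
      where
      open +-*-Solver
      excess : 2 * suc (m S) ≡ 2 * (τ * 1) + (j + i * (2 + j))
      excess = begin
        2 * suc (m S)                                ≡⟨ *-suc 2 (m S) ⟩
        2 + 2 * m S                                  ≡⟨ cong (2 +_) (2m eq) ⟩
        2 + (2 + j) * card S                         ≡⟨ cong (λ z → 2 + (2 + j) * z) (trans (sym c≡) (cong (λ z → suc (suc z) + i) eq)) ⟩
        2 + (2 + j) * (4 + j + i)                    ≡⟨ solve 2 (λ j i → con 2 :+ (con 2 :+ j) :* (con 4 :+ j :+ i) := (con 10 :+ con 5 :* j :+ j :* j) :+ (j :+ i :* (con 2 :+ j))) refl j i ⟩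
        (10 + 5 * j + j * j) + (j + i * (2 + j))     ≡⟨ cong (_+ (j + i * (2 + j))) (trans (sym (twice-τ eq)) (cong (2 *_) (sym (*-identityʳ τ)))) ⟩
        2 * (τ * 1) + (j + i * (2 + j))              ∎
        where open ≡-Reasoning
      slack : 0 < j + i * (2 + j) → Result S
      slack pos = strict (v ∷ []) iso (halve-< (≤-trans (m<m+n (2 * (τ * 1)) pos) (≤-reflexive (sym excess))))
      shape : ∀ j₀ i₀ → j ≡ j₀ → i ≡ i₀ → Result S
      shape (suc _) _ refl _ = slack (s≤s z≤n)
      shape zero (suc _) refl refl = slack (s≤s z≤n)
      shape zero zero refl refl = tight (v ∷ []) iso (sym (*-cancelˡ-≡ _ _ 2 (trans excess (+-identityʳ _))))
        (square (cong suc eq) (square-from-regular cS (trans (sym c≡) (trans (+-identityʳ _) (cong (2 +_) eq))) (λ y yS → trans (reg y yS) eq)))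

  module _ {S : DSet n} (cS : Conn S) (IH : ∀ H → card H < card S → Conn H → Result H) {j : ℕ} (k′≡ : k′ ≡ 2 + j) where

    Done : Set₁
    Done = Result S ⊎ HasClique S

    HasSquare : Fin n → Set₁
    HasSquare v = Σ[ J ∈ DSet n ] (Comp J (far S v) × k ≡ 3 × IsoOn C4 J)

    -- The estimate is doubled, yet edges to N[v] count once: the degree sum over the neighbours of
    -- `v` consumes the other half of each of them.
    record CorePart (v : Fin n) (R : DSet n) : Set₁ where
      field
        D        : List (Fin n)
        isolate  : Isol D R
        bound    : 2 * (τ * length D) ≤ 2 * m R + e (nbhd S v) R
        if-tight : 2 * (τ * length D) ≡ 2 * m R + e (nbhd S v) R → (∀ y → y ∉ˢ R) ⊎ HasSquare v

    -- A special component hands over one of its k-cliques, and 3 ≤ k excludes pentagons. Among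
    -- tight components only squares remain; two edges make up for their doubled + 1, and a single
    -- edge leads to a hub.
    core-component : ∀ {v H} → v ∈ˢ S → Comp H (far S v) → Done ⊎ CorePart v H
    core-component {v} {H} vS cH with comp-edge cS (nbhd-split S v) (vS , inj₁ refl) cH
    ... | a , h , aA , hH , ah = go (IH H (card-⊂ H S H⊆ vS (λ p → proj₂ (sub cH v p) (vS , inj₁ refl))) (conn cH))
      where
      N = nbhd S v
      H⊆ : H ⊆ˢ S
      H⊆ y p = proj₁ (sub cH y p)
      1≤e : 1 ≤ e N H
      1≤e = e-at N H aA hH ah
      slack : ∀ D → Isol D H → 2 * (τ * length D) < 2 * m H + e N H → CorePart v H
      slack D iso lt = record { D = D ; isolate = iso ; bound = <⇒≤ lt ; if-tight = λ eq → contradiction eq (<⇒≢ lt) }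
      go : Result H → Done ⊎ CorePart v H
      go (clique cl) = inj₁ (inj₂ (H , cl , H⊆))
      go (strict D iso le) = inj₂ (slack D iso (≤-trans (s≤s (*-monoʳ-≤ 2 le)) (≤-trans (≤-reflexive (+-comm 1 _)) (+-monoʳ-≤ (2 * m H) 1≤e))))
      go (tight D iso eq (special P _ _)) = inj₁ (inj₂ (petal H (ctr P) (ctr P h) ,
        petal-clique P (ctr-∈ P h hH) (ctr-idem P h hH) , λ y q → H⊆ y (proj₁ q)))
      go (tight D iso eq (pentagon k≡2 _)) with trans (sym (cong suc k′≡)) k≡2
      ... | ()
      go (tight D iso eq (square k≡3 io)) with m≤n⇒m<n∨m≡n 1≤e
      ... | inj₂ 1≡e = inj₁ (inj₁ (hub-square cS IH (proj₁ aA) k≡3 (conn cH) io H⊆ (λ p → proj₂ (sub cH a p) aA)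
                         (comp-touch {S} {v} cH (sym 1≡e) aA hH ah)))
      ... | inj₁ 2≤e = inj₂ (record
              { D = D ; isolate = iso
              ; bound = ≤-trans (≤-reflexive (trans (cong (2 *_) eq) (trans (*-suc 2 (m H)) (+-comm 2 _)))) (+-monoʳ-≤ (2 * m H) 2≤e)
              ; if-tight = λ _ → inj₂ (H , cH , k≡3 , io) })

    core-part : ∀ v → v ∈ˢ S → Done ⊎ CorePart v (far S v)
    core-part v vS = compInd (far S v) (λ R → Done ⊎ CorePart v R)
      (λ R none → inj₂ (record
        { D = [] ; isolate = isol-empty none ; bound = ≤-trans (≤-reflexive (cong (2 *_) (*-zeroʳ τ))) z≤n
        ; if-tight = λ _ → inj₁ none }))
      extend
      where
      N = nbhd S v
      extend : ∀ R H R′ → Split R H R′ → R ⊆ˢ far S v → Comp H (far S v) → (∀ a b → a ∈ˢ H → b ∈ˢ R′ → ¬ Adj a b) →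
        Done ⊎ CorePart v R′ → Done ⊎ CorePart v R
      extend R H R′ sp _ cH apart (inj₁ r) = inj₁ r
      extend R H R′ sp _ cH apart (inj₂ rest) with core-component vS cH
      ... | inj₁ r = inj₁ r
      ... | inj₂ p = inj₂ (record
          { D = P.D ++ Q.D
          ; isolate = isol-split sp apart ++⁺ˡ (++⁺ʳ P.D) P.isolate Q.isolate
          ; bound = ≤-trans (≤-reflexive len) (≤-trans (+-mono-≤ P.bound Q.bound) (≤-reflexive (sym total)))
          ; if-tight = λ eq → [ (λ none → ⊥-elim (none _ (proj₂ (inhabited (conn cH))))) , inj₂ ]′
              (P.if-tight (proj₁ (+-≡-split P.bound Q.bound (trans (sym len) (trans eq total))))) })
        where
        module P = CorePart p
        module Q = CorePart rest
        len : 2 * (τ * length (P.D ++ Q.D)) ≡ 2 * (τ * length P.D) + 2 * (τ * length Q.D)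
        len = trans (cong (2 *_) (trans (cong (τ *_) (length-++ P.D)) (*-distribˡ-+ τ (length P.D) _))) (*-distribˡ-+ 2 (τ * length P.D) _)
        total : 2 * m R + e N R ≡ (2 * m H + e N H) + (2 * m R′ + e N R′)
        total = trans (cong₂ _+_ (trans (cong (2 *_) (m-apart sp apart)) (*-distribˡ-+ 2 (m H) _)) (e-splitʳ sp N))
                      (+-interchange (2 * m H) (2 * m R′) _ _)

    Leaf : Fin n → Set
    Leaf v = ∃[ z ] (z ∈ˢ S × Adj v z × deg S z ≡ 1)

    core-centre : ∀ {X v} → X ⊆ˢ S → Core X → v ∈ˢ X → k ≤ deg S v → Done ⊎ (Leaf v × HasSquare v)
    core-centre {X} {v} X⊆ core vX k≤d with core-part v (X⊆ v vX)
    ... | inj₁ r = inj₁ r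
    ... | inj₂ part = byLeaf (find W (λ w → deg S w ≟ 1))
      where
      open CorePart part
      open +-*-Solver
      vS = X⊆ v vX
      N W R Y : DSet n
      N = nbhd S v
      W = N ─ v
      R = far S v
      Y = W ∩ˢ X
      d = deg S v
      Wadj : ∀ w → w ∈ˢ W → Adj v w
      Wadj w ((_ , inj₁ q) , ne) = contradiction q ne
      Wadj w ((_ , inj₂ p) , _) = p
      -- The degree of a neighbour of `v` in `S` without its edge to `v`, as `deg-f` confirms.
      f : Fin n → ℕ
      f w = deg W w + deg R w
      spv : Split N (sing v) W
      spv = split-point N (vS , inj₁ refl)
      |W| : card W ≡ d
      |W| = suc-injective (trans (sym (card-remove N (vS , inj₁ refl))) (nbhd-card S vS))
      deg-f : ∀ w → w ∈ˢ W → deg S w ≡ suc (f w)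
      deg-f w wW = begin
        deg S w                               ≡⟨ deg-split (nbhd-split S v) w ⟩
        deg N w + deg R w                     ≡⟨ cong (_+ deg R w) (deg-split spv w) ⟩
        deg (sing v) w + deg W w + deg R w    ≡⟨ cong (λ z → z + deg W w + deg R w) (trans (sumOn-sing v (α w)) (α-adj (Adj-sym (Wadj w wW)))) ⟩
        suc (f w)                             ∎
        where open ≡-Reasoning
      Σf : ℕ
      Σf = sumOn W f
      count : 2 * m S ≡ 2 * d + Σf + (2 * m R + e N R)
      count = begin
        2 * m S                                                ≡⟨ cong (2 *_) (m-split (nbhd-split S v)) ⟩
        2 * (m N + e N R + m R)                                ≡⟨ cong (λ z → 2 * (z + e N R + m R)) (m-add spv) ⟩
        2 * (deg W v + m W + e N R + m R)                      ≡⟨ cong (λ z → 2 * (z + m W + e N R + m R)) (trans (deg-complete W v Wadj) |W|) ⟩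
        2 * (d + m W + e N R + m R)                            ≡⟨ solve 4 (λ a b c f → con 2 :* (a :+ b :+ c :+ f) := con 2 :* a :+ (con 2 :* b :+ c) :+ (con 2 :* f :+ c)) refl d (m W) (e N R) (m R) ⟩
        2 * d + (2 * m W + e N R) + (2 * m R + e N R)          ≡⟨ cong (λ z → 2 * d + z + (2 * m R + e N R)) (cong₂ _+_ (double-m W) eNR) ⟩
        2 * d + (e W W + e W R) + (2 * m R + e N R)            ≡⟨ cong (λ z → 2 * d + z + (2 * m R + e N R)) (sym (sumOn-+ W (deg W) (deg R))) ⟩
        2 * d + Σf + (2 * m R + e N R)                         ∎
        where
        open ≡-Reasoning
        eNR : e N R ≡ e W R
        eNR = trans (e-splitˡ spv R) (cong (_+ e W R) (trans (e-sing v R) (deg-none R v (λ y yR vy → proj₂ yR (proj₁ yR , inj₂ vy)))))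
      |Y| : 2 + j ≤ card Y
      |Y| = begin
        2 + j      ≡⟨ sym k′≡ ⟩
        k′         ≤⟨ core v vX ⟩
        deg X v    ≤⟨ deg-≤ X Y v (λ y yX vy → ((X⊆ y yX , inj₂ vy) , Adj-irrefl (Adj-sym vy)) , yX) ⟩
        deg Y v    ≤⟨ deg≤card Y v ⟩
        card Y     ∎
        where open ≤-Reasoning
      f-on-Y : ∀ w → w ∈ˢ Y → 1 + j ≤ f w
      f-on-Y w (wW , wX) = ≤-pred (begin
        2 + j      ≡⟨ sym k′≡ ⟩
        k′         ≤⟨ core w wX ⟩
        deg X w    ≤⟨ sumOn-⊆ X S X⊆ ⟩
        deg S w    ≡⟨ deg-f w wW ⟩
        suc (f w)  ∎)
        where open ≤-Reasoning
      3+j≤d : 3 + j ≤ d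
      3+j≤d = subst (λ z → suc z ≤ d) k′≡ k≤d
      D⁺ = v ∷ D
      2τD⁺ : 2 * (τ * length D⁺) ≡ (10 + 5 * j + j * j) + 2 * (τ * length D)
      2τD⁺ = trans (cong (2 *_) (*-suc τ (length D))) (trans (*-distribˡ-+ 2 τ _) (cong (_+ 2 * (τ * length D)) (twice-τ k′≡)))
      2sm : 2 * suc (m S) ≡ 2 + (2 * d + Σf) + (2 * m R + e N R)
      2sm = trans (*-suc 2 (m S)) (cong (2 +_) count)

      -- Every neighbour of `v` now has `f` at least 1, and those in the core at least 1 + j. With
      -- degree at least 3 + j at `v` this exceeds 2τ by one, and a doubled estimate that is strict
      -- by one yields the strict bound.
      no-leaf : (∀ w → w ∈ˢ W → deg S w ≢ 1) → Result S
      no-leaf none = strict D⁺ (isol-nbhd isolate) (halve-< (begin-strict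
        2 * (τ * length D⁺)                              ≡⟨ 2τD⁺ ⟩
        (10 + 5 * j + j * j) + 2 * (τ * length D)        <⟨ n<1+n _ ⟩
        (11 + 5 * j + j * j) + 2 * (τ * length D)        ≡⟨ cong (_+ 2 * (τ * length D)) (solve 1 (λ j → con 11 :+ con 5 :* j :+ j :* j := con 2 :+ (con 2 :* (con 3 :+ j) :+ (j :* (con 2 :+ j) :+ (con 3 :+ j)))) refl j) ⟩
        2 + (2 * (3 + j) + (j * (2 + j) + (3 + j))) + 2 * (τ * length D)
                                                         ≤⟨ +-mono-≤ (+-monoʳ-≤ 2 (+-mono-≤ (*-monoʳ-≤ 2 3+j≤d) Σf-big)) bound ⟩
        2 + (2 * d + Σf) + (2 * m R + e N R)             ≡⟨ sym 2sm ⟩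
        2 * suc (m S)                                    ∎))
        where
        open ≤-Reasoning
        spY : Split W Y (W ∖ Y)
        spY = split-remove W Y (λ _ → proj₁)
        f-pos : ∀ w → w ∈ˢ W → 1 ≤ f w
        f-pos w wW with f w in eq
        ... | zero = contradiction (trans (deg-f w wW) (cong suc eq)) (none w wW)
        ... | suc _ = s≤s z≤n
        Σf-big : j * (2 + j) + (3 + j) ≤ Σf
        Σf-big = begin
          j * (2 + j) + (3 + j)                       ≤⟨ +-mono-≤ (*-monoʳ-≤ j |Y|) (≤-trans 3+j≤d (≤-reflexive (trans (sym |W|) (sumOn-split spY _)))) ⟩
          j * card Y + (card Y + card (W ∖ Y))        ≡⟨ solve 3 (λ j y w → j :* y :+ (y :+ w) := (con 1 :+ j) :* y :+ w) refl j (card Y) (card (W ∖ Y)) ⟩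
          (1 + j) * card Y + card (W ∖ Y)             ≡⟨ cong (_+ card (W ∖ Y)) (sym (sumOn-const Y (1 + j))) ⟩
          sumOn Y (λ _ → 1 + j) + card (W ∖ Y)        ≤⟨ +-mono-≤ (sumOn-mono Y f-on-Y) (sumOn-mono (W ∖ Y) (λ w p → f-pos w (proj₁ p))) ⟩
          sumOn Y f + sumOn (W ∖ Y) f                 ≡⟨ sym (sumOn-split spY f) ⟩
          Σf                                          ∎

      -- Neighbours outside the core may be leaves and contribute nothing here; what remains meets
      -- 2τ exactly, with no slack.
      Σf-min : (1 + j) * (2 + j) ≤ Σf
      Σf-min = begin
        (1 + j) * (2 + j)          ≤⟨ *-monoʳ-≤ (1 + j) |Y| ⟩
        (1 + j) * card Y           ≡⟨ sym (sumOn-const Y (1 + j)) ⟩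
        sumOn Y (λ _ → 1 + j)      ≤⟨ sumOn-mono Y f-on-Y ⟩
        sumOn Y f                  ≤⟨ sumOn-⊆ Y W (λ _ → proj₁) ⟩
        Σf                         ∎
        where open ≤-Reasoning

      low : (10 + 5 * j + j * j) + 2 * (τ * length D) ≡ 2 + (2 * (3 + j) + (1 + j) * (2 + j)) + 2 * (τ * length D)
      low = cong (_+ 2 * (τ * length D)) (solve 1 (λ j → con 10 :+ con 5 :* j :+ j :* j := con 2 :+ (con 2 :* (con 3 :+ j) :+ (con 1 :+ j) :* (con 2 :+ j))) refl j)

      front : 2 + (2 * (3 + j) + (1 + j) * (2 + j)) ≤ 2 + (2 * d + Σf)
      front = +-monoʳ-≤ 2 (+-mono-≤ (*-monoʳ-≤ 2 3+j≤d) Σf-min)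

      byLeaf : (∃[ w ] (w ∈ˢ W × deg S w ≡ 1)) ⊎ (∀ w → w ∈ˢ W → deg S w ≢ 1) → Done ⊎ (Leaf v × HasSquare v)
      byLeaf (inj₂ none) = inj₁ (inj₁ (no-leaf none))
      byLeaf (inj₁ (z , zW , dz≡1)) with m≤n⇒m<n∨m≡n (+-mono-≤ front bound)
      ... | inj₁ lt = inj₁ (inj₁ (strict D⁺ (isol-nbhd isolate) (halve-< (≤-trans (≤-reflexive (cong suc (trans 2τD⁺ low))) (≤-trans lt (≤-reflexive (sym 2sm)))))))
      ... | inj₂ eq with +-≡-split front bound eq
      ...   | eq₁ , eq₂ with if-tight eq₂
      ...     | inj₂ sq = inj₂ ((z , proj₁ (proj₁ zW) , Wadj z zW , dz≡1) , sq)
      ...     | inj₁ none = inj₁ (inj₂ (X , small-core-clique X core vX X-small , X⊆))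
        where
        d≡ : 3 + j ≡ d
        d≡ = *-cancelˡ-≡ _ _ 2 (proj₁ (+-≡-split (*-monoʳ-≤ 2 3+j≤d) Σf-min (+-cancelˡ-≡ 2 _ _ eq₁)))
        z∉X : z ∉ˢ X
        z∉X zX = contradiction (≤-trans (core z zX) (≤-trans (sumOn-⊆ X S X⊆) (≤-reflexive dz≡1))) (<⇒≱ (≤-trans (s≤s (s≤s z≤n)) (≤-reflexive (sym k′≡))))
        X⊆N : X ⊆ˢ N ─ z
        X⊆N y yX with Split.cover (nbhd-split S v) y (X⊆ y yX)
        ... | inj₁ yN = yN , λ { refl → z∉X yX }
        ... | inj₂ yR = ⊥-elim (none y yR)
        X-small : card X ≤ k
        X-small = ≤-trans (card-⊆ X (N ─ z) X⊆N) (≤-reflexive (suc-injective (begin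
          suc (card (N ─ z))   ≡⟨ sym (card-remove N (proj₁ zW)) ⟩
          card N               ≡⟨ nbhd-card S vS ⟩
          suc d                ≡⟨ cong suc (sym d≡) ⟩
          4 + j                ≡⟨ cong (2 +_) (sym k′≡) ⟩
          suc k                ∎)))
          where open ≡-Reasoning

    large-core-case : ∀ {X v} → X ⊆ˢ S → Core X → v ∈ˢ X → k ≤ deg S v → Done
    large-core-case {X} {v} X⊆ core vX k≤d with core-centre X⊆ core vX k≤d
    ... | inj₁ r = r
    ... | inj₂ (_ , J , cJ , k≡3 , io) with comp-edge cS (nbhd-split S v) (X⊆ v vX , inj₁ refl) cJ
    -- The square `J` is itself a core for k = 3, and the edge to `a` raises the degree of `z` to 3,
    -- so the same analysis applies at `z`.
    ...   | a , z , aN , zJ , az with core-centre {J} {z} J⊆ (λ y yJ → ≤-reflexive (trans (suc-injective k≡3) (sym (square-deg io yJ)))) zJ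
              (≤-trans (≤-reflexive k≡3) (begin
                3                             ≡⟨⟩
                2 + 1                         ≤⟨ +-mono-≤ (≤-reflexive (sym (square-deg io zJ))) (deg-at (S ∖ J) (proj₁ aN , a∉J) (Adj-sym az)) ⟩
                deg J z + deg (S ∖ J) z       ≡⟨ sym (deg-split (split-remove S J J⊆) z) ⟩
                deg S z                       ∎))
      where
      open ≤-Reasoning
      J⊆ : J ⊆ˢ S
      J⊆ y p = proj₁ (sub cJ y p)
      a∉J : a ∉ˢ J
      a∉J p = proj₂ (sub cJ a p) aN
    ...     | inj₁ r = r
    -- A leaf at `z` cannot exist: a neighbour of `z` outside N[v] is in `J` and has degree 2 there,
    -- and one in N[v] is a neighbour of both `v` and `z`.
    ...     | inj₂ ((y , yS , zy , dy≡1) , _) = ⊥-elim (<⇒≱ (2≤dy (mem? J y)) (≤-reflexive dy≡1))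
      where
      J⊆ : J ⊆ˢ S
      J⊆ w p = proj₁ (sub cJ w p)
      z∉N : z ∉ˢ nbhd S v
      z∉N = proj₂ (sub cJ z zJ)
      2≤dy : Dec (y ∈ˢ J) → 2 ≤ deg S y
      2≤dy (yes yJ) = ≤-trans (≤-reflexive (sym (square-deg io yJ))) (sumOn-⊆ J S J⊆)
      2≤dy (no y∉J) with Split.cover (nbhd-split S v) y yS
      ... | inj₂ yR = contradiction (closed cJ z y zJ yR zy) y∉J
      ... | inj₁ (_ , inj₁ refl) = contradiction (J⊆ z zJ , inj₂ (Adj-sym zy)) z∉N
      ... | inj₁ (_ , inj₂ vy) = deg-two S (X⊆ v vX) (J⊆ z zJ) (λ { refl → z∉N (J⊆ z zJ , inj₁ refl) }) (Adj-sym vy) (Adj-sym zy)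

  core-case : ∀ {S X v} → Conn S → (∀ H → card H < card S → Conn H → Result H) →
    X ⊆ˢ S → Core X → v ∈ˢ X → k ≤ deg S v → Result S ⊎ HasClique S
  core-case {S} {X} {v} cS IH X⊆ core vX k≤d = byDegree k′ refl
    where
    byDegree : ∀ j → k′ ≡ j → Result S ⊎ HasClique S
    -- For k = 1 a vertex, and for k = 2 an edge of the core, already is a k-clique.
    byDegree zero eq = inj₂ (sing v , record { size = trans (card-sing v) (cong suc (sym eq)) ; pairwise = λ { _ _ refl refl ne → contradiction refl ne } }
                            , λ { _ refl → X⊆ v vX })
    byDegree (suc zero) eq with deg-find X v (≤-trans (≤-reflexive (sym eq)) (core v vX))
    ... | y , yX , vy = inj₂ (sing v ∪ˢ sing y , record
            { size = trans (card-add (sing v) (Adj-irrefl (Adj-sym vy))) (trans (cong suc (card-sing v)) (cong suc (sym eq)))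
            ; pairwise = λ { _ _ (inj₁ refl) (inj₁ refl) ne → contradiction refl ne
                           ; _ _ (inj₁ refl) (inj₂ refl) _ → vy
                           ; _ _ (inj₂ refl) (inj₁ refl) _ → Adj-sym vy
                           ; _ _ (inj₂ refl) (inj₂ refl) ne → contradiction refl ne } }
            , λ { _ (inj₁ refl) → X⊆ v vX ; _ (inj₂ refl) → X⊆ y yX })
    byDegree (suc (suc j)) eq = large-core-case cS IH eq X⊆ core vX k≤d

  classify-step : ∀ S → (∀ H → card H < card S → Conn H → Result H) → Conn S → Result S
  classify-step S IH cS with core? S
  ... | inj₁ iso = strict [] iso (≤-trans (≤-reflexive (*-zeroʳ τ)) z≤n)
  ... | inj₂ (X , X⊆ , core , x , xX) with find X (λ y → k ≤? deg S y)
  ...   | inj₂ low = regular-case cS (λ y yS → ≤-antisym (low′ y (S⊆ y yS)) (≤-trans (core y (S⊆ y yS)) (sumOn-⊆ X S X⊆)))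
    where
    low′ : ∀ y → y ∈ˢ X → deg S y ≤ k′
    low′ y yX = ≤-pred (≰⇒> (low y yX))
    S⊆ : S ⊆ˢ X
    S⊆ = core-in-regular cS X⊆ core low′ xX
  ...   | inj₁ (v , vX , k≤d) with core-case cS IH X⊆ core vX k≤d
  ...     | inj₁ r = r
  ...     | inj₂ (Q , cl , Q⊆) = clique-case cS IH cl Q⊆

  classify : ∀ S → Conn S → Result S
  classify S₀ = go (suc (card S₀)) S₀ ≤-refl
    where
    go : ∀ fuel S → card S < fuel → Conn S → Result S
    go (suc fuel) S lt = classify-step S (λ H H<S → go fuel H (≤-trans H<S (≤-pred lt)))

-- From cores to the graph classes and to subsets

∣p∣≡∑ : ∀ {n} (p : Subset n) → Sub.∣ p ∣ ≡ ∑ (λ x → χ (lookup p x))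
∣p∣≡∑ [] = refl
∣p∣≡∑ (true ∷ p) = cong suc (∣p∣≡∑ p)
∣p∣≡∑ (false ∷ p) = ∣p∣≡∑ p

ofSubset : ∀ {n} → Subset n → DSet n
ofSubset p = ⟨ Sub._∈ p , _∈? p ⟩

toSubset : ∀ {n} → DSet n → Subset n
toSubset A = tabulate (λ x → does (mem? A x))

opaque
  unfolding sumOn

  card-ofSubset : ∀ {n} (p : Subset n) → card (ofSubset p) ≡ Sub.∣ p ∣
  card-ofSubset p = trans (∑-cong pt) (sym (∣p∣≡∑ p))
    where
    pt : ∀ x → χ (does (x ∈? p)) * 1 ≡ χ (lookup p x)
    pt x with x ∈? p | lookup p x in eq
    ... | yes q | _ rewrite trans (sym eq) ([]=⇒lookup q) = refl
    ... | no ¬q | true = contradiction (lookup⇒[]= x p eq) ¬q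
    ... | no ¬q | false = refl

  card-toSubset : ∀ {n} (A : DSet n) → Sub.∣ toSubset A ∣ ≡ card A
  card-toSubset A = trans (∣p∣≡∑ (toSubset A))
    (∑-cong (λ x → trans (cong χ (lookup∘tabulate (λ y → does (mem? A y)) x)) (sym (*-identityʳ _))))

∈-toSubset : ∀ {n} (A : DSet n) {x} → x ∈ˢ A → x Sub.∈ toSubset A
∈-toSubset A {x} p = lookup⇒[]= x (toSubset A) (trans (lookup∘tabulate (λ y → does (mem? A y)) x) yes!)
  where
  yes! : does (mem? A x) ≡ true
  yes! with mem? A x
  ... | yes _ = refl
  ... | no ¬p = contradiction p ¬p

members : ∀ {n} → List (Fin n) → DSet n
members D = ⟨ _∈ₗ D , (λ x → DecMembership._∈?_ Fin._≟_ x D) ⟩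

degree-mono : ∀ {h n} (H : Graph h) (G : Graph n) (f : Fin h → Fin n) → (∀ a b → Edge H a b → Edge G (f a) (f b)) →
  ∀ a b → χ (adj H a b) ≤ χ (adj G (f a) (f b))
degree-mono H G f hom a b with adj H a b in eq
... | false = z≤n
... | true rewrite hom a b eq = ≤-refl

K-adj : ∀ {k} (a b : Fin k) → a ≢ b → adj (K k) a b ≡ true
K-adj a b ne with a Fin.≟ b
... | yes q = contradiction q ne
... | no _ = refl

K-degree : ∀ {k} (a : Fin (suc k)) → degree (K (suc k)) a ≡ k
K-degree {k} a = suc-injective (begin
  suc (degree (K (suc k)) a)    ≡⟨ cong suc (sym (deg-full a)) ⟩
  suc (deg full a)              ≡⟨ cong suc (trans (deg-remove-self full) (deg-complete (full ─ a) a (λ b q → K-adj a b (proj₂ q ∘ sym)))) ⟩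
  suc (card (full ─ a))         ≡⟨ sym (card-remove full tt) ⟩
  card (full {suc k})           ≡⟨ card-full (suc k) ⟩
  suc k                         ∎)
  where
  open ≡-Reasoning
  open InGraph (K (suc k))

K-chromatic : ∀ {k} → ChromaticAtLeast k (K k)
K-chromatic c c<k (f , proper) with pigeonhole c<k f
... | i , j , i<j , eq = proper i j (K-adj i j (λ { refl → <-irrefl refl i<j })) eq

K∈𝓕 : ∀ k {ℓ} → ℓ ≡ 1 ⊎ ℓ ≡ 2 ⊎ ℓ ≡ 3 → 𝓕 ℓ (suc k) (K (suc k))
K∈𝓕 k (inj₁ refl) = s≤s z≤n , k , ≤-refl , K-degree
K∈𝓕 k (inj₂ (inj₁ refl)) = K-chromatic
K∈𝓕 k (inj₂ (inj₂ refl)) = inj₁ (s≤s z≤n , k , ≤-refl , K-degree)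

module Transfer {n : ℕ} (G : Graph n) (k′ : ℕ) where

  open InGraph G
  open Isolation G k′
  open OffCentre G k′
  open CoreCase G k′

  -- A graph without a core is (k-2)-degenerate, so the greedy algorithm needs only k - 1 colours.
  greedy : Fin k′ → ∀ R → Isol [] R → Σ[ f ∈ (Fin n → Fin k′) ] (∀ x y → x ∈ˢ R → y ∈ˢ R → Adj x y → f x ≢ f y)
  greedy c₀ R₀ = go (card R₀) R₀ ≤-refl
    where
    go : ∀ fuel R → card R ≤ fuel → Isol [] R → Σ[ f ∈ (Fin n → Fin k′) ] (∀ x y → x ∈ˢ R → y ∈ˢ R → Adj x y → f x ≢ f y)
    go fuel R le iso with find R (λ x → suc (deg R x) ≤? k′)
    ... | inj₂ high = (λ _ → c₀) , λ x y xR → ⊥-elim (no-core iso R (λ _ → id) (λ _ _ ()) (λ y yR → ≤-pred (≰⇒> (high y yR))) x xR)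
    go zero R le iso | inj₁ (x , xR , _) = contradiction (≤-trans (card-positive R xR) le) λ ()
    go (suc fuel) R le iso | inj₁ (x , xR , low)
      with go fuel (R ─ x) (≤-pred (subst (_≤ suc fuel) (card-remove R xR) le)) (isol-mono id (λ _ → proj₁) iso)
    ... | f , proper with any? (λ c → ¬? (any? (λ y → mem? R y ×-dec adj? x y ×-dec (f y Fin.≟ c))))
    -- Choosing a neighbour for each of the k - 1 colours is injective, so `x` would have degree at
    -- least k - 1.
    ...   | no all-used = contradiction k′≤d (<⇒≱ low)
      where
      used : ∀ c → ∃[ y ] (y ∈ˢ R × Adj x y × f y ≡ c)
      used c = decidable-stable (any? (λ y → mem? R y ×-dec adj? x y ×-dec (f y Fin.≟ c))) (λ ¬u → all-used (c , ¬u))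
      N : DSet n
      N = ⟨ (λ y → y ∈ˢ R × Adj x y) , (λ y → mem? R y ×-dec adj? x y) ⟩
      k′≤d : k′ ≤ deg R x
      k′≤d = begin
        k′         ≤⟨ injection-card N (proj₁ ∘ used) (λ {a} {b} q → trans (sym (proj₂ (proj₂ (proj₂ (used a))))) (trans (cong f q) (proj₂ (proj₂ (proj₂ (used b))))))
                        (λ c → proj₁ (proj₂ (used c)) , proj₁ (proj₂ (proj₂ (used c)))) ⟩
        card N     ≡⟨ sym (deg-complete N x (λ y → proj₂)) ⟩
        deg N x    ≤⟨ sumOn-⊆ N R (λ y → proj₁) ⟩
        deg R x    ∎
        where open ≤-Reasoning
    ...   | yes (c , free) = g , proper′
      where
      g : Fin n → Fin k′
      g y = if does (y Fin.≟ x) then c else f y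
      g-x : g x ≡ c
      g-x with x Fin.≟ x
      ... | yes _ = refl
      ... | no ne = contradiction refl ne
      g-other : ∀ {y} → y ≢ x → g y ≡ f y
      g-other {y} ne with y Fin.≟ x
      ... | yes q = contradiction q ne
      ... | no _ = refl
      clash : ∀ y → y ∈ˢ R → Adj x y → g x ≢ g y
      clash y yR xy eq = free (y , yR , xy , trans (sym (g-other (Adj-irrefl (Adj-sym xy)))) (trans (sym eq) g-x))
      proper′ : ∀ a b → a ∈ˢ R → b ∈ˢ R → Adj a b → g a ≢ g b
      proper′ a b aR bR ab = cases (a Fin.≟ x) (b Fin.≟ x)
        where
        cases : Dec (a ≡ x) → Dec (b ≡ x) → g a ≢ g b
        cases (yes refl) _ = clash b bR ab
        cases (no _) (yes refl) = clash a aR (Adj-sym ab) ∘ sym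
        cases (no a≢) (no b≢) eq = proper a b (aR , a≢) (bR , b≢) ab (trans (sym (g-other a≢)) (trans eq (g-other b≢)))

  hit? : ∀ D x → Dec (Hit D x)
  hit? D x = Any.any? (λ d → (x Fin.≟ d) ⊎-dec adj? d x) D

  unhit : List (Fin n) → DSet n
  unhit D = ⟨ (λ x → ¬ Hit D x) , (λ x → ¬? (hit? D x)) ⟩

  unhit-free : ∀ {D} → Isol D full → Isol [] (unhit D)
  unhit-free iso = isol λ X X⊆ _ → no-core iso X (λ _ _ → tt) X⊆

  module _ {D : List (Fin n)} (iso : Isol D full) {h} (H : Graph h) (em : Embedding H G) (avoid : ∀ a → ¬ Hit D (proj₁ em a)) where

    private
      f = proj₁ em
      f-inj = proj₁ (proj₂ em)
      hom = proj₂ (proj₂ em)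

    not-regular : ¬ 𝓕₁ k H
    not-regular (1≤h , d , k′≤d , reg) = no-core iso X (λ _ _ → tt) (λ { _ (a , refl) → avoid a }) core (f a₀) (a₀ , refl)
      where
      a₀ = fromℕ< 1≤h
      X : DSet n
      X = ⟨ (λ x → ∃[ a ] (x ≡ f a)) , (λ x → any? (λ a → x Fin.≟ f a)) ⟩
      core : Core X
      core x (a , refl) = begin
        k′                          ≤⟨ k′≤d ⟩
        d                           ≡⟨ sym (reg a) ⟩
        degree H a                  ≤⟨ ∑-mono (degree-mono H G f hom a) ⟩
        ∑ (λ b → α (f a) (f b))     ≤⟨ ∑-image-≤ X f f-inj (λ b → b , refl) (α (f a)) ⟩
        deg X (f a)                 ∎
        where open ≤-Reasoning

    not-chromatic : ¬ 𝓕₂ k H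
    not-chromatic chrom = chrom k′ ≤-refl (colouring k′ refl)
      where
      colouring : ∀ j → k′ ≡ j → Colourable k′ H
      -- For k = 1 there are no colours and greedy colouring has no default. But then every set is a
      -- core, so no vertex escapes `D` and `H` is empty.
      colouring zero eq = (λ a → ⊥-elim (empty a)) , (λ a → ⊥-elim (empty a))
        where
        empty : Fin h → ⊥
        empty a = no-core (unhit-free iso) (unhit D) (λ _ → id) (λ _ _ ()) (λ x _ → ≤-trans (≤-reflexive eq) z≤n) (f a) (avoid a)
      colouring (suc j) eq with greedy (subst Fin (sym eq) zero) (unhit D) (unhit-free iso)
      ... | g , proper = g ∘ f , λ a b ab → proper (f a) (f b) (avoid a) (avoid b) (hom a b ab)

  card-members : ∀ D → card (members D) ≤ length D
  card-members [] = ≤-reflexive (sumOn-∅ (members []) _ (λ _ ()))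
  card-members (d ∷ D) = ≤-trans (card-⊆ (members (d ∷ D)) (members D ∪ˢ sing d) (λ { _ (here q) → inj₂ q ; _ (there q) → inj₁ q }))
    (≤-trans (card-add-≤ (members D) d) (s≤s (card-members D)))

  isolating : ∀ {D ℓ} → Isol D full → ℓ ≡ 1 ⊎ ℓ ≡ 2 ⊎ ℓ ≡ 3 → Isolating G (𝓕 ℓ k) (toSubset (members D))
  isolating {D} iso which H em avoid = member which
    where
    hit : ∀ {x} → Hit D x → InClosedNbhd G (toSubset (members D)) x
    hit p with find-any p
    ... | d , dD , q = d , ∈-toSubset (members D) dD , q
    member : ∀ {ℓ} → ℓ ≡ 1 ⊎ ℓ ≡ 2 ⊎ ℓ ≡ 3 → ¬ 𝓕 ℓ k H
    member (inj₁ refl) = not-regular iso H em (λ a → avoid a ∘ hit)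
    member (inj₂ (inj₁ refl)) = not-chromatic iso H em (λ a → avoid a ∘ hit)
    member (inj₂ (inj₂ refl)) = [ not-regular iso H em (λ a → avoid a ∘ hit) , not-chromatic iso H em (λ a → avoid a ∘ hit) ]′

  iota-≤ : ∀ {D ℓ i} → Isol D full → ℓ ≡ 1 ⊎ ℓ ≡ 2 ⊎ ℓ ≡ 3 → IsIota G (𝓕 ℓ k) i → i ≤ length D
  iota-≤ {D} iso which iota = ≤-trans (proj₂ iota (toSubset (members D)) (isolating iso which))
    (≤-trans (≤-reflexive (card-toSubset (members D))) (card-members D))

  -- The complete graph on k vertices belongs to all three classes, so no copy of it may avoid the
  -- closed neighbourhood of `D`.
  clique-met : ∀ {ℓ} (D : Subset n) → ℓ ≡ 1 ⊎ ℓ ≡ 2 ⊎ ℓ ≡ 3 → Isolating G (𝓕 ℓ k) D → (U : Fin k → Fin n) → Injective _≡_ _≡_ U →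
    (∀ a b → a ≢ b → Adj (U a) (U b)) → ∃[ d ] (d Sub.∈ D × ∃[ a ] (U a ≡ d ⊎ Adj d (U a)))
  clique-met D which iso U inj pw with any? (λ d → (d ∈? D) ×-dec any? (λ a → (U a Fin.≟ d) ⊎-dec adj? d (U a)))
  ... | yes p = p
  ... | no ¬p = contradiction (K∈𝓕 k′ which) (iso (K k) (U , inj , (λ a b ab → pw a b (InGraph.Adj-irrefl (K k) ab)))
                  (λ { a (d , dD , q) → ¬p (d , dD , a , q) }))

  conn-full : Connected G → Conn full
  conn-full (1≤n , reach) = record { inhabited = fromℕ< 1≤n , tt ; spread = λ X {x} _ Xx cl y _ → along X cl Xx (reach x y) }
    where
    along : ∀ (X : Fin n → Set) → (∀ a b → ⊤ → ⊤ → X a → Adj a b → X b) → ∀ {x y} → X x → Reach G x y → X y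
    along X cl Xx here = Xx
    along X cl Xx (step p r) = along X cl (cl _ _ tt tt Xx p) r

  iso-from : ∀ {h} {H : Graph h} → IsoOn H full → Iso G H
  iso-from io = mk↔ₛ′ (λ x → proj₁ (emb-onto x tt)) emb (λ a → sym (emb-inj (proj₂ (emb-onto (emb a) tt)))) (λ x → sym (proj₂ (emb-onto x tt)))
              , λ a b → trans (cong₂ (adj G) (proj₂ (emb-onto a tt)) (proj₂ (emb-onto b tt))) (emb-adj _ _)
    where open IsoOn io

  iso-to : ∀ {h} {H : Graph h} → Iso G H → IsoOn H full
  iso-to {H = H} (φ , same) = record
    { emb = from ; emb-inj = λ {a} {b} q → trans (sym (inverseˡ′ a)) (trans (cong to q) (inverseˡ′ b))
    ; emb-∈ = λ _ → tt ; emb-onto = λ x _ → to x , sym (inverseʳ′ x)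
    ; emb-adj = λ a b → trans (same _ _) (cong₂ (adj H) (inverseˡ′ a) (inverseˡ′ b)) }
    where
    open Inverse φ using (to; from; inverseˡ; inverseʳ)
    inverseˡ′ : ∀ a → to (from a) ≡ a
    inverseˡ′ a = inverseˡ refl
    inverseʳ′ : ∀ x → from (to x) ≡ x
    inverseʳ′ x = inverseʳ refl

  iso-clique : Clique full → Iso G (K k)
  iso-clique cl = iso-from {H = K k} (record { emb = enum ; emb-inj = enum-inj ; emb-∈ = enum-∈ ; emb-onto = enum-onto ; emb-adj = same })
    where
    open Enumeration (enumerate k full (Clique.size cl))
    same : ∀ a b → adj G (enum a) (enum b) ≡ adj (K k) a b
    same a b with a Fin.≟ b
    ... | yes refl = loopless G (enum a)
    ... | no ne = Clique.pairwise cl _ _ tt tt (ne ∘ enum-inj)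

-- Neighbours on a cycle

≡ᵇ-true : ∀ {a b} → a ≡ b → (a ≡ᵇ b) ≡ true
≡ᵇ-true {a} {b} eq with a ≡ᵇ b | ≡⇒≡ᵇ a b eq
... | true | _ = refl

cyc-edge : ∀ {j} (a b : Fin (3 + j)) → a ≢ b → suc (toℕ a) % (3 + j) ≡ toℕ b → Edge (Cyc j) a b
cyc-edge {j} a b ne eq with a Fin.≟ b
... | yes q = contradiction q ne
... | no _ rewrite ≡ᵇ-true eq = refl

cyc-prev : ∀ {j} (a : Fin (2 + j)) → Edge (Cyc j) (suc a) (inject₁ a)
cyc-prev {j} a = trans (adjSym (Cyc j) (suc a) (inject₁ a)) (cyc-edge {j} (inject₁ a) (suc a)
  (λ q → contradiction (trans (sym (toℕ-inject₁ a)) (cong toℕ q)) (<⇒≢ (n<1+n _)))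
  (trans (cong (λ z → suc z % (3 + j)) (toℕ-inject₁ a)) (m<n⇒m%n≡m (s≤s (toℕ<n a)))))

-- Successor and predecessor; the first vertex and the last one wrap around. They differ because a
-- cycle has at least three vertices.
cyc-two : ∀ {j} (a : Fin (3 + j)) → ∃[ b ] ∃[ c ] (c ≢ b × Edge (Cyc j) a b × Edge (Cyc j) a c)
cyc-two {j} zero = suc zero , fromℕ (2 + j) , (λ ())
  , cyc-edge {j} zero (suc zero) (λ ()) (m<n⇒m%n≡m {n = 3 + j} {m = 1} (s≤s (s≤s z≤n)))
  , trans (adjSym (Cyc j) zero (fromℕ (2 + j))) (cyc-edge {j} (fromℕ (2 + j)) zero (λ ()) (trans (cong (λ z → suc z % (3 + j)) (toℕ-fromℕ (2 + j))) (n%n≡0 (3 + j))))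
cyc-two {j} (suc a) with suc (toℕ (suc a)) <? 3 + j
... | yes lt = fromℕ< lt , inject₁ a
    , (λ q → contradiction (trans (sym (toℕ-inject₁ a)) (trans (cong toℕ q) (toℕ-fromℕ< lt))) (<⇒≢ (m<n⇒m<1+n (n<1+n (toℕ a)))))
    , cyc-edge {j} (suc a) (fromℕ< lt) (λ q → contradiction (trans (cong toℕ q) (toℕ-fromℕ< lt)) (<⇒≢ (n<1+n _))) (trans (m<n⇒m%n≡m lt) (sym (toℕ-fromℕ< lt)))
    , cyc-prev a
... | no ≮ = zero , inject₁ a
    , (λ q → contradiction (trans (sym (suc-injective (suc-injective last))) (trans (sym (toℕ-inject₁ a)) (cong toℕ q))) λ ())
    , cyc-edge {j} (suc a) zero (λ ()) (trans (cong (_% (3 + j)) last) (n%n≡0 (3 + j)))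
    , cyc-prev a
  where
  last : suc (toℕ (suc a)) ≡ 3 + j
  last = ≤-antisym (s≤s (toℕ<n a)) (≮⇒≥ ≮)

-- Lower bounds for the extremal graphs

module Lower {n : ℕ} (G : Graph n) (k′ ℓ : ℕ) (which : ℓ ≡ 1 ⊎ ℓ ≡ 2 ⊎ ℓ ≡ 3) where

  open InGraph G
  open Isolation G k′
  open OffCentre G k′
  open Hub G k′
  open Transfer G k′

  -- The sets U_i ∪ {v_i} are disjoint, and each of them contains the closed neighbourhood of U_i.
  special-lower : ∀ {q′ r} → SpecialStruct k q′ r G → ∀ D → Isolating G (𝓕 ℓ k) D → suc q′ ≤ Sub.∣ D ∣
  special-lower {q′} st D iso = ≤-trans (injection-card (ofSubset D) d d-inj (λ i → proj₁ (proj₂ (met i)))) (≤-reflexive (card-ofSubset D))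
    where
    open SpecialStruct st
    met : ∀ i → ∃[ d ] (d Sub.∈ D × ∃[ a ] (U i a ≡ d ⊎ Adj d (U i a)))
    met i = clique-met D which iso (U i) (λ {a} {b} q → proj₂ (U-inj i a i b q))
      (λ a b ne → edges-complete _ _ (inj₂ (inj₂ (inj₁ (i , a , b , refl , refl , ne)))))
    d : Fin (suc q′) → Fin n
    d i = proj₁ (met i)
    owner : ∀ i → d i ≡ v i ⊎ ∃[ a ] (d i ≡ U i a)
    owner i with proj₂ (proj₂ (met i))
    ... | a , inj₁ q = inj₂ (a , sym q)
    ... | a , inj₂ p with edges-sound _ _ p
    ...   | inj₁ (_ , b , _ , q , _) = contradiction (sym q) (vU-disj b i a)
    ...   | inj₂ (inj₁ (_ , b , _ , q , _)) = contradiction (sym q) (w-U b i a)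
    ...   | inj₂ (inj₂ (inj₁ (i′ , a′ , b′ , q , q′ , _))) with U-inj i a i′ b′ q′
    ...     | refl , _ = inj₂ (a′ , q)
    owner i | a , inj₂ p | inj₂ (inj₂ (inj₂ (i′ , inj₁ (_ , q)))) = contradiction (sym q) (vU-disj i′ i a)
    owner i | a , inj₂ p | inj₂ (inj₂ (inj₂ (i′ , inj₂ (q , q′)))) with U-inj i a i′ (u1 i′) q′
    ...     | refl , _ = inj₁ q
    d-inj : Injective _≡_ _≡_ d
    d-inj {i} {i′} eq with owner i | owner i′
    ... | inj₁ q | inj₁ q′ = v-inj (trans (sym q) (trans eq q′))
    ... | inj₁ q | inj₂ (a , q′) = contradiction (trans (sym q) (trans eq q′)) (vU-disj i i′ a)
    ... | inj₂ (a , q) | inj₁ q′ = contradiction (trans (sym q′) (trans (sym eq) q)) (vU-disj i′ i a)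
    ... | inj₂ (a , q) | inj₂ (b , q′) = proj₁ (U-inj i a i′ b (trans (sym q) (trans eq q′)))

  opaque
    C5-far-edge : ∀ a → ∃[ b ] ∃[ c ] (adj C5 b c ≡ true × b ≢ a × c ≢ a × adj C5 a b ≢ true × adj C5 a c ≢ true)
    C5-far-edge = from-yes (all? λ a → any? λ b → any? λ c → (adj C5 b c Bool.≟ true) ×-dec ¬? (b Fin.≟ a) ×-dec ¬? (c Fin.≟ a)
      ×-dec ¬? (adj C5 a b Bool.≟ true) ×-dec ¬? (adj C5 a c Bool.≟ true))

  -- The edge opposite to the first chosen vertex avoids its closed neighbourhood and needs another
  -- one.
  pentagon-lower : k ≡ 2 → IsoOn C5 full → ∀ D → Isolating G (𝓕 ℓ k) D → 2 ≤ Sub.∣ D ∣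
  pentagon-lower refl io D iso = bound
    where
    open IsoOn io renaming (emb to f)
    met : ∀ b c → adj C5 b c ≡ true → ∃[ d ] (d Sub.∈ D × ((f b ≡ d ⊎ Adj d (f b)) ⊎ (f c ≡ d ⊎ Adj d (f c))))
    met b c bc with clique-met D which iso U inj pw
      where
      fbc : Adj (f b) (f c)
      fbc = trans (emb-adj b c) bc
      U : Fin 2 → Fin n
      U zero = f b
      U (suc zero) = f c
      inj : Injective _≡_ _≡_ U
      inj {zero} {zero} _ = refl
      inj {zero} {suc zero} q = contradiction q (Adj-irrefl fbc)
      inj {suc zero} {zero} q = contradiction (sym q) (Adj-irrefl fbc)
      inj {suc zero} {suc zero} _ = refl
      pw : ∀ a b → a ≢ b → Adj (U a) (U b)
      pw zero zero ne = contradiction refl ne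
      pw zero (suc zero) _ = fbc
      pw (suc zero) zero _ = Adj-sym fbc
      pw (suc zero) (suc zero) ne = contradiction refl ne
    ... | d , dD , zero , q = d , dD , inj₁ q
    ... | d , dD , suc zero , q = d , dD , inj₂ q
    away : ∀ {a b d} → b ≢ a → adj C5 a b ≢ true → f b ≡ d ⊎ Adj d (f b) → d ≢ f a
    away b≢a ¬ab (inj₁ q) refl = b≢a (emb-inj q)
    away b≢a ¬ab (inj₂ p) refl = ¬ab (trans (sym (emb-adj _ _)) p)
    bound : 2 ≤ Sub.∣ D ∣
    bound with met zero (suc zero) refl
    ... | d , dD , _ with emb-onto d tt
    ...   | a , refl with C5-far-edge a
    ...     | b , c , bc , b≢a , c≢a , ¬ab , ¬ac with met b c bc
    ...       | d′ , d′D , q = ≤-trans (card-two (ofSubset D) dD d′D ([ away b≢a ¬ab , away c≢a ¬ac ]′ q)) (≤-reflexive (card-ofSubset D))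

  -- The 4-cycle is itself a regular graph of degree 2, so the empty set does not isolate it.
  square-lower : k ≡ 3 → ℓ ≡ 1 ⊎ ℓ ≡ 3 → IsoOn C4 full → ∀ D → Isolating G (𝓕 ℓ k) D → 1 ≤ Sub.∣ D ∣
  square-lower refl ℓ13 io D iso with any? (_∈? D)
  ... | yes (d , dD) = ≤-trans (card-positive (ofSubset D) dD) (≤-reflexive (card-ofSubset D))
  ... | no none = contradiction (member ℓ13) (iso C4 (f , emb-inj , λ a b ab → trans (emb-adj a b) ab) (λ { a (d , dD , _) → none (d , dD) }))
    where
    open IsoOn io renaming (emb to f)
    member : ∀ {ℓ} → ℓ ≡ 1 ⊎ ℓ ≡ 3 → 𝓕 ℓ 3 C4
    member (inj₁ refl) = s≤s z≤n , 2 , ≤-refl , C4-degree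
    member (inj₂ refl) = inj₁ (s≤s z≤n , 2 , ≤-refl , C4-degree)

opaque
  C4-colouring : Σ[ col ∈ (Fin 4 → Fin 2) ] (∀ a b → adj C4 a b ≡ true → col a ≢ col b)
  C4-colouring = lookup (zero ∷ suc zero ∷ zero ∷ suc zero ∷ [])
    , from-yes (all? λ a → all? λ b → (adj C4 a b Bool.≟ true) →-dec ¬? (lookup (zero ∷ suc zero ∷ zero ∷ suc zero ∷ []) a Fin.≟ lookup (zero ∷ suc zero ∷ zero ∷ suc zero ∷ []) b))

-- Excludes ℓ = 2 from the case of the 4-cycle: every subgraph inherits a proper colouring with two
-- colours, so the empty set isolates.
square-bipartite : ∀ {n i} {G : Graph n} → Iso G C4 → IsIota G (𝓕 2 3) i → i ≡ 0
square-bipartite {n} {i} {G} (φ , same) iota = n≤0⇒n≡0 (≤-trans (proj₂ iota Sub.⊥ iso) (≤-reflexive (∣⊥∣≡0 n)))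
  where
  open Inverse φ using (to)
  iso : Isolating G (𝓕 2 3) Sub.⊥
  iso H (f , _ , hom) _ chrom = chrom 2 ≤-refl ((λ a → proj₁ C4-colouring (to (f a))) ,
    λ a b ab → proj₂ C4-colouring _ _ (trans (sym (same _ _)) (hom a b ab)))

-- Constructing a pure special graph from its constituents

module Build {n : ℕ} (G : Graph n) (k′ : ℕ) where

  open InGraph G
  open Isolation G k′

  -- S has fewer edges than vertices, whereas a cycle in S would account for as many edges as vertices.
  tree-acyclic : ∀ {S} → Conn S → suc (m S) ≡ card S → ∀ {j} (g : Fin (3 + j) → Fin n) → Injective _≡_ _≡_ g → (∀ a → g a ∈ˢ S) →
    ¬ (∀ a b → Edge (Cyc j) a b → Adj (g a) (g b))
  tree-acyclic {S} cS count {j} g inj g∈ hom = <⇒≱ (≤-reflexive count) (+-cancelˡ-≤ (card C) _ _ (begin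
    card C + card S    ≤⟨ +-monoˡ-≤ (card S) C≤m ⟩
    m C + card S       ≤⟨ growth S C cS (zero , refl) (λ { _ (a , refl) → g∈ a }) ⟩
    m S + card C       ≡⟨ +-comm (m S) _ ⟩
    card C + m S       ∎))
    where
    open ≤-Reasoning
    C : DSet n
    C = ⟨ (λ x → ∃[ a ] (x ≡ g a)) , (λ x → any? (λ a → x Fin.≟ g a)) ⟩
    two : ∀ x → x ∈ˢ C → 2 ≤ deg C x
    two x (a , refl) with cyc-two a
    ... | b , c , c≢b , ab , ac = deg-two C (b , refl) (c , refl) (c≢b ∘ inj) (hom a b ab) (hom a c ac)
    C≤m : card C ≤ m C
    C≤m = *-cancelˡ-≤ 2 (begin
      2 * card C           ≡⟨ sym (sumOn-const C 2) ⟩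
      sumOn C (λ _ → 2)    ≤⟨ sumOn-mono C two ⟩
      e C C                ≡⟨ sym (double-m C) ⟩
      2 * m C              ∎)

  module _ (conn : Conn full) (P : Constituents full) (tree : suc (m (centres P)) ≡ card (centres P))
           {q′ : ℕ} (centre-enum : Enumeration (centres P) (suc q′))
           (petal-enum : ∀ c → ctr P c ≡ c → Enumeration (petal full (ctr P) c) k) where

    private
      module E = Enumeration centre-enum
      vᶜ : Fin (suc q′) → Fin n
      vᶜ = E.enum
      isC : ∀ i → ctr P (vᶜ i) ≡ vᶜ i
      isC i = proj₂ (E.enum-∈ i)
      module F i = Enumeration (petal-enum (vᶜ i) (isC i))
      Uᶜ : Fin (suc q′) → Fin k → Fin n
      Uᶜ i = F.enum i
      U-ctr : ∀ i a → ctr P (Uᶜ i a) ≡ vᶜ i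
      U-ctr i a = proj₁ (proj₂ (F.enum-∈ i a))
      hookᶜ : ∀ i → ∃[ a ] (hook P (vᶜ i) ≡ Uᶜ i a)
      hookᶜ i = F.enum-onto i _ (hook-∈ P (vᶜ i) tt (isC i))
      index : ∀ x → ctr P x ≡ x → ∃[ i ] (x ≡ vᶜ i)
      index x cx = E.enum-onto x (tt , cx)
      U-injᶜ : ∀ i a j b → Uᶜ i a ≡ Uᶜ j b → i ≡ j × a ≡ b
      U-injᶜ i a j b eq with E.enum-inj (trans (sym (U-ctr i a)) (trans (cong (ctr P) eq) (U-ctr j b)))
      ... | refl = refl , F.enum-inj i eq
      vU : ∀ i j a → vᶜ i ≢ Uᶜ j a
      vU i j a eq = proj₂ (proj₂ (F.enum-∈ j a)) (trans (sym eq) (trans (sym (isC i)) (trans (cong (ctr P) eq) (U-ctr j a))))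
      in-petal : ∀ x → ctr P x ≢ x → ∃[ i ] ((ctr P x ≡ vᶜ i) × ∃[ a ] (x ≡ Uᶜ i a))
      in-petal x x≢ with index (ctr P x) (ctr-idem P x tt)
      ... | i , q with F.enum-onto i x (tt , q , λ x≡ → x≢ (trans q (sym x≡)))
      ...   | a , r = i , q , a , r
      Tᶜ : Graph (suc q′)
      Tᶜ = record { adj = λ a b → adj G (vᶜ a) (vᶜ b) ; adjSym = λ a b → adjSym G _ _ ; loopless = λ a → loopless G _ }
      snoc : ∀ {a b c} → Reach Tᶜ a b → Edge Tᶜ b c → Reach Tᶜ a c
      snoc here p = step p here
      snoc (step p r) s = step p (snoc r s)
      -- Walks in G are projected by `ctr`: by `separate`, an edge either stays within a constituent
      -- and projects to a point, or joins two centres and is an edge of the tree.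
      reach : ∀ a b → Reach Tᶜ a b
      reach a b = spread conn (λ y → ∀ c → vᶜ c ≡ ctr P y → Reach Tᶜ a c) tt
        (λ c q → subst (Reach Tᶜ a) (E.enum-inj (sym (trans q (isC a)))) here) cl (vᶜ b) tt b (sym (isC b))
        where
        cl : ∀ y z → ⊤ → ⊤ → (∀ c → vᶜ c ≡ ctr P y → Reach Tᶜ a c) → Adj y z → ∀ c → vᶜ c ≡ ctr P z → Reach Tᶜ a c
        cl y z _ _ Xy yz c q with separate P y z tt tt yz
        ... | inj₁ eq = Xy c (trans q (sym eq))
        ... | inj₂ (cy , cz) with index y cy
        ...   | b , refl = snoc (Xy b (sym cy)) (subst (Adj y) (sym (trans q cz)) yz)
      conn-centres : Conn (centres P)
      conn-centres = record
        { inhabited = vᶜ zero , E.enum-∈ zero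
        ; spread = λ X {x} x∈ Xx cl y y∈ → subst X (proj₂ y∈)
            (spread conn (λ z → X (ctr P z)) {x} tt (subst X (sym (proj₂ x∈)) Xx)
              (λ a b _ _ Xa ab → [ (λ eq → subst X eq Xa)
                                 , (λ { (ca , cb) → subst X (sym cb) (cl a b (tt , ca) (tt , cb) (subst X ca Xa) ab) }) ]′ (separate P a b tt tt ab)) y tt) }
      sound : ∀ x y → Edge G x y → SpecEdge vᶜ Uᶜ (proj₁ ∘ hookᶜ) Tᶜ (λ (_ : Fin 1) → vᶜ (fromℕ q′)) (K 1) x y
      sound x y xy with ctr P x Fin.≟ x | ctr P y Fin.≟ y | separate P x y tt tt xy
      ... | yes cx | yes cy | _ with index x cx | index y cy
      ...   | a , refl | b , refl = inj₁ (a , b , refl , refl , xy)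
      sound x y xy | yes cx | no c≢ | inj₂ (_ , cy) = contradiction cy c≢
      sound x y xy | no c≢ | _ | inj₂ (cx , _) = contradiction cx c≢
      sound x y xy | yes cx | no c≢ | inj₁ eq with index x cx
      ... | i , refl = inj₂ (inj₂ (inj₂ (i , inj₂ (refl , trans
              (hook-unique P x y tt cx (tt , trans (sym eq) cx , λ { refl → c≢ cx }) xy) (proj₂ (hookᶜ i))))))
      sound x y xy | no c≢ | yes cy | inj₁ eq with index y cy
      ... | i , refl = inj₂ (inj₂ (inj₂ (i , inj₁ (trans
              (hook-unique P y x tt cy (tt , trans eq cy , λ { refl → c≢ cy }) (Adj-sym xy)) (proj₂ (hookᶜ i)) , refl))))
      sound x y xy | no x≢ | no y≢ | inj₁ eq with in-petal x x≢ | in-petal y y≢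
      ... | i , p , a , refl | j , q , b , refl with E.enum-inj (trans (sym p) (trans eq q))
      ...   | refl = inj₂ (inj₂ (inj₁ (i , a , b , refl , refl , λ { refl → Adj-irrefl xy refl })))
      complete : ∀ x y → SpecEdge vᶜ Uᶜ (proj₁ ∘ hookᶜ) Tᶜ (λ (_ : Fin 1) → vᶜ (fromℕ q′)) (K 1) x y → Edge G x y
      complete x y (inj₁ (a , b , refl , refl , p)) = p
      complete x y (inj₂ (inj₁ (zero , zero , _ , _ , ())))
      complete x y (inj₂ (inj₂ (inj₁ (i , a , b , refl , refl , ne)))) =
        Clique.pairwise (petal-clique P tt (isC i)) x y (F.enum-∈ i a) (F.enum-∈ i b) (ne ∘ F.enum-inj i)
      complete x y (inj₂ (inj₂ (inj₂ (i , inj₁ (q , refl))))) =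
        subst (λ z → Adj z y) (sym (trans q (sym (proj₂ (hookᶜ i))))) (Adj-sym (hook-adj P y tt (isC i)))
      complete x y (inj₂ (inj₂ (inj₂ (i , inj₂ (refl , q))))) =
        subst (Adj x) (sym (trans q (sym (proj₂ (hookᶜ i))))) (hook-adj P x tt (isC i))
      covered : ∀ x → (∃[ a ] (x ≡ (λ (_ : Fin 1) → vᶜ (fromℕ q′)) a)) ⊎ (∃[ i ] (x ≡ vᶜ i)) ⊎ (∃[ i ] ∃[ a ] (x ≡ Uᶜ i a))
      covered x with ctr P x Fin.≟ x
      ... | yes cx = inj₂ (inj₁ (index x cx))
      ... | no x≢ with in-petal x x≢
      ...   | i , _ , a , q = inj₂ (inj₂ (i , a , q))

    special-struct : SpecialStruct k q′ 0 G
    special-struct = record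
      { v = vᶜ ; U = Uᶜ ; u1 = proj₁ ∘ hookᶜ ; v-inj = E.enum-inj ; U-inj = U-injᶜ ; vU-disj = vU
      ; T = Tᶜ
      ; T-tree = (s≤s z≤n , reach) , (λ j em → tree-acyclic conn-centres tree (vᶜ ∘ proj₁ em) (proj₁ (proj₂ em) ∘ E.enum-inj)
                   (λ a → E.enum-∈ (proj₁ em a)) (proj₂ (proj₂ em)))
      -- As r = 0, the second tree is one vertex, placed at the last centre in the enumeration.
      ; p = 1 ; T' = K 1 ; w = λ _ → vᶜ (fromℕ q′)
      ; w-inj = λ { {zero} {zero} _ → refl }
      ; T'-tree = (s≤s z≤n , λ { zero zero → here }) , (λ j em → one j (proj₁ (proj₂ em)))
      ; T'-edges = refl
      ; w-vq = zero , refl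
      ; w-v = λ a i eq → E.enum-inj (sym eq)
      ; w-U = λ a i b → vU (fromℕ q′) i b
      ; cover = covered ; edges-sound = sound ; edges-complete = complete }
      where
      one : ∀ j {f : Fin (3 + j) → Fin 1} → ¬ Injective _≡_ _≡_ f
      one j {f} inj with inj {zero} {suc zero} (collapse (f zero) (f (suc zero)))
        where
        collapse : ∀ (a b : Fin 1) → a ≡ b
        collapse zero zero = refl
      ... | ()

-- Assembling the theorem

special-intro : ∀ {n} (G : Graph n) m k {q′} → (m + 1) / t k ≡ suc q′ → SpecialStruct k q′ ((m + 1) % t k) G → Special m k G
special-intro G m k eq st with (m + 1) / t k | eq
... | _ | refl = st

special-elim : ∀ {n} (G : Graph n) m k → Special m k G →
  ((m + 1) / t k ≡ 0) ⊎ ∃[ q′ ] ((m + 1) / t k ≡ suc q′ × SpecialStruct k q′ ((m + 1) % t k) G)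
special-elim G m k sp with (m + 1) / t k
... | zero   = inj₁ refl
... | suc q′ = inj₂ (q′ , refl , sp)

module Final {n : ℕ} (G : Graph n) (k′ ℓ : ℕ) (which : ℓ ≡ 1 ⊎ ℓ ≡ 2 ⊎ ℓ ≡ 3) (connected : Connected G)
             (¬clique : ¬ Iso G (K (suc k′))) {i : ℕ} (iota : IsIota G (𝓕 ℓ (suc k′)) i) where

  open InGraph G
  open Isolation G k′
  open Hub G k′
  open CoreCase G k′
  open Transfer G k′
  open Lower G k′ ℓ which
  open Build G k′

  iota-≥ : ∀ {b} → (∀ D → Isolating G (𝓕 ℓ k) D → b ≤ Sub.∣ D ∣) → b ≤ i
  iota-≥ lower with proj₁ iota
  ... | D , iso , refl = lower D iso

  outcome : τ * i ≤ m full ⊎ (τ * i ≤ suc (m full) × ∃[ q ] (τ * q ≡ suc (m full) × Extremal full q))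
  outcome with classify full (conn-full connected)
  ... | clique cl = contradiction (iso-clique cl) ¬clique
  ... | strict D iso le = inj₁ (≤-trans (*-monoʳ-≤ τ (iota-≤ iso which iota)) le)
  ... | tight D iso eq ext = inj₂ (≤-trans (*-monoʳ-≤ τ (iota-≤ iso which iota)) (≤-reflexive eq) , length D , eq , ext)

  module _ {μ : ℕ} (edges : edgeCount G ≡ μ) where

    private
      μ+1 : suc (m full) ≡ μ + 1
      μ+1 = trans (cong suc (trans m-full edges)) (+-comm 1 μ)

      tk : ∀ q → τ * q ≡ t k * q
      tk q = cong (_* q) 2+κ≡t

    bound : t k * i ≤ μ + 1
    bound with outcome
    ... | inj₁ le = subst₂ _≤_ (tk i) μ+1 (m≤n⇒m≤1+n le)
    ... | inj₂ (le , _) = subst₂ _≤_ (tk i) μ+1 le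

    i≤quotient : i ≤ (μ + 1) / t k
    i≤quotient = ≤-trans (≤-reflexive (sym (m*n/n≡m i (t k)))) (/-monoˡ-≤ (t k) (≤-trans (≤-reflexive (*-comm i (t k))) bound))

    special-value : Special μ k G → i ≡ (μ + 1) / t k
    special-value sp with special-elim G μ k sp
    ... | inj₁ eq = trans (n≤0⇒n≡0 (≤-trans i≤quotient (≤-reflexive eq))) (sym eq)
    ... | inj₂ (q′ , eq , st) = ≤-antisym i≤quotient (≤-trans (≤-reflexive eq) (iota-≥ (special-lower st)))

    Equality : Set
    Equality = PureSpecial μ k G ⊎ (k ≡ 2 × Iso G C5) ⊎ (k ≡ 3 × (ℓ ≡ 1 ⊎ ℓ ≡ 3) × Iso G C4)

    sharp : ∀ {b} → t k * b ≡ μ + 1 → b ≤ i → t k * i ≡ μ + 1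
    sharp eq b≤i = ≤-antisym bound (≤-trans (≤-reflexive (sym eq)) (*-monoʳ-≤ (t k) b≤i))

    equality-if : Equality → t k * i ≡ μ + 1
    equality-if (inj₁ (sp , r≡0)) = begin
      t k * i                                      ≡⟨ *-comm (t k) i ⟩
      i * t k                                      ≡⟨ cong (_* t k) (special-value sp) ⟩
      (μ + 1) / t k * t k                          ≡⟨ cong (_+ (μ + 1) / t k * t k) (sym r≡0) ⟩
      (μ + 1) % t k + (μ + 1) / t k * t k          ≡⟨ sym (m≡m%n+[m/n]*n (μ + 1) (t k)) ⟩
      μ + 1                                        ∎
      where open ≡-Reasoning
    equality-if (inj₂ (inj₁ (k≡2 , iso))) = sharp {2}
      (trans (cong (λ z → t z * 2) k≡2) (trans (cong suc (sym (pentagon-m (iso-to iso)))) μ+1))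
      (iota-≥ (pentagon-lower k≡2 (iso-to iso)))
    equality-if (inj₂ (inj₂ (k≡3 , ℓ13 , iso))) = sharp {1}
      (trans (cong (λ z → t z * 1) k≡3) (trans (cong suc (sym (square-m (iso-to iso)))) μ+1))
      (iota-≥ (square-lower k≡3 ℓ13 (iso-to iso)))

    equality-only-if : t k * i ≡ μ + 1 → Equality
    equality-only-if eq with outcome
    ... | inj₁ le = contradiction (trans (tk i) (trans eq (sym μ+1))) (<⇒≢ (s≤s le))
    ... | inj₂ (_ , q , τq , pentagon k≡2 io) = inj₂ (inj₁ (k≡2 , iso-from io))
    ... | inj₂ (_ , q , τq , square k≡3 io) = inj₂ (inj₂ (k≡3 , odd which refl , iso-from io))
      where
      odd : ∀ {ℓ′} → ℓ′ ≡ 1 ⊎ ℓ′ ≡ 2 ⊎ ℓ′ ≡ 3 → ℓ′ ≡ ℓ → ℓ ≡ 1 ⊎ ℓ ≡ 3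
      odd (inj₁ refl) refl = inj₁ refl
      odd (inj₂ (inj₂ refl)) refl = inj₂ refl
      odd (inj₂ (inj₁ refl)) refl = contradiction (trans (sym (trans (cong (t k *_) i≡0) (*-zeroʳ (t k)))) (trans eq (+-comm μ 1))) λ ()
        where
        i≡0 : i ≡ 0
        i≡0 = square-bipartite {G = G} (iso-from io) (subst (λ z → IsIota G (𝓕 2 z) i) k≡3 iota)
    -- The q centres carry q - 1 edges, so `m (centres P)` is the predecessor of the quotient q, and
    -- τ q = m + 1 leaves no remainder.
    ... | inj₂ (_ , q , τq , special P cd md) = inj₁ (special-intro G μ k quotient
            (subst (λ r → SpecialStruct k (m (centres P)) r G) (sym remainder)
              (special-struct (conn-full connected) P (trans md (sym cd)) (enumerate _ (centres P) (trans cd (sym md)))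
                (λ c cc → enumerate k (petal full (ctr P) c) (petal-size P c tt cc)))) , remainder)
      where
      total : μ + 1 ≡ q * t k
      total = trans (sym μ+1) (trans (sym τq) (trans (tk q) (*-comm (t k) q)))
      quotient : (μ + 1) / t k ≡ suc (m (centres P))
      quotient = trans (cong (_/ t k) total) (trans (m*n/n≡m q (t k)) (sym md))
      remainder : (μ + 1) % t k ≡ 0
      remainder = trans (cong (_% t k) total) (m*n%n≡0 q (t k))

theorem1p3 : (k ℓ m : ℕ) {n : ℕ} (G : Graph n) →
    1 ≤ k → (ℓ ≡ 1 ⊎ ℓ ≡ 2 ⊎ ℓ ≡ 3) →
    Connected G → edgeCount G ≡ m → ¬ Iso G (K k) →
    (i : ℕ) → IsIota G (𝓕 ℓ k) i →
    (t k * i ≤ m + 1)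
    × ((t k * i ≡ m + 1) ⇔
    (PureSpecial m k G
    ⊎ (k ≡ 2 × Iso G C5)
    ⊎ (k ≡ 3 × (ℓ ≡ 1 ⊎ ℓ ≡ 3) × Iso G C4)))
    × (Special m k G → i ≡ (m + 1) / t k)
theorem1p3 (suc k′) ℓ m G _ which connected edges ¬clique i iota =
  bound edges , mk⇔ (equality-only-if edges) (equality-if edges) , special-value edges
  where open Final G k′ ℓ which connected ¬clique iota
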